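{- For every $n\in\mathbb N$, $n\ge 1$: $\mathrm{XC}_n\le_{\mathrm W}\mathrm{Sort}_{n+1}$.
   Context: A represented space $\mathbf X$ is a set $X$ with a partial surjection $\delta_{\mathbf X}:\subseteq\mathbb N^{\mathbb N}\to X$ (a $p$ with $\delta_{\mathbf X}(p)=x$ is a name of $x$). A realizer of a (partial) multivalued function $f:\subseteq\mathbf X\rightrightarrows\mathbf Y$ is a partial $F:\subseteq\mathbb N^{\mathbb N}\to\mathbb N^{\mathbb N}$ with $\delta_{\mathbf Y}(F(p))\in f(\delta_{\mathbf X}(p))$ for all names $p$ of points of $\mathrm{dom}(f)$; write $F\vdash f$. Weihrauch reducibility: $f\le_{\mathrm W}g$ iff there are computable $H,K:\subseteq\mathbb N^{\mathbb N}\to\mathbb N^{\mathbb N}$ such that $(p\mapsto K\langle p,GH(p)\rangle)\vdash f$ for every $G\vdash g$. $\mathcal A(\mathbf X)$ is the represented space of closed subsets of $\mathbf X$ with negative information: a name of $A$ is a name of the open set $X\setminus A$ (its continuous characteristic function into Sierpiński space). Closed choice $\mathrm C_{\mathbf X}:\subseteq\mathcal A(\mathbf X)\rightrightarrows\mathbf X$ maps a non-empty closed set $A$ to an arbitrary point of $A$. $\mathrm{XC}_n$ is the restriction of $\mathrm C_{[0,1]^n}$ to (non-empty closed) convex sets. $\mathrm{Sort}_d:\{0,\dots,d-1\}^\omega\to\{0,\dots,d-1\}^\omega$ is defined by $\mathrm{Sort}_d(p)=0^{c_0}1^{c_1}\cdots(m-1)^{c_{m-1}}m^{\infty}$, where $m$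 is the least symbol occurring infinitely often in $p$ and $c_l=|\{n: p(n)=l\}|$ for $l<m$. -}

module Defs where

open import Axiom.UniquenessOfIdentityProofs using (module Decidable⇒UIP)
open import Data.Bool using (Bool; true; false)
open import Data.Empty using (⊥-elim)
open import Data.Fin using (Fin; Fin′; toℕ; inject; #_) renaming (zero to fzero; suc to fsuc)
open import Data.Fin.Properties using (toℕ-injective; toℕ<n; toℕ-fromℕ<; _≟_)
open import Data.Integer as ℤ using (+_; -[1+_])
import Data.Integer.Properties as ℤ
open import Data.List as List using (List; []; _∷_)
open import Data.Nat using (ℕ; zero; suc; _<_; z≤n; s≤s; NonZero; _⊔_; _/_; _%_)
  renaming (_+_ to _+ℕ_; _*_ to _*ℕ_; _≤_ to _≤ℕ_; _^_ to _^ℕ_)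
import Data.Nat.Properties as ℕ
open import Data.Nat.Divisibility using (divides-refl)
open import Data.Nat.DivMod
  using (_mod_; [m+kn]%n≡m%n; m<n⇒m%n≡m; m%n<n; +-distrib-/-∣ʳ; m<n⇒m/n≡0; m*n/n≡m)
open import Data.Product using (Σ; ∃; _×_; _,_; proj₁; proj₂; Σ-syntax; ∃-syntax)
open import Data.Rational as ℚ using (ℚ; 0ℚ; 1ℚ; ½; mkℚ)
import Data.Rational.Properties as ℚ
import Data.Rational.Unnormalised as ℚᵘ
import Data.Rational.Unnormalised.Properties as ℚᵘ
open import Data.Rational.Solver using (module +-*-Solver)
open import Data.Vec using (Vec; []; _∷_; lookup)
open import Data.Vec.Relation.Binary.Pointwise.Inductive using (Pointwise)
open import Function using (_∘_)
open import Function.Bundles using (_↔_; _⇔_; mk⇔; mk↔ₛ′; Equivalence)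
open import Function.Construct.Composition using (_↔-∘_)
open import Level using (0ℓ)
open import Relation.Binary.Bundles using (Setoid)
open import Relation.Binary.Definitions using (tri<; tri≈; tri>)
import Relation.Binary.Construct.On as On
open import Relation.Binary.PropositionalEquality
  using (_≡_; _≢_; _≗_; refl; sym; trans; cong; cong₂; subst; module ≡-Reasoning)
open import Relation.Nullary using (¬_)

------------------------------------------------------------------------
-- Baire space and partial functions on it

Baire : Set
Baire = ℕ → ℕ

-- A partial function is a single-valued relation; without function
-- extensionality, pointwise equality plays the role of equality.
record PartialFunction : Set₁ where
  field
    graph      : Baire → Baire → Set
    resp       : ∀ {p p′ q q′} → p ≗ p′ → q ≗ q′ → graph p q → graph p′ q′
    functional : ∀ {p q q′} → graph p q → graph p q′ → q ≗ q′

open PartialFunction public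

-- ⟨ p , q ⟩ is p 0, q 0, p 1, q 1, …
⟨_,_⟩ : Baire → Baire → Baire
⟨ p , q ⟩ zero    = p zero
⟨ p , q ⟩ (suc n) = ⟨ q , p ∘ suc ⟩ n

⟨⟩-cong : ∀ {p p′ q q′} → p ≗ p′ → q ≗ q′ → ⟨ p , q ⟩ ≗ ⟨ p′ , q′ ⟩
⟨⟩-cong e f zero    = e zero
⟨⟩-cong e f (suc n) = ⟨⟩-cong f (e ∘ suc) n

-- p ↦ K ⟨ p , G (H p) ⟩
wrap : PartialFunction → PartialFunction → PartialFunction → PartialFunction
wrap H K G = record
  { graph      = λ p r → ∃[ q ] ∃[ s ] graph H p q × graph G q s × graph K ⟨ p , s ⟩ r
  ; resp       = λ e f (q , s , h , g , k) →
      q , s , resp H e (λ _ → refl) h , g , resp K (⟨⟩-cong e (λ _ → refl)) f k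
  ; functional = λ {p} (q , s , h , g , k) (q′ , s′ , h′ , g′ , k′) →
      let q≗q′ = functional H h h′
          s≗s′ = functional G g (resp G (λ n → sym (q≗q′ n)) (λ _ → refl) g′)
      in functional K k
           (resp K (⟨⟩-cong (λ _ → refl) (λ n → sym (s≗s′ n))) (λ _ → refl) k′)
  }

------------------------------------------------------------------------
-- Computability: μ-recursive functions relative to an oracle

data Code : ℕ → Set where
  zero   : ∀ {n} → Code n
  succ   : Code 1
  proj   : ∀ {n} → Fin n → Code n
  oracle : Code 1
  comp   : ∀ {m n} → Code m → Vec (Code n) m → Code n
  prec   : ∀ {n} → Code n → Code (2 +ℕ n) → Code (1 +ℕ n)
  min    : ∀ {n} → Code (1 +ℕ n) → Code n

-- p ⊢ e [ xs ]⇓ y : with oracle p, program e on input xs halts with output y.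
data _⊢_[_]⇓_ (p : Baire) : ∀ {n} → Code n → Vec ℕ n → ℕ → Set where
  zero⇓   : ∀ {n} {xs : Vec ℕ n} → p ⊢ zero [ xs ]⇓ 0
  succ⇓   : ∀ {x} → p ⊢ succ [ x ∷ [] ]⇓ suc x
  proj⇓   : ∀ {n} {i : Fin n} {xs} → p ⊢ proj i [ xs ]⇓ lookup xs i
  oracle⇓ : ∀ {x} → p ⊢ oracle [ x ∷ [] ]⇓ p x
  comp⇓   : ∀ {m n} {f : Code m} {gs : Vec (Code n) m} {xs ys z} →
            Pointwise (λ g y → p ⊢ g [ xs ]⇓ y) gs ys →
            p ⊢ f [ ys ]⇓ z → p ⊢ comp f gs [ xs ]⇓ z
  prec0⇓  : ∀ {n} {f : Code n} {g xs y} →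
            p ⊢ f [ xs ]⇓ y → p ⊢ prec f g [ 0 ∷ xs ]⇓ y
  precs⇓  : ∀ {n} {f : Code n} {g xs m r y} →
            p ⊢ prec f g [ m ∷ xs ]⇓ r → p ⊢ g [ m ∷ r ∷ xs ]⇓ y →
            p ⊢ prec f g [ suc m ∷ xs ]⇓ y
  min⇓    : ∀ {n} {f : Code (1 +ℕ n)} {xs k} →
            p ⊢ f [ k ∷ xs ]⇓ 0 →
            (∀ {j} → j < k → ∃[ r ] p ⊢ f [ j ∷ xs ]⇓ suc r) →
            p ⊢ min f [ xs ]⇓ k

-- The domain of F may be smaller than that of the program.
Computable : PartialFunction → Set
Computable F = ∃[ e ] ∀ {p q} → graph F p q → ∀ n → p ⊢ e [ n ∷ [] ]⇓ q n

------------------------------------------------------------------------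
-- Represented spaces, multivalued functions, Weihrauch reducibility

record RepresentedSpace : Set₁ where
  infix 4 _names_
  field
    setoid : Setoid 0ℓ 0ℓ
  open Setoid setoid public using (Carrier; _≈_)
    renaming (refl to ≈-refl; sym to ≈-sym; trans to ≈-trans)
  field
    _names_    : Baire → Carrier → Set
    resp-names : ∀ {p q x y} → p ≗ q → x ≈ y → p names x → q names y
    unique     : ∀ {p x y} → p names x → p names y → x ≈ y
    surjective : ∀ x → ∃[ p ] p names x

open RepresentedSpace public using (Carrier)

infix 0 _⇉_
record _⇉_ (X Y : RepresentedSpace) : Set₁ where
  private
    module X = RepresentedSpace X
    module Y = RepresentedSpace Y
  field
    rel      : X.Carrier → Y.Carrier → Set
    resp-rel : ∀ {x x′ y y′} → x X.≈ x′ → y Y.≈ y′ → rel x y → rel x′ y′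
  dom : X.Carrier → Set
  dom x = ∃ (rel x)

open _⇉_ public

infix 4 _⊩_ _≤W_

-- F is a realizer of f.
_⊩_ : ∀ {X Y} → PartialFunction → (X ⇉ Y) → Set
_⊩_ {X} {Y} F f = ∀ {p x} → p X.names x → dom f x →
    ∃[ q ] graph F p q × ∃[ y ] q Y.names y × rel f x y
  where module X = RepresentedSpace X
        module Y = RepresentedSpace Y

_≤W_ : ∀ {X Y X′ Y′} → (X ⇉ Y) → (X′ ⇉ Y′) → Set₁
f ≤W g = Σ[ H ∈ PartialFunction ] Σ[ K ∈ PartialFunction ]
  Computable H × Computable K × (∀ G → G ⊩ g → wrap H K G ⊩ f)

restrict : ∀ {X Y} (f : X ⇉ Y) (P : Carrier X → Set) →
           (∀ {x x′} → RepresentedSpace._≈_ X x x′ → P x → P x′) → X ⇉ Y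
restrict f P P-resp = record
  { rel      = λ x y → P x × rel f x y
  ; resp-rel = λ e e′ (Px , r) → P-resp e Px , resp-rel f e e′ r
  }

------------------------------------------------------------------------
-- Constructions of represented spaces

Subspace : (X : RepresentedSpace) → (Carrier X → Set) → RepresentedSpace
Subspace X P = record
  { setoid     = On.setoid {B = Σ X.Carrier P} X.setoid proj₁
  ; _names_    = λ p x → p X.names proj₁ x
  ; resp-names = X.resp-names
  ; unique     = X.unique
  ; surjective = λ x → X.surjective (proj₁ x)
  }
  where module X = RepresentedSpace X

-- A sequence encodes n sequences, interleaved with period n.
column : ∀ n → Baire → Fin n → Baire
column n p j i = p (toℕ j +ℕ i *ℕ n)

weave : ∀ n .{{_ : NonZero n}} → (Fin n → Baire) → Baire
weave n P k = P (k mod n) (k / n)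

column-weave : ∀ n .{{_ : NonZero n}} P j → column n (weave n P) j ≗ P j
column-weave n P j i = cong₂ P
  (toℕ-injective (begin
    toℕ ((toℕ j +ℕ i *ℕ n) mod n)  ≡⟨ toℕ-fromℕ< (m%n<n (toℕ j +ℕ i *ℕ n) n) ⟩
    (toℕ j +ℕ i *ℕ n) % n          ≡⟨ [m+kn]%n≡m%n (toℕ j) i n ⟩
    toℕ j % n                      ≡⟨ m<n⇒m%n≡m (toℕ<n j) ⟩
    toℕ j                          ∎))
  (begin
    (toℕ j +ℕ i *ℕ n) / n          ≡⟨ +-distrib-/-∣ʳ (toℕ j) (divides-refl i) ⟩
    toℕ j / n +ℕ i *ℕ n / n        ≡⟨ cong₂ _+ℕ_ (m<n⇒m/n≡0 (toℕ<n j)) (m*n/n≡m i n) ⟩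
    i                              ∎)
  where open ≡-Reasoning

Power : RepresentedSpace → ℕ → RepresentedSpace
Power X n = record
  { setoid     = record
      { Carrier       = Fin n → X.Carrier
      ; _≈_           = λ x y → ∀ j → x j X.≈ y j
      ; isEquivalence = record
          { refl  = λ _ → X.≈-refl
          ; sym   = λ e j → X.≈-sym (e j)
          ; trans = λ e f j → X.≈-trans (e j) (f j)
          }
      }
  ; _names_    = λ p x → ∀ j → column n p j X.names x j
  ; resp-names = λ e f h j → X.resp-names (λ i → e _) (f j) (h j)
  ; unique     = λ h h′ j → X.unique (h j) (h′ j)
  ; surjective = onto n
  }
  where
  module X = RepresentedSpace X
  onto : ∀ n (x : Fin n → X.Carrier) → ∃[ p ] (∀ j → column n p j X.names x j)
  onto zero    x = (λ _ → 0) , λ ()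
  onto (suc n) x = weave (suc n) (λ j → proj₁ (X.surjective (x j))) , λ j →
    X.resp-names (λ i → sym (column-weave (suc n) (λ j → proj₁ (X.surjective (x j))) j i)) X.≈-refl
      (proj₂ (X.surjective (x j)))

-- A bijection List ℕ → ℕ.
code : List ℕ → ℕ
code []       = 0
code (a ∷ as) = 2 ^ℕ a *ℕ suc (2 *ℕ code as)

-- The partial function with Kleene associate p: to find value number n at
-- q, look for the first k at which p, applied to (the code of) n followed by
-- q 0, …, q (k - 1), is nonzero.
Answer : Baire → Baire → ℕ → ℕ → ℕ → Set
Answer p q n k m =
  p (query k) ≡ suc m × (∀ {j} → j < k → p (query j) ≡ 0)
  where query : ℕ → ℕ
        query j = code (n ∷ List.applyUpTo q j)

applyUpTo-cong : {f g : Baire} → f ≗ g → List.applyUpTo f ≗ List.applyUpTo g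
applyUpTo-cong e zero    = refl
applyUpTo-cong e (suc k) = cong₂ _∷_ (e 0) (applyUpTo-cong (e ∘ suc) k)

associated : Baire → PartialFunction
associated p = record
  { graph      = λ q r → ∀ n → ∃[ k ] Answer p q n k (r n)
  ; resp       = resp′
  ; functional = λ {q} a a′ n → same {q} {n} (proj₂ (a n)) (proj₂ (a′ n))
  }
  where
  resp′ : ∀ {q q′ r r′} → q ≗ q′ → r ≗ r′ →
          (∀ n → ∃[ k ] Answer p q n k (r n)) → (∀ n → ∃[ k ] Answer p q′ n k (r′ n))
  resp′ e f a n with a n
  ... | k , b , c = k
      , trans (cong (λ w → p (code (n ∷ w))) (sym (applyUpTo-cong e k)))
              (trans b (cong suc (f n)))
      , λ {j} j<k → trans (cong (λ w → p (code (n ∷ w))) (sym (applyUpTo-cong e j))) (c j<k)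

  same : ∀ {q n k k′ m m′} → Answer p q n k m → Answer p q n k′ m′ → m ≡ m′
  same {k = k} {k′} (b , c) (b′ , c′) with ℕ.<-cmp k k′
  ... | tri< k<k′ _ _ with () ← trans (sym b) (c′ k<k′)
  ... | tri≈ _ refl _ = ℕ.suc-injective (trans (sym b) b′)
  ... | tri> _ _ k′<k with () ← trans (sym b′) (c k′<k)

-- The space C(X,Y): a name of f is an associate of a realizer of f.
module _ (X Y : RepresentedSpace) where
  private
    module X = RepresentedSpace X
    module Y = RepresentedSpace Y

  record _⟶_ : Set where
    field
      to          : X.Carrier → Y.Carrier
      to-cong     : ∀ {x x′} → x X.≈ x′ → to x Y.≈ to x′

    asMultivalued : X ⇉ Y
    asMultivalued = record
      { rel      = λ x y → to x Y.≈ y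
      ; resp-rel = λ e f g → Y.≈-trans (to-cong (X.≈-sym e)) (Y.≈-trans g f)
      }

    field
      continuous  : ∃[ p ] associated p ⊩ asMultivalued

  open _⟶_ public

  Continuous : RepresentedSpace
  Continuous = record
    { setoid     = record
        { Carrier       = _⟶_
        ; _≈_           = λ f g → ∀ x → to f x Y.≈ to g x
        ; isEquivalence = record
            { refl  = λ _ → Y.≈-refl
            ; sym   = λ e x → Y.≈-sym (e x)
            ; trans = λ e f x → Y.≈-trans (e x) (f x)
            }
        }
    ; _names_    = λ p f → associated p ⊩ asMultivalued f
    ; resp-names = λ {p} {p′} {f} {g} → resp′ {p} {p′} {f} {g}
    ; unique     = λ {p} {f} {g} → unique′ {p} {f} {g}
    ; surjective = continuous
    }
    where
    resp′ : ∀ {p p′ f g} → p ≗ p′ → (∀ x → to f x Y.≈ to g x) →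
            associated p ⊩ asMultivalued f → associated p′ ⊩ asMultivalued g
    resp′ {p} {p′} e f≈g h {q} {x} qx _ with h qx (_ , Y.≈-refl)
    ... | r , a , y , ry , fx≈y =
      r , a′ , y , ry , Y.≈-trans (Y.≈-sym (f≈g x)) fx≈y
      where
      a′ : graph (associated p′) q r
      a′ n with a n
      ... | k , b , c = k , trans (sym (e _)) b , λ j<k → trans (sym (e _)) (c j<k)

    unique′ : ∀ {p f g} → associated p ⊩ asMultivalued f → associated p ⊩ asMultivalued g →
              ∀ x → to f x Y.≈ to g x
    unique′ {p} h h′ x with X.surjective x
    ... | q , qx with h qx (_ , Y.≈-refl) | h′ qx (_ , Y.≈-refl)
    ... | r , a , y , ry , e | r′ , a′ , y′ , ry′ , e′ =
      Y.≈-trans e (Y.≈-trans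
        (Y.unique (Y.resp-names (functional (associated p) a a′) Y.≈-refl ry) ry′)
        (Y.≈-sym e′))

-- Sierpiński space; true is the open point.
𝕊 : RepresentedSpace
𝕊 = record
  { setoid     = setoidOf Bool
  ; _names_    = λ p b → b ≡ true ⇔ (∃[ n ] p n ≢ 0)
  ; resp-names = λ { e refl h → mk⇔
      (λ b → let n , d = Equivalence.to h b in n , λ z → d (trans (e n) z))
      (λ (n , d) → Equivalence.from h (n , λ z → d (trans (sym (e n)) z))) }
  ; unique     = λ {p} {b} {c} → unique′ {p} {b} {c}
  ; surjective = λ { true  → (λ _ → 1) , mk⇔ (λ _ → 0 , λ ()) (λ _ → refl)
                   ; false → (λ _ → 0) , mk⇔ (λ ()) (λ (_ , d) → ⊥-elim (d refl)) }
  }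
  where
  open import Relation.Binary.PropositionalEquality.Properties using ()
    renaming (setoid to setoidOf)
  unique′ : ∀ {p b c} → (b ≡ true ⇔ (∃[ n ] p n ≢ 0)) →
            (c ≡ true ⇔ (∃[ n ] p n ≢ 0)) → b ≡ c
  unique′ {b = true}  {true}  h h′ = refl
  unique′ {b = true}  {false} h h′ = sym (Equivalence.from h′ (Equivalence.to h refl))
  unique′ {b = false} {true}  h h′ = Equivalence.from h (Equivalence.to h′ refl)
  unique′ {b = false} {false} h h′ = refl

𝒪 : RepresentedSpace → RepresentedSpace
𝒪 X = Continuous X 𝕊

-- Closed sets with negative information: a closed set is given by (the
-- characteristic function of) its complement.  Under excluded middle, which
-- the theorem assumes, Bool-valued characteristic functions are arbitrary
-- subsets.
𝒜 : RepresentedSpace → RepresentedSpace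
𝒜 = 𝒪

module _ {X : RepresentedSpace} where
  infix 4 _∈_
  _∈_ : Carrier X → Carrier (𝒜 X) → Set
  x ∈ A = to A x ≡ false

closedChoice : ∀ X → 𝒜 X ⇉ X
closedChoice X = record
  { rel      = λ A x → _∈_ {X} x A
  ; resp-rel = λ {A} {A′} {x} {x′} e f h →
      trans (sym (e x′)) (trans (sym (to-cong A f)) h)
  }

------------------------------------------------------------------------
-- Real numbers

2⁻_ : ℕ → ℚ
2⁻ zero  = 1ℚ
2⁻ suc i = ½ ℚ.* 2⁻ i

private
  left : ∀ {i j k} → i ⊔ j ≤ℕ k → i ≤ℕ k
  left {i} {j} = ℕ.≤-trans (ℕ.m≤m⊔n i j)

  right : ∀ {i j k} → i ⊔ j ≤ℕ k → j ≤ℕ k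
  right {i} {j} = ℕ.≤-trans (ℕ.m≤n⊔m i j)

  half : ℚ → ℚ
  half ε = ½ ℚ.* ε

  half+half : ∀ ε → half ε ℚ.+ half ε ≡ ε
  half+half = solve 1 (λ ε → con ½ :* ε :+ con ½ :* ε := ε) refl
    where open +-*-Solver

  half>0 : ∀ {ε} → 0ℚ ℚ.< ε → 0ℚ ℚ.< half ε
  half>0 = ℚ.*-monoʳ-<-pos ½

  ≤-abs : ∀ x → x ℚ.≤ ℚ.∣ x ∣
  ≤-abs x@(mkℚ (+ n) _ _)    = ℚ.≤-refl
  ≤-abs x@(mkℚ -[1+ n ] _ _) = ℚ.≤-trans (ℚ.<⇒≤ (ℚ.negative⁻¹ x)) (ℚ.0≤∣p∣ x)

  diff≤ : ∀ {x y ε} → ℚ.∣ x ℚ.- y ∣ ℚ.≤ ε → x ℚ.≤ y ℚ.+ ε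
  diff≤ {x} {y} h = subst (ℚ._≤ _) (e x y)
      (ℚ.+-monoʳ-≤ y (ℚ.≤-trans (≤-abs (x ℚ.- y)) h))
    where open +-*-Solver
          e : ∀ x y → y ℚ.+ (x ℚ.- y) ≡ x
          e = solve 2 (λ x y → y :+ (x :- y) := x) refl

  diff-comm : ∀ x y → ℚ.∣ x ℚ.- y ∣ ≡ ℚ.∣ y ℚ.- x ∣
  diff-comm x y = trans (cong ℚ.∣_∣ (e x y)) (ℚ.∣-p∣≡∣p∣ (y ℚ.- x))
    where open +-*-Solver
          e : ∀ x y → x ℚ.- y ≡ ℚ.- (y ℚ.- x)
          e = solve 2 (λ x y → x :- y := :- (y :- x)) refl

  2⁻>0 : ∀ i → 0ℚ ℚ.< 2⁻ i
  2⁻>0 zero    = ℚ.positive⁻¹ 1ℚ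
  2⁻>0 (suc i) = half>0 (2⁻>0 i)

-- Cauchy sequences of rationals, with _≈ᵣ_ below as equality.
record ℝ : Set where
  constructor mkℝ
  field
    seq    : ℕ → ℚ
    cauchy : ∀ {ε} → 0ℚ ℚ.< ε → ∃[ N ] ∀ {m n} → N ≤ℕ m → N ≤ℕ n →
             ℚ.∣ seq m ℚ.- seq n ∣ ℚ.≤ ε

open ℝ public

infix 4 _≤_ _≈ᵣ_

_≤_ : ℝ → ℝ → Set
x ≤ y = ∀ {ε} → 0ℚ ℚ.< ε → ∃[ N ] ∀ {n} → N ≤ℕ n → seq x n ℚ.≤ seq y n ℚ.+ ε

_≈ᵣ_ : ℝ → ℝ → Set
x ≈ᵣ y = x ≤ y × y ≤ x

≤-refl : ∀ {x} → x ≤ x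
≤-refl {x} {ε} ε>0 = 0 , λ {n} _ →
  subst (ℚ._≤ seq x n ℚ.+ ε) (ℚ.+-identityʳ (seq x n)) (ℚ.+-monoʳ-≤ (seq x n) (ℚ.<⇒≤ ε>0))

≤-trans : ∀ {x y z} → x ≤ y → y ≤ z → x ≤ z
≤-trans {x} {y} {z} h k {ε} ε>0 with h (half>0 ε>0) | k (half>0 ε>0)
... | M , u | N , v = M ⊔ N , λ {n} l → begin
  seq x n                                ≤⟨ u (left {M} l) ⟩
  seq y n ℚ.+ half ε                     ≤⟨ ℚ.+-monoˡ-≤ (half ε) (v (right {M} l)) ⟩
  (seq z n ℚ.+ half ε) ℚ.+ half ε        ≡⟨ ℚ.+-assoc (seq z n) (half ε) (half ε) ⟩
  seq z n ℚ.+ (half ε ℚ.+ half ε)        ≡⟨ cong (seq z n ℚ.+_) (half+half ε) ⟩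
  seq z n ℚ.+ ε                          ∎
  where open ℚ.≤-Reasoning

fromℚ : ℚ → ℝ
fromℚ r = mkℝ (λ _ → r) λ {ε} ε>0 → 0 , λ _ _ →
  subst (λ d → ℚ.∣ d ∣ ℚ.≤ ε) (sym (ℚ.+-inverseʳ r)) (ℚ.<⇒≤ ε>0)

0ℝ 1ℝ : ℝ
0ℝ = fromℚ 0ℚ
1ℝ = fromℚ 1ℚ

infixl 6 _+_ _-_
infixl 7 _*_

_+_ : ℝ → ℝ → ℝ
x + y = mkℝ (λ n → seq x n ℚ.+ seq y n) c
  where
  open +-*-Solver
  rearrange : ∀ a b c d → (a ℚ.+ b) ℚ.- (c ℚ.+ d) ≡ (a ℚ.- c) ℚ.+ (b ℚ.- d)
  rearrange = solve 4 (λ a b c d → (a :+ b) :- (c :+ d) := (a :- c) :+ (b :- d)) refl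
  c : ∀ {ε} → 0ℚ ℚ.< ε → ∃[ N ] ∀ {m n} → N ≤ℕ m → N ≤ℕ n →
      ℚ.∣ (seq x m ℚ.+ seq y m) ℚ.- (seq x n ℚ.+ seq y n) ∣ ℚ.≤ ε
  c {ε} ε>0 with cauchy x (half>0 ε>0) | cauchy y (half>0 ε>0)
  ... | M , u | N , v = M ⊔ N , λ {m} {n} l l′ → begin
    ℚ.∣ (seq x m ℚ.+ seq y m) ℚ.- (seq x n ℚ.+ seq y n) ∣
      ≡⟨ cong ℚ.∣_∣ (rearrange (seq x m) (seq y m) (seq x n) (seq y n)) ⟩
    ℚ.∣ (seq x m ℚ.- seq x n) ℚ.+ (seq y m ℚ.- seq y n) ∣
      ≤⟨ ℚ.∣p+q∣≤∣p∣+∣q∣ (seq x m ℚ.- seq x n) (seq y m ℚ.- seq y n) ⟩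
    ℚ.∣ seq x m ℚ.- seq x n ∣ ℚ.+ ℚ.∣ seq y m ℚ.- seq y n ∣
      ≤⟨ ℚ.+-mono-≤ (u (left {M} l) (left {M} l′))
                    (v (right {M} l) (right {M} l′)) ⟩
    half ε ℚ.+ half ε
      ≡⟨ half+half ε ⟩
    ε ∎
    where open ℚ.≤-Reasoning

-_ : ℝ → ℝ
- x = mkℝ (λ n → ℚ.- seq x n) λ ε>0 →
  let N , u = cauchy x ε>0 in N , λ {m} {n} l l′ →
    subst (ℚ._≤ _) (e (seq x m) (seq x n)) (u l l′)
  where
  open +-*-Solver
  e′ : ∀ a b → ℚ.- a ℚ.- (ℚ.- b) ≡ b ℚ.- a
  e′ = solve 2 (λ a b → (:- a) :- (:- b) := b :- a) refl
  e : ∀ a b → ℚ.∣ a ℚ.- b ∣ ≡ ℚ.∣ ℚ.- a ℚ.- (ℚ.- b) ∣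
  e a b = trans (diff-comm a b) (cong ℚ.∣_∣ (sym (e′ a b)))

_-_ : ℝ → ℝ → ℝ
x - y = x + (- y)

private
  bounded : ∀ x → Σ[ B ∈ ℚ ] 0ℚ ℚ.< B × (∃[ N ] ∀ {n} → N ≤ℕ n → ℚ.∣ seq x n ∣ ℚ.≤ B)
  bounded x with cauchy x (ℚ.positive⁻¹ 1ℚ)
  ... | N , u = ℚ.∣ a ∣ ℚ.+ 1ℚ , ℚ.+-mono-≤-< (ℚ.0≤∣p∣ a) (ℚ.positive⁻¹ 1ℚ) , N , λ {n} l → begin
    ℚ.∣ seq x n ∣                        ≡⟨ cong ℚ.∣_∣ (e a (seq x n)) ⟩
    ℚ.∣ a ℚ.+ (seq x n ℚ.- a) ∣          ≤⟨ ℚ.∣p+q∣≤∣p∣+∣q∣ a (seq x n ℚ.- a) ⟩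
    ℚ.∣ a ∣ ℚ.+ ℚ.∣ seq x n ℚ.- a ∣      ≤⟨ ℚ.+-monoʳ-≤ ℚ.∣ a ∣ (u l ℕ.≤-refl) ⟩
    ℚ.∣ a ∣ ℚ.+ 1ℚ                       ∎
    where
    open ℚ.≤-Reasoning
    a = seq x N
    open +-*-Solver
    e : ∀ a b → b ≡ a ℚ.+ (b ℚ.- a)
    e = solve 2 (λ a b → b := a :+ (b :- a)) refl

  mul-≤ : ∀ {a b c d} → ℚ.∣ a ∣ ℚ.≤ b → ℚ.∣ c ∣ ℚ.≤ d → ℚ.∣ a ℚ.* c ∣ ℚ.≤ b ℚ.* d
  mul-≤ {a} {b} {c} {d} h k = begin
    ℚ.∣ a ℚ.* c ∣        ≡⟨ ℚ.∣p*q∣≡∣p∣*∣q∣ a c ⟩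
    ℚ.∣ a ∣ ℚ.* ℚ.∣ c ∣  ≤⟨ ℚ.*-monoʳ-≤-nonNeg ℚ.∣ c ∣ {{ℚ.∣-∣-nonNeg c}} h ⟩
    b ℚ.* ℚ.∣ c ∣        ≤⟨ ℚ.*-monoˡ-≤-nonNeg b {{ℚ.nonNegative (ℚ.≤-trans (ℚ.0≤∣p∣ a) h)}} k ⟩
    b ℚ.* d              ∎
    where open ℚ.≤-Reasoning

  split-ε : ∀ A B → 0ℚ ℚ.< A ℚ.+ B → ∀ {ε} → 0ℚ ℚ.< ε →
            Σ[ δ ∈ ℚ ] 0ℚ ℚ.< δ × A ℚ.* δ ℚ.+ δ ℚ.* B ≡ ε
  split-ε A B C>0 {ε} ε>0 = i ℚ.* ε , iε>0 , (begin
      A ℚ.* (i ℚ.* ε) ℚ.+ (i ℚ.* ε) ℚ.* B  ≡⟨ regroup A B i ε ⟩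
      (i ℚ.* (A ℚ.+ B)) ℚ.* ε              ≡⟨ cong (ℚ._* ε) (ℚ.*-inverseˡ (A ℚ.+ B)) ⟩
      1ℚ ℚ.* ε                             ≡⟨ ℚ.*-identityˡ ε ⟩
      ε                                    ∎)
    where
    open ≡-Reasoning
    instance
      C-pos : ℚ.Positive (A ℚ.+ B)
      C-pos = ℚ.positive C>0
      C≠0 : ℚ.NonZero (A ℚ.+ B)
      C≠0 = ℚ.pos⇒nonZero (A ℚ.+ B)
    i : ℚ
    i = ℚ.1/ (A ℚ.+ B)
    iε>0 : 0ℚ ℚ.< i ℚ.* ε
    iε>0 = subst (ℚ._< i ℚ.* ε) (ℚ.*-zeroʳ i)
             (ℚ.*-monoʳ-<-pos i {{ℚ.1/pos⇒pos (A ℚ.+ B)}} ε>0)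
    open +-*-Solver
    regroup : ∀ A B i ε → A ℚ.* (i ℚ.* ε) ℚ.+ (i ℚ.* ε) ℚ.* B ≡ (i ℚ.* (A ℚ.+ B)) ℚ.* ε
    regroup = solve 4 (λ A B i ε → A :* (i :* ε) :+ (i :* ε) :* B := (i :* (A :+ B)) :* ε) refl

  product-diff : ∀ a b c d → a ℚ.* b ℚ.- c ℚ.* d ≡ a ℚ.* (b ℚ.- d) ℚ.+ (a ℚ.- c) ℚ.* d
  product-diff = solve 4 (λ a b c d → a :* b :- c :* d := a :* (b :- d) :+ (a :- c) :* d) refl
    where open +-*-Solver

  product-bound : ∀ a b c d A B δ → ℚ.∣ a ∣ ℚ.≤ A → ℚ.∣ d ∣ ℚ.≤ B →
                  ℚ.∣ a ℚ.- c ∣ ℚ.≤ δ → ℚ.∣ b ℚ.- d ∣ ℚ.≤ δ →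
                  ℚ.∣ a ℚ.* b ℚ.- c ℚ.* d ∣ ℚ.≤ A ℚ.* δ ℚ.+ δ ℚ.* B
  product-bound a b c d A B δ a≤A d≤B a-c≤δ b-d≤δ = begin
    ℚ.∣ a ℚ.* b ℚ.- c ℚ.* d ∣
      ≡⟨ cong ℚ.∣_∣ (product-diff a b c d) ⟩
    ℚ.∣ a ℚ.* (b ℚ.- d) ℚ.+ (a ℚ.- c) ℚ.* d ∣
      ≤⟨ ℚ.∣p+q∣≤∣p∣+∣q∣ (a ℚ.* (b ℚ.- d)) ((a ℚ.- c) ℚ.* d) ⟩
    ℚ.∣ a ℚ.* (b ℚ.- d) ∣ ℚ.+ ℚ.∣ (a ℚ.- c) ℚ.* d ∣
      ≤⟨ ℚ.+-mono-≤ {ℚ.∣ a ℚ.* (b ℚ.- d) ∣} {A ℚ.* δ} {ℚ.∣ (a ℚ.- c) ℚ.* d ∣} {δ ℚ.* B}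
           (mul-≤ {a} {A} {b ℚ.- d} {δ} a≤A b-d≤δ)
           (mul-≤ {a ℚ.- c} {δ} {d} {B} a-c≤δ d≤B) ⟩
    A ℚ.* δ ℚ.+ δ ℚ.* B ∎
    where open ℚ.≤-Reasoning

_*_ : ℝ → ℝ → ℝ
x * y = mkℝ (λ n → seq x n ℚ.* seq y n) c
  where
  c : ∀ {ε} → 0ℚ ℚ.< ε → ∃[ N ] ∀ {m n} → N ≤ℕ m → N ≤ℕ n →
      ℚ.∣ seq x m ℚ.* seq y m ℚ.- seq x n ℚ.* seq y n ∣ ℚ.≤ ε
  c {ε} ε>0 =
    let A , A>0 , K , a = bounded x
        B , B>0 , L , b = bounded y
        δ , δ>0 , split = split-ε A B (ℚ.+-mono-< A>0 B>0) ε>0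
        M , u           = cauchy x δ>0
        N , v           = cauchy y δ>0
    in (K ⊔ L) ⊔ (M ⊔ N) , λ {m} {n} l l′ →
         subst (ℚ.∣ seq x m ℚ.* seq y m ℚ.- seq x n ℚ.* seq y n ∣ ℚ.≤_) split
           (product-bound (seq x m) (seq y m) (seq x n) (seq y n) A B δ
             (a (left {K} (left {K ⊔ L} l)))
             (b (right {K} (left {K ⊔ L} l′)))
             (u (left {M} (right {K ⊔ L} l)) (left {M} (right {K ⊔ L} l′)))
             (v (right {M} (right {K ⊔ L} l)) (right {M} (right {K ⊔ L} l′))))

-- Entries 3i, 3i+1, 3i+2 of a sequence encode its i-th rational (a - b)/(c + 1).
rational : Baire → ℕ → ℚ
rational p i = (+ column 3 p (# 0) i ℤ.- + column 3 p (# 1) i) ℚ./ suc (column 3 p (# 2) i)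

private
  rational-cong : ∀ {p q} → p ≗ q → rational p ≗ rational q
  rational-cong e i
    rewrite e (0 +ℕ i *ℕ 3) | e (1 +ℕ i *ℕ 3) | e (2 +ℕ i *ℕ 3) = refl

  encode : (ℕ → ℚ) → Fin 3 → Baire
  encode r fzero               i = ℤ.∣ ℚ.↥ r i ℤ.⊔ + 0 ∣
  encode r (fsuc fzero)        i = ℤ.∣ (ℤ.- ℚ.↥ r i) ℤ.⊔ + 0 ∣
  encode r (fsuc (fsuc fzero)) i = ℚ.denominator-1 (r i)

  rational-encode : ∀ r → rational (weave 3 (encode r)) ≗ r
  rational-encode r i
    rewrite column-weave 3 (encode r) (# 0) i
          | column-weave 3 (encode r) (# 1) i
          | column-weave 3 (encode r) (# 2) i =
    trans (cong (λ z → z ℚ./ suc (ℚ.denominator-1 (r i))) (parts (ℚ.↥ r i))) (ℚ.↥p/↧p≡p (r i))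
    where
    parts : ∀ z → + ℤ.∣ z ℤ.⊔ + 0 ∣ ℤ.- + ℤ.∣ (ℤ.- z) ℤ.⊔ + 0 ∣ ≡ z
    parts (+ zero)    = refl
    parts (+ suc n)   = cong (λ n → + suc n) (trans (ℕ.+-identityʳ _) refl)
    parts -[1+ n ]    = refl

  archimedean : ∀ {ε} → 0ℚ ℚ.< ε → ∃[ i ] 2⁻ i ℚ.≤ ε
  archimedean {ε@(mkℚ (+ suc a) d _)} _ = d , ℚ.toℚᵘ-cancel-≤ (ℚᵘ.≤-trans (small d) d≤ε)
    where
    small : ∀ i → ℚ.toℚᵘ (2⁻ i) ℚᵘ.≤ ℚᵘ.mkℚᵘ (+ 1) i
    small zero    = ℚᵘ.≤-refl
    small (suc i) = ℚᵘ.≤-trans (ℚᵘ.≤-reflexive (ℚ.toℚᵘ-homo-* ½ (2⁻ i)))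
      (ℚᵘ.≤-trans (ℚᵘ.*-monoʳ-≤-nonNeg ℚᵘ.½ (small i))
        (ℚᵘ.*≤* (ℤ.+≤+ (s≤s (arith i)))))
      where
      arith : ∀ i → suc (i +ℕ 0) ≤ℕ (i +ℕ suc (i +ℕ 0)) +ℕ 0
      arith i rewrite ℕ.+-identityʳ i | ℕ.+-identityʳ (i +ℕ suc i) = ℕ.m≤n+m (suc i) i
    d≤ε : ℚᵘ.mkℚᵘ (+ 1) d ℚᵘ.≤ ℚ.toℚᵘ ε
    d≤ε = ℚᵘ.*≤* (ℤ.*-monoʳ-≤-nonNeg (+ suc d) {+ 1} {+ suc a} (ℤ.+≤+ (s≤s z≤n)))
  archimedean {mkℚ (+ zero) _ _} (ℚ.*<* (ℤ.+<+ ()))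
  archimedean {mkℚ -[1+ _ ] _ _} (ℚ.*<* ())

  squeeze : ∀ {x y} (r : ℕ → ℚ) → (∀ i → x ≤ fromℚ (r i ℚ.+ 2⁻ i)) →
            (∀ i → fromℚ (r i ℚ.- 2⁻ i) ≤ y) → x ≤ y
  squeeze {x} {y} r h k {ε} ε>0 =
    let η       = half (half ε)
        η>0     = half>0 (half>0 ε>0)
        i , i≤η = archimedean η>0
        M , u   = h i η>0
        N , v   = k i η>0
    in M ⊔ N , λ {n} l → bound (seq x n) (r i) (2⁻ i) (seq y n) ε
         (u (left {M} l)) (v (right {M} l)) i≤η
    where
    bound : ∀ a r t b ε → a ℚ.≤ (r ℚ.+ t) ℚ.+ half (half ε) → r ℚ.- t ℚ.≤ b ℚ.+ half (half ε) →
            t ℚ.≤ half (half ε) → a ℚ.≤ b ℚ.+ ε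
    bound a r t b ε a≤ ≤b t≤ = begin
      a                            ≤⟨ a≤ ⟩
      (r ℚ.+ t) ℚ.+ η              ≡⟨ e₁ r t η ⟩
      (r ℚ.- t) ℚ.+ ((t ℚ.+ t) ℚ.+ η)
        ≤⟨ ℚ.+-mono-≤ {r ℚ.- t} {b ℚ.+ η} ≤b
             (ℚ.+-monoˡ-≤ η {t ℚ.+ t} {η ℚ.+ η} (ℚ.+-mono-≤ {t} {η} {t} {η} t≤ t≤)) ⟩
      (b ℚ.+ η) ℚ.+ ((η ℚ.+ η) ℚ.+ η)  ≡⟨ e₂ b ε ⟩
      b ℚ.+ ε                      ∎
      where
      open ℚ.≤-Reasoning
      η = half (half ε)
      open +-*-Solver
      e₁ : ∀ r t η → (r ℚ.+ t) ℚ.+ η ≡ (r ℚ.- t) ℚ.+ ((t ℚ.+ t) ℚ.+ η)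
      e₁ = solve 3 (λ r t η → (r :+ t) :+ η := (r :- t) :+ ((t :+ t) :+ η)) refl
      e₂ : ∀ b ε → (b ℚ.+ half (half ε)) ℚ.+ ((half (half ε) ℚ.+ half (half ε)) ℚ.+ half (half ε)) ≡ b ℚ.+ ε
      e₂ = solve 2 (λ b ε → let η = con ½ :* (con ½ :* ε) in
             (b :+ η) :+ ((η :+ η) :+ η) := b :+ ε) refl

-- p names x iff its i-th rational is within 2⁻ⁱ of x, for all i.
realLine : RepresentedSpace
realLine = record
  { setoid     = record
      { Carrier       = ℝ
      ; _≈_           = _≈ᵣ_
      ; isEquivalence = record
          { refl  = λ {x} → ≤-refl {x} , ≤-refl {x}
          ; sym   = λ (l , g) → g , l
          ; trans = λ {x} {y} {z} (l , g) (l′ , g′) →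
              ≤-trans {x} {y} {z} l l′ , ≤-trans {z} {y} {x} g′ g
          }
      }
  ; _names_    = Names
  ; resp-names = λ {p} {q} {x} {y} e (x≤y , y≤x) h i →
      ≤-trans {lower q i} {x} {y} (subst (λ r → fromℚ (r ℚ.- 2⁻ i) ≤ x) (rational-cong e i) (proj₁ (h i))) x≤y ,
      ≤-trans {y} {x} {upper q i} y≤x (subst (λ r → x ≤ fromℚ (r ℚ.+ 2⁻ i)) (rational-cong e i) (proj₂ (h i)))
  ; unique     = λ {p} {x} {y} h k →
      squeeze {x} {y} (rational p) (proj₂ ∘ h) (proj₁ ∘ k) ,
      squeeze {y} {x} (rational p) (proj₂ ∘ k) (proj₁ ∘ h)
  ; surjective = onto
  }
  where
  lower upper : Baire → ℕ → ℝ
  lower p i = fromℚ (rational p i ℚ.- 2⁻ i)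
  upper p i = fromℚ (rational p i ℚ.+ 2⁻ i)

  Names : Baire → ℝ → Set
  Names p x = ∀ i → lower p i ≤ x × x ≤ upper p i

  onto : ∀ x → ∃[ p ] Names p x
  onto x = weave 3 (encode r) , λ i →
      subst (λ s → fromℚ (s ℚ.- 2⁻ i) ≤ x) (sym (rational-encode r i)) (below i) ,
      subst (λ s → x ≤ fromℚ (s ℚ.+ 2⁻ i)) (sym (rational-encode r i)) (above i)
    where
    N : ℕ → ℕ
    N i = proj₁ (cauchy x (2⁻>0 i))
    r : ℕ → ℚ
    r i = seq x (N i)
    weaken : ∀ {a b ε} → 0ℚ ℚ.< ε → a ℚ.≤ b → a ℚ.≤ b ℚ.+ ε
    weaken {a} {b} {ε} ε>0 h = ℚ.≤-trans h
      (subst (ℚ._≤ b ℚ.+ ε) (ℚ.+-identityʳ b) (ℚ.+-monoʳ-≤ b (ℚ.<⇒≤ ε>0)))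
    shift : ∀ a b t → a ℚ.≤ b ℚ.+ t → a ℚ.- t ℚ.≤ b
    shift a b t h = subst (a ℚ.- t ℚ.≤_) (e b t) (ℚ.+-monoˡ-≤ (ℚ.- t) h)
      where open +-*-Solver
            e : ∀ b t → (b ℚ.+ t) ℚ.- t ≡ b
            e = solve 2 (λ b t → (b :+ t) :- t := b) refl
    below : ∀ i → fromℚ (r i ℚ.- 2⁻ i) ≤ x
    below i ε>0 = N i , λ {n} l → weaken {r i ℚ.- 2⁻ i} {seq x n} ε>0
      (shift (r i) (seq x n) (2⁻ i)
        (diff≤ {r i} {seq x n} (proj₂ (cauchy x (2⁻>0 i)) ℕ.≤-refl l)))
    above : ∀ i → x ≤ fromℚ (r i ℚ.+ 2⁻ i)
    above i ε>0 = N i , λ {n} l → weaken {seq x n} {r i ℚ.+ 2⁻ i} ε>0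
      (diff≤ {seq x n} {r i} (proj₂ (cauchy x (2⁻>0 i)) l ℕ.≤-refl))

unitInterval : RepresentedSpace
unitInterval = Subspace realLine (λ x → 0ℝ ≤ x × x ≤ 1ℝ)

Cube : ℕ → RepresentedSpace
Cube = Power unitInterval

------------------------------------------------------------------------
-- Convex choice

-- z ranges over the points of the cube representing (1 - t) x + t y.
Convex : ∀ {n} → Carrier (𝒜 (Cube n)) → Set
Convex {n} A = ∀ (x y z : Carrier (Cube n)) (t : Carrier unitInterval) →
  (∀ i → proj₁ (z i) ≈ᵣ (1ℝ - proj₁ t) * proj₁ (x i) + proj₁ t * proj₁ (y i)) →
  _∈_ {Cube n} x A → _∈_ {Cube n} y A → _∈_ {Cube n} z A

XC : ∀ n → 𝒜 (Cube n) ⇉ Cube n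
XC n = restrict (closedChoice (Cube n)) Convex
  λ e c x y z t zt x∈ y∈ → trans (sym (e z)) (c x y z t zt (trans (e x) x∈) (trans (e y) y∈))

------------------------------------------------------------------------
-- Sorting

Symbols^ω : ℕ → RepresentedSpace
Symbols^ω d = record
  { setoid     = record
      { Carrier       = ℕ → Fin d
      ; _≈_           = _≗_
      ; isEquivalence = record
          { refl  = λ _ → refl
          ; sym   = λ e n → sym (e n)
          ; trans = λ e f n → trans (e n) (f n)
          }
      }
  ; _names_    = λ p s → ∀ n → p n ≡ toℕ (s n)
  ; resp-names = λ e f h n → trans (sym (e n)) (trans (h n) (cong toℕ (f n)))
  ; unique     = λ h k n → toℕ-injective (trans (sym (h n)) (k n))
  ; surjective = λ s → toℕ ∘ s , λ _ → refl
  }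

InfinitelyOften : ∀ {d} → (ℕ → Fin d) → Fin d → Set
InfinitelyOften s l = ∀ N → ∃[ n ] N ≤ℕ n × s n ≡ l

infixr 5 _++ω_
_++ω_ : ∀ {A : Set} → List A → (ℕ → A) → ℕ → A
([]       ++ω s) n       = s n
((a ∷ as) ++ω s) zero    = a
((a ∷ as) ++ω s) (suc n) = (as ++ω s) n

-- 0^(c 0) 1^(c 1) … (m - 1)^(c (m - 1)) m^∞
sorted : ∀ {d} (m : Fin d) → (Fin′ m → ℕ) → ℕ → Fin d
sorted m c =
  List.concat (List.tabulate λ l → List.replicate (c l) (inject {i = m} l)) ++ω λ _ → m

private
  ∃≡-cong : ∀ {d} {s s′ : ℕ → Fin d} {l} → s ≗ s′ →
            (∃[ n ] s n ≡ l) ↔ (∃[ n ] s′ n ≡ l)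
  ∃≡-cong e = mk↔ₛ′
    (λ (n , a) → n , trans (sym (e n)) a)
    (λ (n , a) → n , trans (e n) a)
    (λ (n , a) → cong (n ,_) (Decidable⇒UIP.≡-irrelevant _≟_ _ a))
    (λ (n , a) → cong (n ,_) (Decidable⇒UIP.≡-irrelevant _≟_ _ a))

Sort : ∀ d → Symbols^ω d ⇉ Symbols^ω d
Sort d = record
  { rel      = λ p s → ∃[ m ] InfinitelyOften p m ×
                 (∀ (l : Fin′ m) → ¬ InfinitelyOften p (inject {i = m} l)) ×
                 Σ[ c ∈ (Fin′ m → ℕ) ]
                   (∀ l → Fin (c l) ↔ (∃[ n ] p n ≡ inject {i = m} l)) ×
                   s ≗ sorted m c
  ; resp-rel = λ {p} {p′} e f (m , inf , least , c , count , s≗) →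
      m
    , (λ N → let n , l , a = inf N in n , l , trans (sym (e n)) a)
    , (λ l inf′ → least l λ N → let n , k , a = inf′ N in n , k , trans (e n) a)
    , c
    , (λ l → ∃≡-cong e ↔-∘ count l)
    , λ n → trans (sym (f n)) (s≗ n)
  }

-- Points of the cube are named by binary expansions of their coordinates, so
-- by compactness the emptiness of a closed subset is witnessed by finitely
-- many prefixes and can be recognised at some stage.  The inner reduction
-- tries to pin down coordinates.  For every level l < n it keeps a candidate
-- hyperplane "coordinate j equals e", which is the number c l of symbols l
-- emitted so far (j = c l mod n, and the bits of e = c l / n are those of the
-- prescribed value).  It emits the least l whose candidate is rejected, because
-- j is already pinned at a lower level or because A has been seen not to meet
-- the hyperplanes of the levels up to l; if there is none, it emits n.
--
-- Let m be the least symbol emitted infinitely often.  The candidates below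
-- level m are final and their intersection B with A is nonempty.  In every
-- coordinate that is not pinned all candidates of level m are rejected, and
-- these are dense; as B is convex, it is a single point.  (If m = n, then all
-- coordinates are pinned.)  The outer reduction reads the sorted sequence: a
-- finite initial segment of it determines the final candidates of all levels
-- below its last symbol, hence a superset of B, and it searches for a stage at
-- which this superset is seen to have a small projection to the coordinate in
-- question.
module Submission where

open import Defs
open import Axiom.ExcludedMiddle using (ExcludedMiddle)
open import Data.Nat using (ℕ; suc; _≥_)
open import Level using (0ℓ)

open import Axiom.UniquenessOfIdentityProofs using (module Decidable⇒UIP)
open import Data.Bool using (true; false)
open import Data.Bool.Properties using (¬-not)
open import Data.Empty using (⊥; ⊥-elim)
open import Data.Fin as Fin using (Fin; Fin′; toℕ; inject; fromℕ<; #_) renaming (zero to fzero; suc to fsuc)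
open import Data.Fin.Permutation using (↔⇒≡)
open import Data.Fin.Properties as Fin
  using (toℕ<n; toℕ-injective; toℕ-fromℕ<; toℕ-inject; pigeonhole; +↔⊎)
open import Data.Integer as ℤ using (+_; -[1+_])
import Data.Integer.Properties as ℤ
open import Data.List as List using (List; []; _∷_)
open import Data.Nat
  using (zero; _<_; z≤n; s≤s; pred; _∸_; _/_; _%_; _⊔_; _≤′_; ≤′-reflexive; ≤′-step; >-nonZero⁻¹)
  renaming (_+_ to _+ℕ_; _*_ to _*ℕ_; _≤_ to _≤ℕ_; _^_ to _^ℕ_)
import Data.Nat.Properties as ℕ
open import Data.Nat.Divisibility using (divides-refl)
open import Data.Nat.DivMod
  using (_mod_; [m+kn]%n≡m%n; m<n⇒m%n≡m; m%n<n; +-distrib-/-∣ʳ; m<n⇒m/n≡0; m*n/n≡m;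
         m≡m%n+[m/n]*n; m/n≤m)
open import Data.Product using (Σ; _×_; _,_; proj₁; proj₂; Σ-syntax; ∃-syntax)
open import Data.Rational as ℚ using (ℚ; 0ℚ; 1ℚ; ½; mkℚ)
import Data.Rational.Properties as ℚ
open import Data.Rational.Solver using (module +-*-Solver)
import Data.Rational.Unnormalised as ℚᵘ
import Data.Rational.Unnormalised.Properties as ℚᵘ
open import Data.Sum using (_⊎_; inj₁; inj₂)
open import Data.Sum.Function.Propositional using (_⊎-↔_)
open import Data.Vec using (Vec; []; _∷_; lookup; head; tail; tabulate)
open import Data.Vec.Relation.Binary.Pointwise.Inductive using (Pointwise; []; _∷_)
open import Function using (_∘_)
open import Function.Bundles using (Equivalence; _⇔_; _↔_; mk↔ₛ′)
open import Function.Construct.Composition using (_↔-∘_)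
open import Function.Construct.Symmetry using (↔-sym)
open import Relation.Binary.Definitions using (tri<; tri≈; tri>)
open import Relation.Binary.PropositionalEquality
  using (_≡_; _≢_; _≗_; refl; sym; trans; cong; cong₂; subst; subst₂; module ≡-Reasoning)
open import Relation.Nullary using (¬_; Dec; yes; no; contradiction)
open import Relation.Nullary.Decidable using (decidable-stable)

-- Programs

-- Why the candidates of level m force B to be a single point: suppose two points of B have
-- numerators differing by at least two at some precision in coordinate J. Then J is not pinned, and
-- by convexity the segment between them lies in B and crosses every hyperplane of J whose value
-- lies in a dyadic interval strictly in between. The count of m grows by one at each emission of m,
-- so every sufficiently large number is the candidate at some emission of m, and emitting m means
-- that this candidate is rejected. A candidate for J with such a value cannot be. The difference of
-- two is forced: a dyadic rational has two binary expansions, whose prefixes differ by one, and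
-- both may survive every stage. All comparisons of numerators therefore have tolerance one. Each
-- level pins one new coordinate, so n levels suffice; with the symbol n for the case that no level
-- is rejected, this gives the n + 1 symbols. The outer search need not know whether level m has
-- been reached, since a certificate for fewer levels concerns a superset of B. Excluded middle
-- enters only in the verification of the two programs: the existence of m, binary expansions and
-- König's lemma.

mutual
  ⇓-cong : ∀ {p p′ n} {e : Code n} {xs y} → p ≗ p′ → p ⊢ e [ xs ]⇓ y → p′ ⊢ e [ xs ]⇓ y
  ⇓-cong e zero⇓         = zero⇓
  ⇓-cong e succ⇓         = succ⇓
  ⇓-cong e proj⇓         = proj⇓
  ⇓-cong e (oracle⇓ {x}) = subst (_ ⊢ oracle [ x ∷ [] ]⇓_) (sym (e x)) oracle⇓
  ⇓-cong e (comp⇓ gs f)  = comp⇓ (⇓-congs e gs) (⇓-cong e f)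
  ⇓-cong e (prec0⇓ f)    = prec0⇓ (⇓-cong e f)
  ⇓-cong e (precs⇓ r g)  = precs⇓ (⇓-cong e r) (⇓-cong e g)
  ⇓-cong e (min⇓ z nz)   = min⇓ (⇓-cong e z) λ j<k → let r , d = nz j<k in r , ⇓-cong e d

  ⇓-congs : ∀ {p p′ m n} {gs : Vec (Code n) m} {xs ys} → p ≗ p′ →
            Pointwise (λ g y → p ⊢ g [ xs ]⇓ y) gs ys → Pointwise (λ g y → p′ ⊢ g [ xs ]⇓ y) gs ys
  ⇓-congs e []       = []
  ⇓-congs e (d ∷ ds) = ⇓-cong e d ∷ ⇓-congs e ds

mutual
  ⇓-functional : ∀ {p n} {e : Code n} {xs y y′} → p ⊢ e [ xs ]⇓ y → p ⊢ e [ xs ]⇓ y′ → y ≡ y′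
  ⇓-functional zero⇓ zero⇓     = refl
  ⇓-functional succ⇓ succ⇓     = refl
  ⇓-functional proj⇓ proj⇓     = refl
  ⇓-functional oracle⇓ oracle⇓ = refl
  ⇓-functional (comp⇓ gs f) (comp⇓ gs′ f′) with refl ← ⇓-functionals gs gs′ = ⇓-functional f f′
  ⇓-functional (prec0⇓ f) (prec0⇓ f′) = ⇓-functional f f′
  ⇓-functional (precs⇓ r g) (precs⇓ r′ g′) with refl ← ⇓-functional r r′ = ⇓-functional g g′
  ⇓-functional (min⇓ {k = k} z nz) (min⇓ {k = k′} z′ nz′) with ℕ.<-cmp k k′
  ... | tri≈ _ k≡k′ _ = k≡k′
  ... | tri< k<k′ _ _ with () ← ⇓-functional z (proj₂ (nz′ k<k′))
  ... | tri> _ _ k′<k with () ← ⇓-functional z′ (proj₂ (nz k′<k))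

  ⇓-functionals : ∀ {p m n} {gs : Vec (Code n) m} {xs ys ys′} →
                  Pointwise (λ g y → p ⊢ g [ xs ]⇓ y) gs ys →
                  Pointwise (λ g y → p ⊢ g [ xs ]⇓ y) gs ys′ → ys ≡ ys′
  ⇓-functionals []       []         = refl
  ⇓-functionals (d ∷ ds) (d′ ∷ ds′) = cong₂ _∷_ (⇓-functional d d′) (⇓-functionals ds ds′)

computedBy : Code 1 → PartialFunction
computedBy e = record
  { graph      = λ p q → ∀ n → p ⊢ e [ n ∷ [] ]⇓ q n
  ; resp       = λ p≗p′ q≗q′ g n → subst (_ ⊢ e [ n ∷ [] ]⇓_) (q≗q′ n) (⇓-cong p≗p′ (g n))
  ; functional = λ g g′ n → ⇓-functional (g n) (g′ n)
  }

computedBy-computable : ∀ e → Computable (computedBy e)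
computedBy-computable e = e , λ g → g

natrec : ∀ {A : Set} → A → (ℕ → A → A) → ℕ → A
natrec z s zero    = z
natrec z s (suc n) = s n (natrec z s n)

-- A code bundled with a proof that it computes `F` on every input and oracle, so that programs are
-- composed together with their meaning. Only the unbounded search in `outer` leaves this class of
-- total programs.
Prog : ∀ n → (Baire → Vec ℕ n → ℕ) → Set
Prog n F = Σ[ e ∈ Code n ] ∀ p xs → p ⊢ e [ xs ]⇓ F p xs

data Args n : ∀ {m} → (Baire → Vec ℕ n → Vec ℕ m) → Set where
  []  : Args n (λ _ _ → [])
  _∷_ : ∀ {m G} {Gs : Baire → Vec ℕ n → Vec ℕ m} →
        Prog n G → Args n Gs → Args n (λ p xs → G p xs ∷ Gs p xs)

infixr 5 _∷_

var : ∀ {n} (i : Fin n) → Prog n (λ _ xs → lookup xs i)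
var i = proj i , λ _ _ → proj⇓

oracleᴾ : Prog 1 (λ p xs → p (lookup xs (# 0)))
oracleᴾ = oracle , λ { p (x ∷ []) → oracle⇓ }

sucᴾ : Prog 1 (λ p xs → suc (lookup xs (# 0)))
sucᴾ = succ , λ { p (x ∷ []) → succ⇓ }

app : ∀ {m n F} {Gs : Baire → Vec ℕ n → Vec ℕ m} → Prog m F → Args n Gs → Prog n (λ p xs → F p (Gs p xs))
app (f , f⇓) gs = comp f (codes gs) , λ p xs → comp⇓ (codes⇓ gs p xs) (f⇓ p _)
  where
  codes : ∀ {m n} {Gs : Baire → Vec ℕ n → Vec ℕ m} → Args n Gs → Vec (Code n) m
  codes []            = []
  codes ((g , _) ∷ gs) = g ∷ codes gs
  codes⇓ : ∀ {m n} {Gs : Baire → Vec ℕ n → Vec ℕ m} (gs : Args n Gs) p xs →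
           Pointwise (λ g y → p ⊢ g [ xs ]⇓ y) (codes gs) (Gs p xs)
  codes⇓ []              p xs = []
  codes⇓ ((_ , g⇓) ∷ gs) p xs = g⇓ p xs ∷ codes⇓ gs p xs

lit : ∀ {n} k → Prog n (λ _ _ → k)
lit zero    = zero , λ _ _ → zero⇓
lit (suc k) = app sucᴾ (lit k ∷ [])

infix 3 _by_
_by_ : ∀ {n F G} → Prog n F → (∀ p xs → F p xs ≡ G p xs) → Prog n G
(e , e⇓) by F≡G = e , λ p xs → subst (p ⊢ e [ xs ]⇓_) (F≡G p xs) (e⇓ p xs)

rec : ∀ {n F G} → Prog n F → Prog (2 +ℕ n) G →
      Prog (1 +ℕ n) (λ p xs → natrec (F p (tail xs)) (λ k r → G p (k ∷ r ∷ tail xs)) (head xs))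
rec {n} {F} {G} (f , f⇓) (g , g⇓) = prec f g , λ { p (k ∷ xs) → prec⇓ p xs k }
  where
  prec⇓ : ∀ p xs k → p ⊢ prec f g [ k ∷ xs ]⇓ natrec (F p xs) (λ k r → G p (k ∷ r ∷ xs)) k
  prec⇓ p xs zero    = prec0⇓ (f⇓ p xs)
  prec⇓ p xs (suc k) = precs⇓ (prec⇓ p xs k) (g⇓ p _)

projs⇓ : ∀ {p m n} (ρ : Fin m → Fin n) {xs ys} → (∀ i → lookup xs (ρ i) ≡ lookup ys i) →
         Pointwise (λ g y → p ⊢ g [ xs ]⇓ y) (tabulate (proj ∘ ρ)) ys
projs⇓ ρ {ys = []}     e = []
projs⇓ ρ {xs = xs} {y ∷ ys} e =
  subst (_ ⊢ proj (ρ fzero) [ xs ]⇓_) (e fzero) proj⇓ ∷ projs⇓ (ρ ∘ fsuc) (e ∘ fsuc)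

fold : ∀ {n O B F N} → Prog 2 O → Prog n B → Prog (1 +ℕ n) F → Prog n N →
       Prog n (λ p xs → natrec (B p xs) (λ k r → O p (r ∷ F p (k ∷ xs) ∷ [])) (N p xs))
fold {n} {O} {B} {F} (o , o⇓) b (f , f⇓) (k , k⇓) =
    comp (proj₁ loop) (k ∷ tabulate proj)
  , λ p xs → comp⇓ (k⇓ p xs ∷ projs⇓ (λ i → i) (λ _ → refl)) (proj₂ loop p (_ ∷ xs))
  where
  step : Prog (2 +ℕ n) (λ p xs → O p (head (tail xs) ∷ F p (head xs ∷ tail (tail xs)) ∷ []))
  step = comp o (proj (# 1) ∷ comp f (proj (# 0) ∷ tabulate (λ i → proj (fsuc (fsuc i)))) ∷ [])
       , λ { p (x ∷ y ∷ xs) → comp⇓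
             (proj⇓ ∷ comp⇓ (proj⇓ ∷ projs⇓ (λ i → fsuc (fsuc i)) (λ _ → refl)) (f⇓ p _) ∷ [])
             (o⇓ p _) }
  loop = rec b step

addᴾ : Prog 2 (λ _ xs → lookup xs (# 0) +ℕ lookup xs (# 1))
addᴾ = rec (var (# 0)) (app sucᴾ (var (# 1) ∷ [])) by λ { _ (x ∷ y ∷ []) → e x y }
  where
  e : ∀ x y → natrec y (λ _ r → suc r) x ≡ x +ℕ y
  e zero    y = refl
  e (suc x) y = cong suc (e x y)

mulᴾ : Prog 2 (λ _ xs → lookup xs (# 0) *ℕ lookup xs (# 1))
mulᴾ = rec (lit 0) (app addᴾ (var (# 2) ∷ var (# 1) ∷ [])) by λ { _ (x ∷ y ∷ []) → e x y }
  where
  e : ∀ x y → natrec 0 (λ _ r → y +ℕ r) x ≡ x *ℕ y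
  e zero    y = refl
  e (suc x) y = cong (y +ℕ_) (e x y)

predᴾ : Prog 1 (λ _ xs → pred (lookup xs (# 0)))
predᴾ = rec (lit 0) (var (# 0)) by λ { _ (zero ∷ []) → refl ; _ (suc x ∷ []) → refl }

monusᴾ : Prog 2 (λ _ xs → lookup xs (# 0) ∸ lookup xs (# 1))
monusᴾ = app (rec (var (# 0)) (app predᴾ (var (# 1) ∷ []))) (var (# 1) ∷ var (# 0) ∷ [])
  by λ { _ (x ∷ y ∷ []) → e x y }
  where
  e : ∀ x y → natrec x (λ _ r → pred r) y ≡ x ∸ y
  e x zero    = refl
  e x (suc y) = trans (cong pred (e x y)) (ℕ.pred[m∸n]≡m∸[1+n] x y)

2^ᴾ : Prog 1 (λ _ xs → 2 ^ℕ lookup xs (# 0))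
2^ᴾ = rec (lit 1) (app mulᴾ (lit 2 ∷ var (# 1) ∷ [])) by λ { _ (x ∷ []) → e x }
  where
  e : ∀ x → natrec 1 (λ _ r → 2 *ℕ r) x ≡ 2 ^ℕ x
  e zero    = refl
  e (suc x) = cong (2 *ℕ_) (e x)

-- The two truncated differences add up to the distance of `x` and `y`, so this is equality as a
-- number 0 or 1, which serves as a factor in place of a case distinction.
eq : ℕ → ℕ → ℕ
eq x y = 1 ∸ ((x ∸ y) +ℕ (y ∸ x))

eq-refl : ∀ x → eq x x ≡ 1
eq-refl x rewrite ℕ.n∸n≡0 x = refl

eq-≢ : ∀ {x y} → x ≢ y → eq x y ≡ 0
eq-≢ {zero}  {zero}  x≢y = contradiction refl x≢y
eq-≢ {zero}  {suc y} x≢y = ℕ.0∸n≡0 y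
eq-≢ {suc x} {zero}  x≢y = ℕ.0∸n≡0 (x +ℕ 0)
eq-≢ {suc x} {suc y} x≢y = eq-≢ (x≢y ∘ cong suc)

infixl 6 _∔_
infixl 7 _⋆_
infixl 6 _∸ᴾ_

_∔_ : ∀ {n F G} → Prog n F → Prog n G → Prog n (λ p xs → F p xs +ℕ G p xs)
f ∔ g = app addᴾ (f ∷ g ∷ [])

_⋆_ : ∀ {n F G} → Prog n F → Prog n G → Prog n (λ p xs → F p xs *ℕ G p xs)
f ⋆ g = app mulᴾ (f ∷ g ∷ [])

_∸ᴾ_ : ∀ {n F G} → Prog n F → Prog n G → Prog n (λ p xs → F p xs ∸ G p xs)
f ∸ᴾ g = app monusᴾ (f ∷ g ∷ [])

eqᴾ : ∀ {n F G} → Prog n F → Prog n G → Prog n (λ p xs → eq (F p xs) (G p xs))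
eqᴾ f g = lit 1 ∸ᴾ ((f ∸ᴾ g) ∔ (g ∸ᴾ f))

modDiv-unique : ∀ {r n} k → r < suc n → (r +ℕ k *ℕ suc n) % suc n ≡ r × (r +ℕ k *ℕ suc n) / suc n ≡ k
modDiv-unique {r} {n} k r<n =
    trans ([m+kn]%n≡m%n r k (suc n)) (m<n⇒m%n≡m r<n)
  , trans (+-distrib-/-∣ʳ r (divides-refl k))
          (cong₂ _+ℕ_ (m<n⇒m/n≡0 r<n) (m*n/n≡m k (suc n)))

private
  modStep : ℕ → ℕ → ℕ
  modStep y r = suc r *ℕ (1 ∸ eq r y)

  mod-suc : ∀ x y → suc x % suc y ≡ modStep y (x % suc y) × suc x / suc y ≡ x / suc y +ℕ eq (x % suc y) y
  mod-suc x y with x % suc y | x / suc y | m≡m%n+[m/n]*n x (suc y) | m%n<n x (suc y)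
  ... | r | k | refl | r<y with r ℕ.≟ y
  ... | yes refl rewrite eq-refl r | ℕ.*-zeroʳ r | ℕ.+-comm k 1 = modDiv-unique {0} {y} (suc k) (s≤s z≤n)
  ... | no  r≢y rewrite eq-≢ r≢y | ℕ.*-identityʳ r | ℕ.+-identityʳ k =
    modDiv-unique k (s≤s (ℕ.≤∧≢⇒< (ℕ.≤-pred r<y) r≢y))

modᴾ : Prog 2 (λ _ xs → lookup xs (# 0) % suc (lookup xs (# 1)))
modᴾ = rec (lit 0) (app sucᴾ (var (# 1) ∷ []) ⋆ (lit 1 ∸ᴾ eqᴾ (var (# 1)) (var (# 2))))
  by λ { _ (x ∷ y ∷ []) → e x y }
  where
  e : ∀ x y → natrec 0 (λ _ r → modStep y r) x ≡ x % suc y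
  e zero    y = refl
  e (suc x) y = trans (cong (modStep y) (e x y)) (sym (proj₁ (mod-suc x y)))

divᴾ : Prog 2 (λ _ xs → lookup xs (# 0) / suc (lookup xs (# 1)))
divᴾ = rec (lit 0) (var (# 1) ∔ eqᴾ (app modᴾ (var (# 0) ∷ var (# 2) ∷ [])) (var (# 2)))
  by λ { _ (x ∷ y ∷ []) → e x y }
  where
  e : ∀ x y → natrec 0 (λ k r → r +ℕ eq (k % suc y) y) x ≡ x / suc y
  e zero    y = refl
  e (suc x) y = trans (cong (_+ℕ eq (x % suc y) y) (e x y)) (sym (proj₂ (mod-suc x y)))

-- The reductions

Bits : Set
Bits = ℕ → ℕ

-- `r` if it is nonzero, else `v`: the recursion of length `r` overwrites `v` as soon as it makes a
-- step.
orElse : ℕ → ℕ → ℕ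
orElse r v = natrec v (λ _ _ → r) r

sumTo : (ℕ → ℕ) → ℕ → ℕ
sumTo f = natrec 0 (λ k r → r +ℕ f k)

digit : ℕ → ℕ → ℕ → ℕ
digit b h k = natrec h (λ _ r → r / suc b) k % suc b

prefix : Bits → ℕ → ℕ
prefix β = natrec 0 (λ k r → β k +ℕ (r +ℕ r))

-- `code` consumes a list from the front, so a recursion on numbers must prepend the entries from
-- the last one backwards; hence the index `k ∸ suc i`.
listCode : Baire → ℕ → ℕ
listCode q k = natrec 0 (λ i r → 2 ^ℕ q (k ∸ suc i) *ℕ suc (2 *ℕ r)) k

-- Evaluation of the associate `f` with a bounded number of queries. The result keeps the shift of
-- `Answer`: 0 stands for no answer yet, `suc v` for the answer `v`.
firstValue : Baire → Baire → ℕ → ℕ → ℕ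
firstValue f q N = natrec 0 (λ k r → orElse r (f (2 ^ℕ N *ℕ suc (2 *ℕ listCode q k))))

-- Nonzero once the point named by q is seen, within s steps, to lie outside the
-- closed set named by f.
score : Baire → Baire → ℕ → ℕ
score f q s = sumTo (λ N → firstValue f q N s ∸ 1) s

-- Nonzero iff the distance is at most one. Equality would be too strict: even a single point may
-- have two expansions, with prefixes differing by one, and no stage would then exclude all prefixes
-- but one.
near : ℕ → ℕ → ℕ
near a b = (1 ∸ (a ∸ suc b)) *ℕ (1 ∸ (b ∸ suc a))

module Construction (n′ : ℕ) where
  private
    n = suc n′

  count : ℕ → ℕ → ℕ → ℕ
  count h s l = sumTo (λ y → eq (digit n h y) l) s

  -- suc e if a candidate of a level below m pins coordinate j to the bits of e,
  -- and 0 if there is none.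
  pinned : (ℕ → ℕ) → ℕ → ℕ → ℕ
  pinned c m j = natrec 0 (λ l r → orElse r (eq j (c l % n) *ℕ suc (c l / n))) m

  -- A free coordinate `j` reads the positions of `γ` congruent to `j` modulo n. In a pinned one,
  -- bit `k` of `e`, counted from the least significant, becomes the bit `k` after the binary point.
  -- So the values for e = 0, 1, 2, ... form the van der Corput sequence in base 2, which visits
  -- every dyadic interval infinitely often.
  bitsAt : (ℕ → ℕ) → ℕ → Bits → ℕ → Bits
  bitsAt c m γ j k = natrec (γ (j +ℕ k *ℕ n)) (λ e _ → digit 1 e k) (pinned c m j)

  -- The i-th rational of coordinate j is prefix (β j) i / 2 ^ i: the index P is
  -- j + (e + 3 i) n, where e selects numerator, subtrahend or denominator.
  entry : (ℕ → Bits) → Baire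
  entry β P =
    eq (P / n % 3) 0 *ℕ prefix (β (P % n)) (P / n / 3) +ℕ eq (P / n % 3) 2 *ℕ (2 ^ℕ (P / n / 3) ∸ 1)

  -- Nonzero as long as the point with free bits `γ` is a possible counterexample at stage `s`: it
  -- is not yet seen to leave the closed set, and its coordinate `j` is far from `b`. Absence of
  -- survivors thus certifies that all points of the set on the first `m` hyperplanes have
  -- coordinate `j` near `b`.
  survives : Baire → (ℕ → ℕ) → ℕ → ℕ → ℕ → ℕ → ℕ → Bits → ℕ
  survives f c m s j i b γ =
    1 ∸ (score f (entry (bitsAt c m γ)) s +ℕ near (prefix (bitsAt c m γ j) i) b)

  -- Only the first s bits are inspected, so it suffices to let t < 2 ^ s.
  survivors : Baire → (ℕ → ℕ) → ℕ → ℕ → ℕ → ℕ → ℕ → ℕ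
  survivors f c m s j i b = sumTo (λ t → survives f c m s j i b (digit 1 t)) (2 ^ℕ s)

  -- As 0 and 2 are not near, survivors … 0 0 2 is zero only if no point is left.
  reject : Baire → (ℕ → ℕ) → ℕ → ℕ → ℕ
  reject f c s l = pinned c l (c l % n) +ℕ (1 ∸ survivors f c (suc l) s 0 0 2)

  -- The accumulator advances at level `l` only if it equals `l` and the level is accepted; a
  -- rejection makes the product 0, which is never `suc r`. After the first rejected level it lags
  -- behind `l` and stays there.
  emit : Baire → (ℕ → ℕ) → ℕ → ℕ
  emit f c s = natrec 0 (λ l r → r +ℕ eq (suc l *ℕ (1 ∸ reject f c s l)) (suc r)) n

  -- The symbols emitted so far as the digits of a number, the latest one least
  -- significant.
  history : Baire → ℕ → ℕ
  history f = natrec 0 (λ s h → emit f (count h s) s +ℕ h *ℕ suc n)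

  emission : Baire → Baire
  emission f s = emit f (count (history f s) s) s

  packed : Baire → ℕ → ℕ
  packed σ = natrec 0 (λ k h → σ k +ℕ h *ℕ suc n)

  attempt : Baire → Baire → ℕ → ℕ → ℕ → ℕ → ℕ
  attempt f σ j i s q = survivors f (count (packed σ s) s) (σ s) s j (suc i) q

  -- The search variable w encodes a stage and a numerator over 2 ^ suc i; bits of
  -- index below the stage determine the first suc i bits of coordinate j.
  stage : ℕ → ℕ → ℕ → ℕ
  stage j i w = w / suc (2 ^ℕ suc i) +ℕ (j +ℕ suc i *ℕ n)

  guess : ℕ → ℕ → ℕ
  guess i w = w % suc (2 ^ℕ suc i)

  miss : Baire → Baire → ℕ → ℕ → ℕ → ℕ
  miss f σ j i w = attempt f σ j i (stage j i w) (guess i w)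

  -- The layout is that of `entry`, but the i-th rational has denominator 2 ^ suc i: the numerator
  -- may be off by one and the dyadic interval has length one unit, and these two units together are
  -- the permitted error of the i-th entry of a name.
  answer : ℕ → ℕ → ℕ
  answer P w = eq (P / n % 3) 0 *ℕ guess i w +ℕ eq (P / n % 3) 2 *ℕ (2 ^ℕ suc i ∸ 1)
    where i = P / n / 3

  -- Programs for the functions of the two reductions

  orElseᴾ : Prog 2 (λ _ xs → orElse (lookup xs (# 0)) (lookup xs (# 1)))
  orElseᴾ = app (rec (var (# 0)) (var (# 3))) (var (# 0) ∷ var (# 1) ∷ var (# 0) ∷ [])

  sumᴾ : ∀ {n F N} → Prog (suc n) F → Prog n N → Prog n (λ p xs → sumTo (λ k → F p (k ∷ xs)) (N p xs))
  sumᴾ f k = fold addᴾ (lit 0) f k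

  digitᴾ : ∀ b → Prog 2 (λ _ xs → digit b (lookup xs (# 0)) (lookup xs (# 1)))
  digitᴾ b = app modᴾ
    (fold (app divᴾ (var (# 0) ∷ lit b ∷ [])) (var (# 0)) (lit 0) (var (# 1)) ∷ lit b ∷ [])

  prefixᴾ : ∀ {n F N} → Prog (suc n) F → Prog n N → Prog n (λ p xs → prefix (λ k → F p (k ∷ xs)) (N p xs))
  prefixᴾ f k = fold (var (# 1) ∔ (var (# 0) ∔ var (# 0))) (lit 0) f k

  countᴾ : Prog 3 (λ _ xs → count (lookup xs (# 0)) (lookup xs (# 1)) (lookup xs (# 2)))
  countᴾ = sumᴾ (eqᴾ (app (digitᴾ n) (var (# 1) ∷ var (# 0) ∷ [])) (var (# 3))) (var (# 1))

  _%n : ∀ {k F} → Prog k F → Prog k (λ p xs → F p xs % n)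
  f %n = app modᴾ (f ∷ lit n′ ∷ [])

  _/n : ∀ {k F} → Prog k F → Prog k (λ p xs → F p xs / n)
  f /n = app divᴾ (f ∷ lit n′ ∷ [])

  -- Programs take numbers, not functions. Here and below `c` is therefore passed as a packed
  -- history together with its stage, and in the following programs `γ` as a number with these
  -- binary digits.
  pinnedᴾ : Prog 4 (λ _ xs →
    pinned (count (lookup xs (# 0)) (lookup xs (# 1))) (lookup xs (# 2)) (lookup xs (# 3)))
  pinnedᴾ = fold orElseᴾ (lit 0) (eqᴾ (var (# 4)) (c %n) ⋆ app sucᴾ (c /n ∷ [])) (var (# 2))
    where c = app countᴾ (var (# 1) ∷ var (# 2) ∷ var (# 0) ∷ [])

  bitsAtᴾ : Prog 6 (λ _ xs →
    bitsAt (count (lookup xs (# 3)) (lookup xs (# 4))) (lookup xs (# 5)) (digit 1 (lookup xs (# 2)))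
           (lookup xs (# 1)) (lookup xs (# 0)))
  bitsAtᴾ = app (rec (app (digitᴾ 1) (var (# 2) ∷ (var (# 1) ∔ var (# 0) ⋆ lit n) ∷ []))
                     (app (digitᴾ 1) (var (# 0) ∷ var (# 2) ∷ [])))
    (app pinnedᴾ (var (# 3) ∷ var (# 4) ∷ var (# 5) ∷ var (# 1) ∷ []) ∷
     var (# 0) ∷ var (# 1) ∷ var (# 2) ∷ var (# 3) ∷ var (# 4) ∷ var (# 5) ∷ [])

  prefixAtᴾ : Prog 6 (λ _ xs →
    prefix (bitsAt (count (lookup xs (# 3)) (lookup xs (# 4))) (lookup xs (# 5)) (digit 1 (lookup xs (# 2)))
           (lookup xs (# 1))) (lookup xs (# 0)))
  prefixAtᴾ = prefixᴾ
    (app bitsAtᴾ (var (# 0) ∷ var (# 2) ∷ var (# 3) ∷ var (# 4) ∷ var (# 5) ∷ var (# 6) ∷ []))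
    (var (# 0))

  selectᴾ : ∀ {k F G H} → Prog k F → Prog k G → Prog k H →
            Prog k (λ p xs → eq (F p xs / n % 3) 0 *ℕ G p xs +ℕ eq (F p xs / n % 3) 2 *ℕ (2 ^ℕ H p xs ∸ 1))
  selectᴾ f g h =
    eqᴾ (app modᴾ (f /n ∷ lit 2 ∷ [])) (lit 0) ⋆ g ∔
    eqᴾ (app modᴾ (f /n ∷ lit 2 ∷ [])) (lit 2) ⋆ (app 2^ᴾ (h ∷ []) ∸ᴾ lit 1)

  _/n/3 : ∀ {k F} → Prog k F → Prog k (λ p xs → F p xs / n / 3)
  f /n/3 = app divᴾ (f /n ∷ lit 2 ∷ [])

  entryᴾ : Prog 5 (λ _ xs →
    entry (bitsAt (count (lookup xs (# 2)) (lookup xs (# 3))) (lookup xs (# 4)) (digit 1 (lookup xs (# 1))))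
          (lookup xs (# 0)))
  entryᴾ = selectᴾ (var (# 0))
    (app prefixAtᴾ (var (# 0) /n/3 ∷ var (# 0) %n ∷ var (# 1) ∷ var (# 2) ∷ var (# 3) ∷ var (# 4) ∷ []))
    (var (# 0) /n/3)

  listCodeᴾ : Prog 5 (λ _ xs →
    listCode (entry (bitsAt (count (lookup xs (# 2)) (lookup xs (# 3))) (lookup xs (# 4)) (digit 1 (lookup xs (# 1)))))
             (lookup xs (# 0)))
  listCodeᴾ = fold (app 2^ᴾ (var (# 1) ∷ []) ⋆ app sucᴾ ((lit 2 ⋆ var (# 0)) ∷ [])) (lit 0)
    (app entryᴾ ((var (# 1) ∸ᴾ app sucᴾ (var (# 0) ∷ [])) ∷ var (# 2) ∷ var (# 3) ∷ var (# 4) ∷ var (# 5) ∷ []))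
    (var (# 0))

  -- The name of the closed set is the whole oracle of the inner reduction but only the even half of
  -- the oracle of the outer one; the way to read it is a parameter.
  module _ {ask : Baire → Baire} (askᴾ : Prog 1 (λ p xs → ask p (lookup xs (# 0)))) where

    firstValueᴾ : Prog 6 (λ p xs →
      firstValue (ask p)
        (entry (bitsAt (count (lookup xs (# 3)) (lookup xs (# 4))) (lookup xs (# 5)) (digit 1 (lookup xs (# 2)))))
        (lookup xs (# 0)) (lookup xs (# 1)))
    firstValueᴾ = fold orElseᴾ (lit 0)
      (app askᴾ ((app 2^ᴾ (var (# 1) ∷ []) ⋆ app sucᴾ ((lit 2 ⋆
        app listCodeᴾ (var (# 0) ∷ var (# 3) ∷ var (# 4) ∷ var (# 5) ∷ var (# 6) ∷ [])) ∷ [])) ∷ []))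
      (var (# 1))

    scoreᴾ : Prog 5 (λ p xs →
      score (ask p)
        (entry (bitsAt (count (lookup xs (# 2)) (lookup xs (# 3))) (lookup xs (# 4)) (digit 1 (lookup xs (# 1)))))
        (lookup xs (# 0)))
    scoreᴾ = sumᴾ
      (app firstValueᴾ (var (# 0) ∷ var (# 1) ∷ var (# 2) ∷ var (# 3) ∷ var (# 4) ∷ var (# 5) ∷ []) ∸ᴾ lit 1)
      (var (# 0))

    nearᴾ : Prog 2 (λ _ xs → near (lookup xs (# 0)) (lookup xs (# 1)))
    nearᴾ = (lit 1 ∸ᴾ (var (# 0) ∸ᴾ app sucᴾ (var (# 1) ∷ []))) ⋆
            (lit 1 ∸ᴾ (var (# 1) ∸ᴾ app sucᴾ (var (# 0) ∷ [])))

    survivorsᴾ : Prog 7 (λ p xs →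
      survivors (ask p) (count (lookup xs (# 0)) (lookup xs (# 1))) (lookup xs (# 2)) (lookup xs (# 3))
                (lookup xs (# 4)) (lookup xs (# 5)) (lookup xs (# 6)))
    survivorsᴾ = sumᴾ
      (lit 1 ∸ᴾ (app scoreᴾ (var (# 4) ∷ var (# 0) ∷ var (# 1) ∷ var (# 2) ∷ var (# 3) ∷ []) ∔
                 app nearᴾ (app prefixAtᴾ (var (# 6) ∷ var (# 5) ∷ var (# 0) ∷ var (# 1) ∷ var (# 2) ∷ var (# 3) ∷ [])
                            ∷ var (# 7) ∷ [])))
      (app 2^ᴾ (var (# 3) ∷ []))

  emitᴾ : Prog 2 (λ p xs → emit p (count (lookup xs (# 0)) (lookup xs (# 1))) (lookup xs (# 1)))
  emitᴾ = fold (var (# 0) ∔ eqᴾ (var (# 1)) (app sucᴾ (var (# 0) ∷ []))) (lit 0)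
    (app sucᴾ (var (# 0) ∷ []) ⋆ (lit 1 ∸ᴾ
      (app pinnedᴾ (var (# 1) ∷ var (# 2) ∷ var (# 0) ∷ (app countᴾ (var (# 1) ∷ var (# 2) ∷ var (# 0) ∷ []) %n) ∷ [])
       ∔ (lit 1 ∸ᴾ app (survivorsᴾ {λ p → p} oracleᴾ)
           (var (# 1) ∷ var (# 2) ∷ app sucᴾ (var (# 0) ∷ []) ∷ var (# 2) ∷ lit 0 ∷ lit 0 ∷ lit 2 ∷ [])))))
    (lit n)

  historyᴾ : Prog 1 (λ p xs → history p (lookup xs (# 0)))
  historyᴾ = rec (lit 0) (app emitᴾ (var (# 1) ∷ var (# 0) ∷ []) ∔ var (# 1) ⋆ lit (suc n))
    by λ { _ (_ ∷ []) → refl }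

  emissionᴾ : Prog 1 (λ p xs → emission p (lookup xs (# 0)))
  emissionᴾ = app emitᴾ (historyᴾ ∷ var (# 0) ∷ [])

  evens odds : Baire → Baire
  evens p x = p (x +ℕ x)
  odds p x = p (suc (x +ℕ x))

  evensᴾ : Prog 1 (λ p xs → evens p (lookup xs (# 0)))
  evensᴾ = app oracleᴾ ((var (# 0) ∔ var (# 0)) ∷ [])

  oddsᴾ : Prog 1 (λ p xs → odds p (lookup xs (# 0)))
  oddsᴾ = app oracleᴾ (app sucᴾ ((var (# 0) ∔ var (# 0)) ∷ []) ∷ [])

  packedᴾ : Prog 1 (λ p xs → packed (odds p) (lookup xs (# 0)))
  packedᴾ = fold (var (# 1) ∔ var (# 0) ⋆ lit (suc n)) (lit 0) (app oddsᴾ (var (# 0) ∷ [])) (var (# 0))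

  missᴾ : Prog 2 (λ p xs →
    miss (evens p) (odds p) (lookup xs (# 1) % n) (lookup xs (# 1) / n / 3) (lookup xs (# 0)))
  missᴾ = app (survivorsᴾ {evens} evensᴾ)
    (app packedᴾ (s ∷ []) ∷ s ∷ app oddsᴾ (s ∷ []) ∷ s ∷ (var (# 1) %n) ∷ i ∷
     app modᴾ (var (# 0) ∷ app 2^ᴾ (i ∷ []) ∷ []) ∷ [])
    where
    i = app sucᴾ ((var (# 1) /n/3) ∷ [])
    s = app divᴾ (var (# 0) ∷ app 2^ᴾ (i ∷ []) ∷ []) ∔ ((var (# 1) %n) ∔ i ⋆ lit n)

  answerᴾ : Prog 2 (λ _ xs → answer (lookup xs (# 1)) (lookup xs (# 0)))
  answerᴾ = selectᴾ (var (# 1)) (app modᴾ (var (# 0) ∷ app 2^ᴾ (app sucᴾ ((var (# 1) /n/3) ∷ []) ∷ []) ∷ []))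
                    (app sucᴾ ((var (# 1) /n/3) ∷ []))

-- Certificates

sumTo-cong : ∀ {f g} s → (∀ {k} → k < s → f k ≡ g k) → sumTo f s ≡ sumTo g s
sumTo-cong zero    e = refl
sumTo-cong (suc s) e = cong₂ _+ℕ_ (sumTo-cong s λ k<s → e (ℕ.m<n⇒m<1+n k<s)) (e ℕ.≤-refl)

sumTo≡0 : ∀ {f} s → (∀ {k} → k < s → f k ≡ 0) → sumTo f s ≡ 0
sumTo≡0 zero    e = refl
sumTo≡0 (suc s) e = cong₂ _+ℕ_ (sumTo≡0 s λ k<s → e (ℕ.m<n⇒m<1+n k<s)) (e ℕ.≤-refl)

sumTo≡0⇒ : ∀ {f} s → sumTo f s ≡ 0 → ∀ {k} → k < s → f k ≡ 0
sumTo≡0⇒ {f} (suc s) e {k} (s≤s k≤s) with k ℕ.≟ s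
... | yes refl = ℕ.m+n≡0⇒n≡0 (sumTo f s) e
... | no  k≢s  = sumTo≡0⇒ s (ℕ.m+n≡0⇒m≡0 (sumTo f s) e) (ℕ.≤∧≢⇒< k≤s k≢s)

sumTo≢0⇒ : ∀ {f} s → sumTo f s ≢ 0 → ∃[ k ] k < s × f k ≢ 0
sumTo≢0⇒ zero    e = contradiction refl e
sumTo≢0⇒ {f} (suc s) e with f s ℕ.≟ 0
... | no  h = s , ℕ.≤-refl , h
... | yes h with sumTo≢0⇒ {f} s (λ z → e (cong₂ _+ℕ_ z h))
... | k , k<s , d = k , ℕ.m<n⇒m<1+n k<s , d

sumTo-suc : ∀ f s → sumTo f (suc s) ≡ f 0 +ℕ sumTo (f ∘ suc) s
sumTo-suc f zero    = sym (ℕ.+-identityʳ (f 0))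
sumTo-suc f (suc s) = trans (cong (_+ℕ f (suc s)) (sumTo-suc f s)) (ℕ.+-assoc (f 0) _ _)

digit-suc : ∀ b h k → digit b h (suc k) ≡ digit b (h / suc b) k
digit-suc b h k = cong (_% suc b) (e k)
  where
  e : ∀ k → natrec h (λ _ r → r / suc b) (suc k) ≡ natrec (h / suc b) (λ _ r → r / suc b) k
  e zero    = refl
  e (suc k) = cong (_/ suc b) (e k)

Binary : Bits → Set
Binary γ = ∀ k → γ k < 2

digit-binary : ∀ h → Binary (digit 1 h)
digit-binary h k = m%n<n (natrec h (λ _ r → r / 2) k) 2

-- Low bits prescribed, `M` above them. With `M` = 0 this is the index of `γ` in the finite search
-- of `survivors`; with `M` large it is a candidate with a prescribed beginning that is still to
-- come.
fromBits : Bits → ℕ → ℕ → ℕ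
fromBits γ zero    M = M
fromBits γ (suc s) M = γ 0 +ℕ fromBits (γ ∘ suc) s M *ℕ 2

digit-fromBits : ∀ {γ} → Binary γ → ∀ s M {k} → k < s → digit 1 (fromBits γ s M) k ≡ γ k
digit-fromBits bin (suc s) M {zero}  _         = proj₁ (modDiv-unique (fromBits _ s M) (bin 0))
digit-fromBits {γ} bin (suc s) M {suc k} (s≤s k<s) =
  trans (digit-suc 1 (fromBits γ (suc s) M) k)
    (trans (cong (λ h → digit 1 h k) (proj₂ (modDiv-unique (fromBits (γ ∘ suc) s M) (bin 0))))
           (digit-fromBits (bin ∘ suc) s M k<s))

fromBits≥ : ∀ γ s M → M ≤ℕ fromBits γ s M
fromBits≥ γ zero    M = ℕ.≤-refl
fromBits≥ γ (suc s) M = ℕ.≤-trans (fromBits≥ (γ ∘ suc) s M)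
  (ℕ.≤-trans (ℕ.m≤m*n _ 2) (ℕ.m≤n+m _ (γ 0)))

fromBits< : ∀ {γ} → Binary γ → ∀ s → fromBits γ s 0 < 2 ^ℕ s
fromBits< bin zero    = s≤s z≤n
fromBits< {γ} bin (suc s) = begin
  suc (γ 0 +ℕ x *ℕ 2) ≤⟨ ℕ.+-monoˡ-≤ (x *ℕ 2) (bin 0) ⟩
  suc x *ℕ 2          ≤⟨ ℕ.*-monoˡ-≤ 2 (fromBits< (bin ∘ suc) s) ⟩
  2 ^ℕ s *ℕ 2         ≡⟨ ℕ.*-comm (2 ^ℕ s) 2 ⟩
  2 *ℕ 2 ^ℕ s         ∎
  where open ℕ.≤-Reasoning
        x = fromBits (γ ∘ suc) s 0

prefix-cong : ∀ {β β′} i → (∀ {k} → k < i → β k ≡ β′ k) → prefix β i ≡ prefix β′ i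
prefix-cong zero    e = refl
prefix-cong (suc i) e with prefix-cong i (λ k<i → e (ℕ.m<n⇒m<1+n k<i))
... | r = cong₂ _+ℕ_ (e ℕ.≤-refl) (cong₂ _+ℕ_ r r)

prefix< : ∀ {β} → Binary β → ∀ i → prefix β i < 2 ^ℕ i
prefix< bin zero    = s≤s z≤n
prefix< {β} bin (suc i) = begin
  suc (β i +ℕ (a +ℕ a))   ≤⟨ ℕ.+-monoˡ-≤ (a +ℕ a) (bin i) ⟩
  2 +ℕ (a +ℕ a)           ≡⟨ cong suc (ℕ.+-suc a a) ⟨
  suc a +ℕ suc a          ≤⟨ ℕ.+-mono-≤ (prefix< bin i) (prefix< bin i) ⟩
  2 ^ℕ i +ℕ 2 ^ℕ i        ≡⟨ cong (2 ^ℕ i +ℕ_) (ℕ.+-identityʳ (2 ^ℕ i)) ⟨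
  2 *ℕ 2 ^ℕ i             ∎
  where open ℕ.≤-Reasoning
        a = prefix β i

bits-of-prefix : ∀ i {a} → a < 2 ^ℕ i → ∃[ β ] Binary β × prefix β i ≡ a
bits-of-prefix zero    {zero} _ = (λ _ → 0) , (λ _ → s≤s z≤n) , refl
bits-of-prefix zero    {suc a} (s≤s ())
bits-of-prefix (suc i) {a} a<  with a / 2 | a % 2 | m≡m%n+[m/n]*n a 2 | m%n<n a 2
... | x | r | refl | r<2 with bits-of-prefix i {x} x<
  where
  x< : x < 2 ^ℕ i
  x< = ℕ.*-cancelʳ-< 2 x (2 ^ℕ i)
    (ℕ.≤-<-trans (ℕ.m≤n+m (x *ℕ 2) r) (subst (r +ℕ x *ℕ 2 <_) (ℕ.*-comm 2 (2 ^ℕ i)) a<))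
... | β , bin , e = β′ , bin′ , cong₂ _+ℕ_ last (trans (cong₂ _+ℕ_ init init) double)
  where
  β′ : Bits
  β′ k with k ℕ.≟ i
  ... | yes _ = r
  ... | no  _ = β k
  bin′ : Binary β′
  bin′ k with k ℕ.≟ i
  ... | yes _ = r<2
  ... | no  _ = bin k
  last : β′ i ≡ r
  last with i ℕ.≟ i
  ... | yes _ = refl
  ... | no  d = contradiction refl d
  init : prefix β′ i ≡ x
  init = trans (prefix-cong i same) e
    where
    same : ∀ {k} → k < i → β′ k ≡ β k
    same {k} k<i with k ℕ.≟ i
    ... | yes k≡i = contradiction k≡i (ℕ.<⇒≢ k<i)
    ... | no  _   = refl
  double : x +ℕ x ≡ x *ℕ 2
  double = trans (cong (x +ℕ_) (sym (ℕ.+-identityʳ x))) (ℕ.*-comm 2 x)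

∸-suc : ∀ {k i} → i < k → k ∸ i ≡ suc (k ∸ suc i)
∸-suc {suc k} {zero}  _         = refl
∸-suc {suc k} {suc i} (s≤s i<k) = ∸-suc i<k

-- The induction runs over suffixes: after `i` steps the recursion has coded the last `i` of the `k`
-- entries.
listCode-correct : ∀ q k → listCode q k ≡ code (List.applyUpTo q k)
listCode-correct q k = trans (part k ℕ.≤-refl)
  (cong code (applyUpTo-cong
    (λ x → cong q (trans (cong (x +ℕ_) (ℕ.n∸n≡0 k)) (ℕ.+-identityʳ x))) k))
  where
  part : ∀ i → i ≤ℕ k → natrec 0 (λ i r → 2 ^ℕ q (k ∸ suc i) *ℕ suc (2 *ℕ r)) i ≡
                         code (List.applyUpTo (λ x → q (x +ℕ (k ∸ i))) i)
  part zero    _   = refl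
  part (suc i) i<k = cong (λ r → 2 ^ℕ q (k ∸ suc i) *ℕ suc (2 *ℕ r))
    (trans (part i (ℕ.<⇒≤ i<k)) (cong code (applyUpTo-cong
      (λ x → cong q (trans (cong (x +ℕ_) (∸-suc i<k)) (ℕ.+-suc x (k ∸ suc i)))) i)))

query : ℕ → Baire → ℕ → ℕ
query N q k = 2 ^ℕ N *ℕ suc (2 *ℕ listCode q k)

query-correct : ∀ N q k → query N q k ≡ code (N ∷ List.applyUpTo q k)
query-correct N q k = cong (λ r → 2 ^ℕ N *ℕ suc (2 *ℕ r)) (listCode-correct q k)

applyUpTo-cong-< : ∀ {q q′ : Baire} k → (∀ {x} → x < k → q x ≡ q′ x) → List.applyUpTo q k ≡ List.applyUpTo q′ k
applyUpTo-cong-< zero    e = refl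
applyUpTo-cong-< (suc k) e = cong₂ _∷_ (e (s≤s z≤n)) (applyUpTo-cong-< k (λ x<k → e (s≤s x<k)))

firstValue-cong : ∀ f {q q′} N s → (∀ {x} → x < s → q x ≡ q′ x) → firstValue f q N s ≡ firstValue f q′ N s
firstValue-cong f N zero    e = refl
firstValue-cong f {q} {q′} N (suc s) e = cong₂ orElse
  (firstValue-cong f N s (λ x<s → e (ℕ.m<n⇒m<1+n x<s)))
  (cong f (trans (query-correct N q s) (trans
    (cong (λ w → code (N ∷ w)) (applyUpTo-cong-< s (λ x<s → e (ℕ.m<n⇒m<1+n x<s))))
    (sym (query-correct N q′ s)))))

firstValue-before : ∀ {f q N k v} → Answer f q N k v → ∀ {s} → s ≤ℕ k → firstValue f q N s ≡ 0
firstValue-before a {zero} _ = refl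
firstValue-before {f} {q} {N} {k} a@(_ , z) {suc s} s<k =
  cong₂ orElse (firstValue-before {f} {q} {N} {k} a (ℕ.<⇒≤ s<k))
    (trans (cong f (query-correct N q s)) (z s<k))

firstValue-after : ∀ {f q N k v} → Answer f q N k v → ∀ {s} → k < s → firstValue f q N s ≡ suc v
firstValue-after {f} {q} {N} {k} a@(b , _) {suc s} (s≤s k≤s) with k ℕ.≟ s
... | yes refl = cong₂ orElse (firstValue-before {f} {q} {N} a {k} ℕ.≤-refl) (trans (cong f (query-correct N q k)) b)
... | no  k≢s  = cong (λ r → orElse r (f (query N q s))) (firstValue-after {f} {q} {N} a (ℕ.≤∧≢⇒< k≤s k≢s))

firstValue-mono : ∀ f q N {s s′} → s ≤ℕ s′ → firstValue f q N s′ ∸ 1 ≡ 0 → firstValue f q N s ∸ 1 ≡ 0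
firstValue-mono f q N {s} {s′} s≤s′ e = go (ℕ.≤⇒≤′ s≤s′) e
  where
  go : ∀ {s s′} → s ≤′ s′ → firstValue f q N s′ ∸ 1 ≡ 0 → firstValue f q N s ∸ 1 ≡ 0
  go (≤′-reflexive refl) e = e
  go {s′ = suc s′} (≤′-step l) e = go l (drop (firstValue f q N s′) e)
    where
    drop : ∀ r {v} → orElse r v ∸ 1 ≡ 0 → r ∸ 1 ≡ 0
    drop zero    _ = refl
    drop (suc r) e = e

score-cong : ∀ f {q q′} s → (∀ {x} → x < s → q x ≡ q′ x) → score f q s ≡ score f q′ s
score-cong f s e = sumTo-cong s (λ {N} _ → cong (_∸ 1) (firstValue-cong f N s e))

score-mono : ∀ f q {s s′} → s ≤ℕ s′ → score f q s′ ≡ 0 → score f q s ≡ 0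
score-mono f q {s} {s′} l e = sumTo≡0 s λ {N} N<s →
  firstValue-mono f q N l (sumTo≡0⇒ s′ e (ℕ.<-≤-trans N<s l))

near⇒ : ∀ {a b} → near a b ≢ 0 → a ≤ℕ suc b × b ≤ℕ suc a
near⇒ {a} {b} h with a ∸ suc b in e | b ∸ suc a in e′
... | zero  | zero  = ℕ.m∸n≡0⇒m≤n e , ℕ.m∸n≡0⇒m≤n e′
... | zero  | suc y rewrite ℕ.0∸n≡0 y = contradiction refl h
... | suc x | _     rewrite ℕ.0∸n≡0 x = contradiction refl h

far⇒ : ∀ {a b} → near a b ≡ 0 → suc b < a ⊎ suc a < b
far⇒ {a} {b} h with a ∸ suc b in e | b ∸ suc a in e′
far⇒ () | zero | zero
... | zero  | suc y = inj₂ (ℕ.m∸n≢0⇒n<m λ z → ℕ.1+n≢0 (trans (sym e′) z))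
... | suc x | _     = inj₁ (ℕ.m∸n≢0⇒n<m λ z → ℕ.1+n≢0 (trans (sym e) z))

1∸≢0 : ∀ {x} → 1 ∸ x ≢ 0 → x ≡ 0
1∸≢0 {zero}  _ = refl
1∸≢0 {suc x} h = contradiction (ℕ.0∸n≡0 x) h

1∸≡0 : ∀ {x} → 1 ∸ x ≡ 0 → x ≢ 0
1∸≡0 () refl

countIn : Baire → ℕ → ℕ → ℕ
countIn σ s l = sumTo (λ y → eq (σ y) l) s

module Certificates (n′ : ℕ) where
  open Construction n′ public
  private
    n = suc n′

  Packing : Baire → Baire → Set
  Packing h σ = h 0 ≡ 0 × (∀ s → h (suc s) ≡ σ s +ℕ h s *ℕ suc n)

  -- The bound on the symbols excludes carries, so the digits of the packed number in base n + 1 are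
  -- exactly the symbols, in reverse order.
  count-packing : ∀ {h σ} → Packing h σ → (∀ s → σ s ≤ℕ n) → ∀ s l → count (h s) s l ≡ countIn σ s l
  count-packing pk σ≤ zero    l = refl
  count-packing {h} {σ} pk@(_ , step) σ≤ (suc s) l = begin
    count (h (suc s)) (suc s) l
      ≡⟨ sumTo-suc (λ y → eq (digit n (h (suc s)) y) l) s ⟩
    eq (h (suc s) % suc n) l +ℕ sumTo (λ y → eq (digit n (h (suc s)) (suc y)) l) s
      ≡⟨ cong₂ _+ℕ_ (cong (λ x → eq x l) d₀) (sumTo-cong s λ {y} _ → cong (λ x → eq x l) (dₛ y)) ⟩
    eq (σ s) l +ℕ count (h s) s l
      ≡⟨ cong (eq (σ s) l +ℕ_) (count-packing {h} {σ} pk σ≤ s l) ⟩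
    eq (σ s) l +ℕ countIn σ s l
      ≡⟨ ℕ.+-comm (eq (σ s) l) _ ⟩
    countIn σ (suc s) l ∎
    where
    open ≡-Reasoning
    d₀ : h (suc s) % suc n ≡ σ s
    d₀ = trans (cong (_% suc n) (step s)) (proj₁ (modDiv-unique (h s) (s≤s (σ≤ s))))
    dₛ : ∀ y → digit n (h (suc s)) (suc y) ≡ digit n (h s) y
    dₛ y = trans (digit-suc n (h (suc s)) y) (cong (λ x → digit n x y)
      (trans (cong (_/ suc n) (step s)) (proj₂ (modDiv-unique (h s) (s≤s (σ≤ s))))))

  pinned-cong : ∀ {c c′} m j → (∀ {l} → l < m → c l ≡ c′ l) → pinned c m j ≡ pinned c′ m j
  pinned-cong zero    j e = refl
  pinned-cong (suc m) j e = cong₂ orElse (pinned-cong m j (λ l<m → e (ℕ.m<n⇒m<1+n l<m)))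
    (cong (λ x → eq j (x % n) *ℕ suc (x / n)) (e ℕ.≤-refl))

  pinned-≡0 : ∀ c m {j} → pinned c m j ≡ 0 → ∀ {l} → l < m → c l % n ≢ j
  pinned-≡0 c (suc m) {j} e {l} (s≤s l≤m) with pinned c m j in e′
  ... | zero with l ℕ.≟ m
  ...   | no  l≢m  = pinned-≡0 c m e′ (ℕ.≤∧≢⇒< l≤m l≢m)
  ...   | yes refl = λ { refl → ℕ.1+n≢0 (trans (sym (trans (cong (_*ℕ suc (c l / n)) (eq-refl (c l % n)))
                                                (ℕ.*-identityˡ _))) e) }

  pinned-old : ∀ c m {j e} → pinned c m j ≡ suc e → pinned c (suc m) j ≡ suc e
  pinned-old c m h rewrite h = refl

  -- `orElse` gives precedence to the lowest level that pins `j`, so further levels cannot change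
  -- its value.
  pinned-mono : ∀ c {m m′} → m ≤ℕ m′ → ∀ {j e} → pinned c m j ≡ suc e → pinned c m′ j ≡ suc e
  pinned-mono c {m′ = zero} z≤n h = h
  pinned-mono c {m} {suc m′} m≤ h with m ℕ.≟ suc m′
  ... | yes refl = h
  ... | no  m≢   = pinned-old c m′ (pinned-mono c (ℕ.≤-pred (ℕ.≤∧≢⇒< m≤ m≢)) h)

  pinned-other : ∀ c m {j} → c m % n ≢ j → pinned c (suc m) j ≡ pinned c m j
  pinned-other c m {j} d rewrite eq-≢ (d ∘ sym) with pinned c m j
  ... | zero  = refl
  ... | suc _ = refl

  pinned-new : ∀ c m {j} → pinned c m j ≡ 0 → c m % n ≡ j → pinned c (suc m) j ≡ suc (c m / n)
  pinned-new c m h refl rewrite h | eq-refl (c m % n) = ℕ.+-identityʳ _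

  bitsAt-binary : ∀ c m {γ} → Binary γ → ∀ j → Binary (bitsAt c m γ j)
  bitsAt-binary c m bin j k with pinned c m j
  ... | zero  = bin _
  ... | suc e = digit-binary e k

  bitsAt-pinned : ∀ c m γ {j e} → pinned c m j ≡ suc e → ∀ k → bitsAt c m γ j k ≡ digit 1 e k
  bitsAt-pinned c m γ h k rewrite h = refl

  bitsAt-free : ∀ c m γ {j} → pinned c m j ≡ 0 → ∀ k → bitsAt c m γ j k ≡ γ (j +ℕ k *ℕ n)
  bitsAt-free c m γ h k rewrite h = refl

  bitsAt-cong : ∀ c m {γ γ′} j k → γ (j +ℕ k *ℕ n) ≡ γ′ (j +ℕ k *ℕ n) → bitsAt c m γ j k ≡ bitsAt c m γ′ j k
  bitsAt-cong c m j k e = cong (λ z → natrec z (λ e _ → digit 1 e k) (pinned c m j)) e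

  bitsAt-cong-c : ∀ {c c′} m γ j k → (∀ {l} → l < m → c l ≡ c′ l) → bitsAt c m γ j k ≡ bitsAt c′ m γ j k
  bitsAt-cong-c m γ j k e = cong (natrec _ (λ e _ → digit 1 e k)) (pinned-cong m j e)

  entry-cong : ∀ {β β′} P → (∀ {k} → k < P / n / 3 → β (P % n) k ≡ β′ (P % n) k) → entry β P ≡ entry β′ P
  entry-cong P e = cong (λ z → eq (P / n % 3) 0 *ℕ z +ℕ _) (prefix-cong (P / n / 3) e)

  private
    -- Entry `P` of the name of a point reads only bits of `γ` at positions below `P`. This is why
    -- `s` bits suffice for the first `s` entries of the name, and 2 ^ s points for a stage.
    index< : ∀ P {k} → k < P / n / 3 → P % n +ℕ k *ℕ n < P
    index< P {k} k< = subst (P % n +ℕ k *ℕ n <_) (sym (m≡m%n+[m/n]*n P n))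
      (ℕ.+-monoʳ-< (P % n) (ℕ.*-monoˡ-< n (ℕ.<-≤-trans k< (m/n≤m (P / n) 3))))

  -- The score is local by `index<`, but the comparison with `b` reads the bits j + k n for k < i
  -- whatever the stage is. The stage must cover these; for i = 0, the test for emptiness, there are
  -- none.
  survives-cong : ∀ f c m s j i b {γ γ′} → j +ℕ i *ℕ n ≤ℕ s ⊎ i ≡ 0 → (∀ {k} → k < s → γ k ≡ γ′ k) →
                  survives f c m s j i b γ ≡ survives f c m s j i b γ′
  survives-cong f c m s j i b {γ} {γ′} big e = cong₂ (λ x y → 1 ∸ (x +ℕ near y b))
    (score-cong f {entry (bitsAt c m γ)} {entry (bitsAt c m γ′)} s λ {P} P<s →
      entry-cong {bitsAt c m γ} {bitsAt c m γ′} P λ {k} k< →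
        bitsAt-cong c m {γ} {γ′} (P % n) k (e (ℕ.<-trans (index< P k<) P<s)))
    (prefix-cong {bitsAt c m γ j} {bitsAt c m γ′ j} i λ {k} k<i → bitsAt-cong c m {γ} {γ′} j k (e (bound big k<i)))
    where
    bound : j +ℕ i *ℕ n ≤ℕ s ⊎ i ≡ 0 → ∀ {k} → k < i → j +ℕ k *ℕ n < s
    bound (inj₁ l) k<i = ℕ.<-≤-trans (ℕ.+-monoʳ-< j (ℕ.*-monoˡ-< n k<i)) l
    bound (inj₂ refl) ()

  survives⇒ : ∀ f c m s j i b γ → survives f c m s j i b γ ≢ 0 →
              score f (entry (bitsAt c m γ)) s ≡ 0 × near (prefix (bitsAt c m γ j) i) b ≡ 0
  survives⇒ f c m s j i b γ h = ℕ.m+n≡0⇒m≡0 _ (1∸≢0 h) , ℕ.m+n≡0⇒n≡0 (score f (entry (bitsAt c m γ)) s) (1∸≢0 h)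

  survives⇐ : ∀ f c m s j i b γ → score f (entry (bitsAt c m γ)) s ≡ 0 →
              near (prefix (bitsAt c m γ j) i) b ≡ 0 → survives f c m s j i b γ ≢ 0
  survives⇐ f c m s j i b γ e e′ rewrite e | e′ = λ ()

  -- Cutting `γ` off after `s` bits changes nothing that stage `s` inspects, and the truncation is
  -- among the finitely many points searched.
  survivors≡0⇒ : ∀ f c m s j i b → survivors f c m s j i b ≡ 0 → j +ℕ i *ℕ n ≤ℕ s ⊎ i ≡ 0 →
                 ∀ {γ} → Binary γ → score f (entry (bitsAt c m γ)) s ≡ 0 →
                 near (prefix (bitsAt c m γ j) i) b ≢ 0
  survivors≡0⇒ f c m s j i b h big {γ} bin z e = survives⇐ f c m s j i b γ z e
    (trans (survives-cong f c m s j i b big (λ k<s → sym (digit-fromBits bin s 0 k<s)))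
      (sumTo≡0⇒ (2 ^ℕ s) h (fromBits< bin s)))

  survivors≢0⇒ : ∀ f c m s j i b → survivors f c m s j i b ≢ 0 →
                 ∃[ γ ] Binary γ × score f (entry (bitsAt c m γ)) s ≡ 0 × near (prefix (bitsAt c m γ j) i) b ≡ 0
  survivors≢0⇒ f c m s j i b h with sumTo≢0⇒ (2 ^ℕ s) h
  ... | t , _ , d = digit 1 t , digit-binary t , survives⇒ f c m s j i b (digit 1 t) d

  survivors-cong : ∀ {f c c′} m s j i b → (∀ {l} → l < m → c l ≡ c′ l) →
                   survivors f c m s j i b ≡ survivors f c′ m s j i b
  survivors-cong {f} {c} {c′} m s j i b e = sumTo-cong (2 ^ℕ s) λ {t} _ → cong₂ (λ x y → 1 ∸ (x +ℕ near y b))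
    (score-cong f {entry (bitsAt c m (digit 1 t))} {entry (bitsAt c′ m (digit 1 t))} s λ {P} _ →
      entry-cong {bitsAt c m (digit 1 t)} {bitsAt c′ m (digit 1 t)} P λ {k} _ →
        bitsAt-cong-c m (digit 1 t) (P % n) k e)
    (prefix-cong {bitsAt c m (digit 1 t) j} {bitsAt c′ m (digit 1 t) j} i λ {k} _ → bitsAt-cong-c m (digit 1 t) j k e)

  module _ (f : Baire) (c : ℕ → ℕ) (s : ℕ) where
    private
      sel : ℕ → ℕ
      sel = natrec 0 (λ l r → r +ℕ eq (suc l *ℕ (1 ∸ reject f c s l)) (suc r))

      -- The loop invariant of `emit`: after `k` levels, `r` is the least rejected level below `k`,
      -- or `k` if there is none.
      Sel : ℕ → ℕ → Set
      Sel k r = r ≤ℕ k × (r < k → reject f c s r ≢ 0) × (∀ {l} → l < r → reject f c s l ≡ 0)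

      step : ∀ k r → Sel k r → Sel (suc k) (r +ℕ eq (suc k *ℕ (1 ∸ reject f c s k)) (suc r))
      step k r (r≤k , rej , acc) with r ℕ.≟ k
      step k r (r≤k , rej , acc) | no r≢k =
        subst (Sel (suc k)) (sym (trans (cong (r +ℕ_) (eq-≢ (other (reject f c s k)))) (ℕ.+-identityʳ r)))
          (ℕ.m≤n⇒m≤1+n r≤k , (λ _ → rej r<k) , acc)
        where
        r<k = ℕ.≤∧≢⇒< r≤k r≢k
        other : ∀ x → suc k *ℕ (1 ∸ x) ≢ suc r
        other zero    e = r≢k (sym (ℕ.suc-injective (trans (sym (ℕ.*-identityʳ (suc k))) e)))
        other (suc x) e rewrite ℕ.0∸n≡0 x | ℕ.*-zeroʳ k with () ← e
      step k .k (r≤k , rej , acc) | yes refl with reject f c s k in e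
      ... | zero  = subst (Sel (suc k)) (sym (trans
                        (cong (k +ℕ_) (trans (cong (λ x → eq x (suc k)) (ℕ.*-identityʳ (suc k))) (eq-refl (suc k))))
                        (ℕ.+-comm k 1)))
                      (ℕ.≤-refl , (λ l → contradiction refl (ℕ.<⇒≢ l)) , all)
        where
        all : ∀ {l} → l < suc k → reject f c s l ≡ 0
        all {l} (s≤s l≤k) with l ℕ.≟ k
        ... | yes refl = e
        ... | no  l≢k  = acc (ℕ.≤∧≢⇒< l≤k l≢k)
      ... | suc x = subst (Sel (suc k)) (sym (trans (cong (k +ℕ_) (eq-≢ zero≢)) (ℕ.+-identityʳ k)))
                      (ℕ.n≤1+n k , (λ _ z → ℕ.1+n≢0 (trans (sym e) z)) , acc)
        where
        zero≢ : suc k *ℕ (1 ∸ suc x) ≢ suc k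
        zero≢ z rewrite ℕ.0∸n≡0 x | ℕ.*-zeroʳ k with () ← z

      sel-spec : ∀ k → Sel k (sel k)
      sel-spec zero    = z≤n , (λ ()) , (λ ())
      sel-spec (suc k) = step k (sel k) (sel-spec k)

    emit≤ : emit f c s ≤ℕ n
    emit≤ = proj₁ (sel-spec n)

    emit-rejected : emit f c s < n → reject f c s (emit f c s) ≢ 0
    emit-rejected = proj₁ (proj₂ (sel-spec n))

    emit-accepted : ∀ {l} → l < emit f c s → reject f c s l ≡ 0
    emit-accepted = proj₂ (proj₂ (sel-spec n))

-- Dyadic rationals

2⁻-pos : ∀ i → 0ℚ ℚ.< 2⁻ i
2⁻-pos zero    = ℚ.positive⁻¹ 1ℚ
2⁻-pos (suc i) = ℚ.*-monoʳ-<-pos ½ (2⁻-pos i)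

2⁻-nonneg : ∀ i → 0ℚ ℚ.≤ 2⁻ i
2⁻-nonneg i = ℚ.<⇒≤ (2⁻-pos i)

2⁻-half : ∀ i → 2⁻ suc i ℚ.+ 2⁻ suc i ≡ 2⁻ i
2⁻-half i = solve 1 (λ ε → con ½ :* ε :+ con ½ :* ε := ε) refl (2⁻ i)
  where open +-*-Solver

≤-+-nonneg : ∀ {p q r} → 0ℚ ℚ.≤ r → q ≡ p ℚ.+ r → p ℚ.≤ q
≤-+-nonneg {p} {r = r} 0≤r refl = subst (ℚ._≤ p ℚ.+ r) (ℚ.+-identityʳ p) (ℚ.+-monoʳ-≤ p 0≤r)

ι : ℕ → ℚ
ι zero    = 0ℚ
ι (suc a) = 1ℚ ℚ.+ ι a

ι-+ : ∀ a b → ι (a +ℕ b) ≡ ι a ℚ.+ ι b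
ι-+ zero    b = sym (ℚ.+-identityˡ (ι b))
ι-+ (suc a) b = trans (cong (1ℚ ℚ.+_) (ι-+ a b)) (sym (ℚ.+-assoc 1ℚ (ι a) (ι b)))

ι-nonneg : ∀ a → 0ℚ ℚ.≤ ι a
ι-nonneg zero    = ℚ.≤-refl
ι-nonneg (suc a) = ℚ.≤-trans (ι-nonneg a)
  (≤-+-nonneg (ℚ.<⇒≤ (ℚ.positive⁻¹ 1ℚ)) (ℚ.+-comm 1ℚ (ι a)))

abstract
  -- The unreduced form is the one that `rational` yields for an entry with numerator `a`,
  -- subtrahend 0 and denominator 2 ^ i.
  dyadic : ℕ → ℕ → ℚ
  dyadic a i = (+ a ℤ.- + 0) ℚ./ suc (2 ^ℕ i ∸ 1)

  dyadic-/ : ∀ a i → dyadic a i ≡ (+ a ℤ.- + 0) ℚ./ suc (2 ^ℕ i ∸ 1)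
  dyadic-/ a i = refl

suc[2^i∸1] : ∀ i → suc (2 ^ℕ i ∸ 1) ≡ 2 ^ℕ i
suc[2^i∸1] i = ℕ.m+[n∸m]≡n {1} (>-nonZero⁻¹ (2 ^ℕ i) {{ℕ.m^n≢0 2 i}})

dyadic≡ : ∀ a i → dyadic a i ≡ ι a ℚ.* 2⁻ i
dyadic≡ a i = ℚ.toℚᵘ-injective (begin
  ℚ.toℚᵘ (dyadic a i)                                     ≡⟨ cong ℚ.toℚᵘ (dyadic-/ a i) ⟩
  ℚ.toℚᵘ ((+ a ℤ.- + 0) ℚ./ suc (2 ^ℕ i ∸ 1))              ≈⟨ ℚ.toℚᵘ-fromℚᵘ (ℚᵘ.mkℚᵘ (+ a ℤ.- + 0) (2 ^ℕ i ∸ 1)) ⟩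
  ℚᵘ.mkℚᵘ (+ a ℤ.- + 0) (2 ^ℕ i ∸ 1)                        ≈⟨ ℚᵘ.*≡* (cong₂ ℤ._*_
                                                                    (trans (ℤ.+-identityʳ (+ a)) (sym (ℤ.*-identityʳ (+ a))))
                                                                    (cong +_ (ℕ.+-identityʳ _))) ⟩
  ℚᵘ.mkℚᵘ (+ a) 0 ℚᵘ.* ℚᵘ.mkℚᵘ (+ 1) (2 ^ℕ i ∸ 1)           ≈⟨ ℚᵘ.*-cong (ιᵘ a) (2⁻ᵘ i) ⟨
  ℚ.toℚᵘ (ι a) ℚᵘ.* ℚ.toℚᵘ (2⁻ i)                          ≈⟨ ℚ.toℚᵘ-homo-* (ι a) (2⁻ i) ⟨
  ℚ.toℚᵘ (ι a ℚ.* 2⁻ i)                                    ∎)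
  where
  open ℚᵘ.≃-Reasoning
  ιᵘ : ∀ a → ℚ.toℚᵘ (ι a) ℚᵘ.≃ ℚᵘ.mkℚᵘ (+ a) 0
  ιᵘ zero    = ℚᵘ.≃-refl
  ιᵘ (suc a) = ℚᵘ.≃-trans (ℚ.toℚᵘ-homo-+ 1ℚ (ι a)) (ℚᵘ.≃-trans (ℚᵘ.+-congʳ ℚᵘ.1ℚᵘ (ιᵘ a))
    (ℚᵘ.*≡* (cong (ℤ._* + 1) (cong (λ x → + 1 ℤ.+ x) (ℤ.*-identityʳ (+ a))))))
  2⁻ᵘ : ∀ i → ℚ.toℚᵘ (2⁻ i) ℚᵘ.≃ ℚᵘ.mkℚᵘ (+ 1) (2 ^ℕ i ∸ 1)
  2⁻ᵘ zero    = ℚᵘ.≃-refl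
  2⁻ᵘ (suc i) = ℚᵘ.≃-trans (ℚ.toℚᵘ-homo-* ½ (2⁻ i)) (ℚᵘ.≃-trans (ℚᵘ.*-congˡ {ℚᵘ.½} (2⁻ᵘ i))
    (ℚᵘ.*≡* (cong (λ x → + 1 ℤ.* + x) (trans (suc[2^i∸1] (suc i))
      (sym (cong (2 *ℕ_) (suc[2^i∸1] i)))))))

dyadic-suc : ∀ a i → dyadic (suc a) i ≡ dyadic a i ℚ.+ 2⁻ i
dyadic-suc a i = trans (dyadic≡ (suc a) i) (trans
  (solve 2 (λ a t → (con 1ℚ :+ a) :* t := a :* t :+ t) refl (ι a) (2⁻ i))
  (cong (ℚ._+ 2⁻ i) (sym (dyadic≡ a i))))
  where open +-*-Solver

dyadic-double : ∀ b a i → dyadic (b +ℕ (a +ℕ a)) (suc i) ≡ dyadic a i ℚ.+ ι b ℚ.* 2⁻ suc i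
dyadic-double b a i = trans (dyadic≡ (b +ℕ (a +ℕ a)) (suc i)) (trans
  (cong (ℚ._* 2⁻ suc i) (trans (ι-+ b (a +ℕ a)) (cong (ι b ℚ.+_) (ι-+ a a)))) (trans
  (solve 3 (λ b a t → (b :+ (a :+ a)) :* (con ½ :* t) := a :* t :+ b :* (con ½ :* t)) refl (ι b) (ι a) (2⁻ i))
  (cong (ℚ._+ ι b ℚ.* 2⁻ suc i) (sym (dyadic≡ a i)))))
  where open +-*-Solver

dyadic-zero : ∀ i → dyadic 0 i ≡ 0ℚ
dyadic-zero i = trans (dyadic≡ 0 i) (ℚ.*-zeroˡ (2⁻ i))

dyadic-mono : ∀ {a b} i → a ≤ℕ b → dyadic a i ℚ.≤ dyadic b i
dyadic-mono {a} i a≤b with ℕ.≤⇒≤′ a≤b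
... | l = go l
  where
  go : ∀ {b} → a ≤′ b → dyadic a i ℚ.≤ dyadic b i
  go (≤′-reflexive refl) = ℚ.≤-refl
  go (≤′-step {b} l)     = ℚ.≤-trans (go {b} l) (≤-+-nonneg (2⁻-nonneg i) (dyadic-suc b i))

dyadic-nonneg : ∀ a i → 0ℚ ℚ.≤ dyadic a i
dyadic-nonneg a i = subst (ℚ._≤ dyadic a i) (dyadic-zero i) (dyadic-mono {0} {a} i z≤n)

-- Binary expansions

lo : Bits → ℕ → ℚ
lo β i = dyadic (prefix β i) i

lo-suc : ∀ β i → lo β (suc i) ≡ lo β i ℚ.+ ι (β i) ℚ.* 2⁻ suc i
lo-suc β i = dyadic-double (β i) (prefix β i) i

ι*-nonneg : ∀ b i → 0ℚ ℚ.≤ ι b ℚ.* 2⁻ i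
ι*-nonneg b i = subst (0ℚ ℚ.≤_) (dyadic≡ b i) (dyadic-nonneg b i)

lo-mono : ∀ β {k l} → k ≤ℕ l → lo β k ℚ.≤ lo β l
lo-mono β k≤l = go (ℕ.≤⇒≤′ k≤l)
  where
  go : ∀ {k l} → k ≤′ l → lo β k ℚ.≤ lo β l
  go (≤′-reflexive refl) = ℚ.≤-refl
  go (≤′-step {l} k≤l)   = ℚ.≤-trans (go k≤l) (≤-+-nonneg (ι*-nonneg (β l) (suc l)) (lo-suc β l))

-- The next bit selects the left or the right half of the current dyadic interval, so the right
-- endpoint never increases.
hi-mono : ∀ {β} → Binary β → ∀ {k l} → k ≤ℕ l → lo β l ℚ.+ 2⁻ l ℚ.≤ lo β k ℚ.+ 2⁻ k
hi-mono {β} bin k≤l = go (ℕ.≤⇒≤′ k≤l)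
  where
  open +-*-Solver
  step : ∀ {b} l → b < 2 → (lo β l ℚ.+ ι b ℚ.* 2⁻ suc l) ℚ.+ 2⁻ suc l ℚ.≤ lo β l ℚ.+ 2⁻ l
  step {0} l _ = ≤-+-nonneg (2⁻-nonneg (suc l))
    (solve 2 (λ x t → x :+ t := ((x :+ con 0ℚ :* (con ½ :* t)) :+ con ½ :* t) :+ con ½ :* t) refl (lo β l) (2⁻ l))
  step {1} l _ = ℚ.≤-reflexive
    (solve 2 (λ x t → (x :+ (con 1ℚ :+ con 0ℚ) :* (con ½ :* t)) :+ con ½ :* t := x :+ t) refl (lo β l) (2⁻ l))
  step {suc (suc _)} l (s≤s (s≤s ()))
  go : ∀ {k l} → k ≤′ l → lo β l ℚ.+ 2⁻ l ℚ.≤ lo β k ℚ.+ 2⁻ k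
  go (≤′-reflexive refl) = ℚ.≤-refl
  go (≤′-step {l} k≤l)   = ℚ.≤-trans
    (subst (λ x → x ℚ.+ 2⁻ suc l ℚ.≤ lo β l ℚ.+ 2⁻ l) (sym (lo-suc β l)) (step l (bin l))) (go k≤l)

lo≤hi : ∀ {β} → Binary β → ∀ {k l} → k ≤ℕ l → lo β l ℚ.≤ lo β k ℚ.+ 2⁻ k
lo≤hi {β} bin {k} {l} k≤l = ℚ.≤-trans (≤-+-nonneg (2⁻-nonneg l) refl) (hi-mono {β} bin k≤l)

∣∣≤ : ∀ {p ε} → p ℚ.≤ ε → ℚ.- p ℚ.≤ ε → ℚ.∣ p ∣ ℚ.≤ ε
∣∣≤ {p} h k with ℚ.∣p∣≡p∨∣p∣≡-p p
... | inj₁ e rewrite e = h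
... | inj₂ e rewrite e = k

∣-∣≤ : ∀ {a δ u w} → a ℚ.≤ u → u ℚ.≤ a ℚ.+ δ → a ℚ.≤ w → w ℚ.≤ a ℚ.+ δ → ℚ.∣ u ℚ.- w ∣ ℚ.≤ δ
∣-∣≤ {a} {δ} {u} {w} a≤u u≤ a≤w w≤ = ∣∣≤ (bound u≤ a≤w)
  (subst (ℚ._≤ δ) (solve 2 (λ u w → w :- u := :- (u :- w)) refl u w) (bound w≤ a≤u))
  where
  open +-*-Solver
  bound : ∀ {u w} → u ℚ.≤ a ℚ.+ δ → a ℚ.≤ w → u ℚ.- w ℚ.≤ δ
  bound {u} {w} h k = subst (u ℚ.- w ℚ.≤_) (solve 2 (λ a d → (a :+ d) :- a := d) refl a δ)
    (ℚ.+-mono-≤ h (ℚ.neg-antimono-≤ k))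

-- If d + 1 is the denominator of `ε`, then `ε` is at least 1 / (d + 1), and d + 1 ≤ 2 ^ d.
2⁻-archimedean : ∀ {ε} → 0ℚ ℚ.< ε → ∃[ i ] 2⁻ i ℚ.≤ ε
2⁻-archimedean {ε@(mkℚ (+ suc a) d _)} _ = d , ℚ.≤-trans (small d) (ℚ.toℚᵘ-cancel-≤
    (ℚᵘ.≤-trans (ℚᵘ.≤-reflexive (ℚ.toℚᵘ-fromℚᵘ (ℚᵘ.mkℚᵘ (+ 1) d)))
      (ℚᵘ.*≤* (ℤ.*-monoʳ-≤-nonNeg (+ suc d) {+ 1} {+ suc a} (ℤ.+≤+ (s≤s z≤n))))))
  where
  1≤2^ : ∀ d → suc d ≤ℕ 2 ^ℕ d
  1≤2^ zero    = s≤s z≤n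
  1≤2^ (suc d) = ℕ.≤-trans (ℕ.+-mono-≤ {1} {2 ^ℕ d} (ℕ.≤-trans (s≤s z≤n) (1≤2^ d)) (1≤2^ d))
    (ℕ.≤-reflexive (cong (2 ^ℕ d +ℕ_) (sym (ℕ.+-identityʳ _))))
  small : ∀ d → 2⁻ d ℚ.≤ + 1 ℚ./ suc d
  small d = subst (ℚ._≤ + 1 ℚ./ suc d) (trans (trans (sym (dyadic-/ 1 d)) (dyadic≡ 1 d))
      (trans (cong (ℚ._* 2⁻ d) (ℚ.+-identityʳ 1ℚ)) (ℚ.*-identityˡ (2⁻ d))))
    (ℚ.toℚᵘ-cancel-≤ (ℚᵘ.≤-trans (ℚᵘ.≤-reflexive (ℚ.toℚᵘ-fromℚᵘ (ℚᵘ.mkℚᵘ (+ 1) (2 ^ℕ d ∸ 1))))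
      (ℚᵘ.≤-trans (ℚᵘ.*≤* (ℤ.*-monoˡ-≤-nonNeg (+ 1) (ℤ.+≤+ (ℕ.≤-trans (1≤2^ d) (ℕ.≤-reflexive (sym (suc[2^i∸1] d)))))))
        (ℚᵘ.≤-reflexive (ℚᵘ.≃-sym (ℚ.toℚᵘ-fromℚᵘ (ℚᵘ.mkℚᵘ (+ 1) d)))))))
2⁻-archimedean {mkℚ (+ zero) _ _} (ℚ.*<* (ℤ.+<+ ()))
2⁻-archimedean {mkℚ -[1+ _ ] _ _} (ℚ.*<* ())

≤-eventually : ∀ {x y} N → (∀ {n} → N ≤ℕ n → seq x n ℚ.≤ seq y n) → x ≤ y
≤-eventually N h ε>0 = N , λ N≤n → ℚ.≤-trans (h N≤n) (≤-+-nonneg (ℚ.<⇒≤ ε>0) refl)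

fromBinary : ∀ {β} → Binary β → ℝ
fromBinary {β} bin = mkℝ (lo β) λ ε>0 →
  let N , h = 2⁻-archimedean ε>0 in N , λ N≤m N≤n →
    ℚ.≤-trans (∣-∣≤ {lo β N} (lo-mono β N≤m) (lo≤hi {β} bin N≤m) (lo-mono β N≤n) (lo≤hi {β} bin N≤n)) h

-- The intervals are closed, so a dyadic rational strictly between 0 and 1 keeps both of its
-- expansions, and 1 has the one consisting of ones.
Expansion : Bits → ℝ → Set
Expansion β x = ∀ i → fromℚ (lo β i) ≤ x × x ≤ fromℚ (lo β i ℚ.+ 2⁻ i)

fromBinary-expansion : ∀ {β} (bin : Binary β) → Expansion β (fromBinary {β} bin)
fromBinary-expansion {β} bin i =
    ≤-eventually {fromℚ (lo β i)} {fromBinary {β} bin} i (lo-mono β)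
  , ≤-eventually {fromBinary {β} bin} {fromℚ (lo β i ℚ.+ 2⁻ i)} i (lo≤hi {β} bin)

lo≤1 : ∀ {β} → Binary β → ∀ i → lo β i ℚ.≤ 1ℚ
lo≤1 {β} bin i = subst (lo β i ℚ.≤_) (trans (cong (ℚ._+ 1ℚ) (dyadic-zero 0)) (ℚ.+-identityˡ 1ℚ)) (lo≤hi {β} bin (z≤n {i}))

fromBinary-unit : ∀ {β} (bin : Binary β) → 0ℝ ≤ fromBinary {β} bin × fromBinary {β} bin ≤ 1ℝ
fromBinary-unit {β} bin =
    ≤-eventually {0ℝ} {fromBinary {β} bin} 0 (λ {n} _ → dyadic-nonneg (prefix β n) n)
  , ≤-eventually {fromBinary {β} bin} {1ℝ} 0 (λ {n} _ → lo≤1 {β} bin n)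

Expansion-cong : ∀ {β β′ x} → (∀ k → β k ≡ β′ k) → Expansion β x → Expansion β′ x
Expansion-cong {β} {β′} {x} e h i = subst (λ a → fromℚ (dyadic a i) ≤ x × x ≤ fromℚ (dyadic a i ℚ.+ 2⁻ i))
  (prefix-cong {β} {β′} i (λ {k} _ → e k)) (h i)

Expansion-≈ : ∀ {β x y} → x ≈ᵣ y → Expansion β x → Expansion β y
Expansion-≈ {β} {x} {y} (x≤y , y≤x) h i =
    ≤-trans {fromℚ (lo β i)} {x} {y} (proj₁ (h i)) x≤y
  , ≤-trans {y} {x} {fromℚ (lo β i ℚ.+ 2⁻ i)} y≤x (proj₂ (h i))

module _ (em : ExcludedMiddle 0ℓ) where

  -- If some late approximation is at most `q`, the Cauchy property carries this, up to `ε`, to all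
  -- late ones; if none is, then `q` lies below `x` after all.
  ≰⇒≥ : ∀ x q → ¬ fromℚ q ≤ x → x ≤ fromℚ q
  ≰⇒≥ x q q≰x {ε} ε>0 with cauchy x ε>0
  ... | N , u with em {∃[ n ] N ≤ℕ n × seq x n ℚ.≤ q}
  ... | yes (k , N≤k , h) = N , λ {n} N≤n → begin
    seq x n                              ≡⟨ solve 2 (λ a b → a := b :+ (a :- b)) refl (seq x n) (seq x k) ⟩
    seq x k ℚ.+ (seq x n ℚ.- seq x k)    ≤⟨ ℚ.+-mono-≤ h (ℚ.≤-trans (p≤∣p∣ (seq x n ℚ.- seq x k)) (u N≤n N≤k)) ⟩
    q ℚ.+ ε                              ∎
    where
    open ℚ.≤-Reasoning
    open +-*-Solver
    p≤∣p∣ : ∀ p → p ℚ.≤ ℚ.∣ p ∣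
    p≤∣p∣ p with ℚ.∣p∣≡p∨∣p∣≡-p p | ℚ.≤-total 0ℚ p
    ... | inj₁ e | _      = ℚ.≤-reflexive (sym e)
    ... | inj₂ e | inj₁ l = ℚ.≤-reflexive (sym (ℚ.0≤p⇒∣p∣≡p l))
    ... | inj₂ e | inj₂ l = ℚ.≤-trans l (ℚ.0≤∣p∣ p)
  ... | no h = ⊥-elim (q≰x
    (≤-eventually {fromℚ q} {x} N λ {n} N≤n → ℚ.<⇒≤ (ℚ.≰⇒> λ l → h (n , N≤n , l))))

  module _ (x : ℝ) (0≤x : 0ℝ ≤ x) (x≤1 : x ≤ 1ℝ) where
    private
      next : ℕ → ℕ → ℕ
      next a i with em {fromℚ (dyadic (1 +ℕ (a +ℕ a)) (suc i)) ≤ x}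
      ... | yes _ = 1
      ... | no  _ = 0

      next<2 : ∀ a i → next a i < 2
      next<2 a i with em {fromℚ (dyadic (1 +ℕ (a +ℕ a)) (suc i)) ≤ x}
      ... | yes _ = s≤s (s≤s z≤n)
      ... | no  _ = s≤s z≤n

      Encloses : ℕ → ℕ → Set
      Encloses a i = fromℚ (dyadic a i) ≤ x × x ≤ fromℚ (dyadic a i ℚ.+ 2⁻ i)

      next-encloses : ∀ a i → Encloses a i → Encloses (next a i +ℕ (a +ℕ a)) (suc i)
      next-encloses a i (l , g) with em {fromℚ (dyadic (1 +ℕ (a +ℕ a)) (suc i)) ≤ x}
      ... | yes h = h , subst (λ q → x ≤ fromℚ q) (sym (trans
                (cong (ℚ._+ 2⁻ suc i) (dyadic-double 1 a i))
                (solve 2 (λ d t → (d :+ (con 1ℚ :+ con 0ℚ) :* (con ½ :* t)) :+ con ½ :* t := d :+ t) refl (dyadic a i) (2⁻ i)))) g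
        where open +-*-Solver
      ... | no  h = subst (λ q → fromℚ q ≤ x) (sym (trans (dyadic-double 0 a i)
                (solve 2 (λ d t → d :+ con 0ℚ :* t := d) refl (dyadic a i) (2⁻ suc i)))) l
              , subst (λ q → x ≤ fromℚ q) (dyadic-suc (a +ℕ a) (suc i)) (≰⇒≥ x (dyadic (1 +ℕ (a +ℕ a)) (suc i)) h)
        where open +-*-Solver

      prefixes : ℕ → ℕ
      prefixes zero    = 0
      prefixes (suc i) = next (prefixes i) i +ℕ (prefixes i +ℕ prefixes i)

    abstract
      expand : Bits
      expand i = next (prefixes i) i

      expand-binary : Binary expand
      expand-binary i = next<2 (prefixes i) i

      expand-expansion : Expansion expand x
      expand-expansion i = subst (λ a → Encloses a i) (sym (same i)) (encl i)
        where
        same : ∀ i → prefix expand i ≡ prefixes i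
        same zero    = refl
        same (suc i) = cong (λ a → expand i +ℕ (a +ℕ a)) (same i)
        encl : ∀ i → Encloses (prefixes i) i
        encl zero    = subst (λ q → fromℚ q ≤ x × x ≤ fromℚ (q ℚ.+ 1ℚ)) (sym (dyadic-zero 0)) (0≤x , x≤1)
        encl (suc i) = next-encloses (prefixes i) i (encl i)

-- Names of points of the cube from the bits of their coordinates

rational-dyadic : ∀ p {a i k} → column 3 p (# 0) i ≡ a → column 3 p (# 1) i ≡ 0 →
                  column 3 p (# 2) i ≡ 2 ^ℕ k ∸ 1 → rational p i ≡ dyadic a k
rational-dyadic p {a} {i} {k} e₀ e₁ e₂ =
  trans (cong (λ x → (+ x ℤ.- + column 3 p (# 1) i) ℚ./ suc (column 3 p (# 2) i)) e₀)
    (trans (cong₂ (λ x y → (+ a ℤ.- + x) ℚ./ suc y) e₁ e₂) (sym (dyadic-/ a k)))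

module EntryNames (n′ : ℕ) where
  open Certificates n′
  entry-at : ∀ β {j e} i → j < suc n′ → e < 3 →
             entry β (j +ℕ (e +ℕ i *ℕ 3) *ℕ suc n′) ≡ eq e 0 *ℕ prefix (β j) i +ℕ eq e 2 *ℕ (2 ^ℕ i ∸ 1)
  entry-at β {j} {e} i j<n e<3
    rewrite proj₁ (modDiv-unique (e +ℕ i *ℕ 3) j<n) | proj₂ (modDiv-unique (e +ℕ i *ℕ 3) j<n)
          | proj₁ (modDiv-unique i e<3) | proj₂ (modDiv-unique i e<3) = refl

  entry-rational : ∀ β (j : Fin (suc n′)) i → rational (column (suc n′) (entry β) j) i ≡ lo (β (toℕ j)) i
  entry-rational β j i = rational-dyadic (column (suc n′) (entry β) j) {prefix (β (toℕ j)) i} {i} {i}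
    (trans (entry-at β i (toℕ<n j) (s≤s z≤n)) (trans (ℕ.+-identityʳ _) (ℕ.+-identityʳ _)))
    (entry-at β i (toℕ<n j) (s≤s (s≤s z≤n)))
    (trans (entry-at β i (toℕ<n j) (s≤s (s≤s (s≤s z≤n)))) (ℕ.+-identityʳ _))

  entry-names : ∀ {β} {x : Carrier (Cube (suc n′))} → (∀ j → Expansion (β (toℕ j)) (proj₁ (x j))) →
                RepresentedSpace._names_ (Cube (suc n′)) (entry β) x
  entry-names {β} {x} h j i = subst (λ q → fromℚ (q ℚ.- 2⁻ i) ≤ y × y ≤ fromℚ (q ℚ.+ 2⁻ i)) (sym (entry-rational β j i))
    ( ≤-trans {fromℚ (lo b i ℚ.- 2⁻ i)} {fromℚ (lo b i)} {y}
        (≤-eventually {fromℚ (lo b i ℚ.- 2⁻ i)} {fromℚ (lo b i)} 0 (λ _ → ≤-+-nonneg (2⁻-nonneg i)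
          (solve 2 (λ a t → a := (a :- t) :+ t) refl (lo b i) (2⁻ i))))
        (proj₁ (h j i))
    , proj₂ (h j i))
    where
    open +-*-Solver
    b = β (toℕ j)
    y = proj₁ (x j)

-- Convex combinations

mix : ℚ → ℚ → ℚ → ℚ
mix t x y = (1ℚ ℚ.- t) ℚ.* x ℚ.+ t ℚ.* y

mix-same : ∀ t x → mix t x x ≡ x
mix-same = solve 2 (λ t x → (con 1ℚ :- t) :* x :+ t :* x := x) refl
  where open +-*-Solver

mix-mono : ∀ {t x y x′ y′} → 0ℚ ℚ.≤ t → t ℚ.≤ 1ℚ → x ℚ.≤ x′ → y ℚ.≤ y′ → mix t x y ℚ.≤ mix t x′ y′
mix-mono {t} 0≤t t≤1 x≤ y≤ = ℚ.+-mono-≤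
  (ℚ.*-monoˡ-≤-nonNeg (1ℚ ℚ.- t) {{ℚ.nonNegative 0≤1-t}} x≤)
  (ℚ.*-monoˡ-≤-nonNeg t {{ℚ.nonNegative 0≤t}} y≤)
  where
  0≤1-t : 0ℚ ℚ.≤ 1ℚ ℚ.- t
  0≤1-t = subst (ℚ._≤ 1ℚ ℚ.- t) (ℚ.+-inverseʳ t) (ℚ.+-monoˡ-≤ (ℚ.- t) t≤1)

mix-unit : ∀ {t x y} → 0ℚ ℚ.≤ t → t ℚ.≤ 1ℚ → 0ℚ ℚ.≤ x → x ℚ.≤ 1ℚ → 0ℚ ℚ.≤ y → y ℚ.≤ 1ℚ →
           0ℚ ℚ.≤ mix t x y × mix t x y ℚ.≤ 1ℚ
mix-unit {t} {x} {y} 0≤t t≤1 0≤x x≤1 0≤y y≤1 =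
    subst (ℚ._≤ mix t x y) (mix-same t 0ℚ) (mix-mono {t} 0≤t t≤1 0≤x 0≤y)
  , subst (mix t x y ℚ.≤_) (mix-same t 1ℚ) (mix-mono {t} 0≤t t≤1 x≤1 y≤1)

-- Division is needed for the parameter (r - x) / (y - x) at which a segment meets a hyperplane.
-- Indices below `I` are replaced by `I`, so that the bounds on `u` and `d` hold for all terms.
module Quotient (u d : ℝ) {δ} (δ>0 : 0ℚ ℚ.< δ) (I : ℕ)
  (0≤u : ∀ {n} → I ≤ℕ n → 0ℚ ℚ.≤ seq u n)
  (u≤d : ∀ {n} → I ≤ℕ n → seq u n ℚ.≤ seq d n)
  (δ≤d : ∀ {n} → I ≤ℕ n → δ ℚ.≤ seq d n) where
  private
    U D : ℕ → ℚ
    U n = seq u (n ⊔ I)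
    D n = seq d (n ⊔ I)

    D-pos : ∀ n → ℚ.Positive (D n)
    D-pos n = ℚ.positive (ℚ.<-≤-trans δ>0 (δ≤d (ℕ.m≤n⊔m n I)))

    q : ℕ → ℚ
    q n = U n ℚ.* (ℚ.1/ D n) {{ℚ.pos⇒nonZero (D n) {{D-pos n}}}}

    q*D : ∀ n → q n ℚ.* D n ≡ U n
    q*D n = trans (ℚ.*-assoc (U n) _ (D n)) (trans
      (cong (U n ℚ.*_) (ℚ.*-inverseˡ (D n) {{ℚ.pos⇒nonZero (D n) {{D-pos n}}}})) (ℚ.*-identityʳ (U n)))

  0≤q : ∀ n → 0ℚ ℚ.≤ q n
  0≤q n = ℚ.*-cancelʳ-≤-pos (D n) {{D-pos n}}
    (subst₂ ℚ._≤_ (sym (ℚ.*-zeroˡ (D n))) (sym (q*D n)) (0≤u (ℕ.m≤n⊔m n I)))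

  q≤1 : ∀ n → q n ℚ.≤ 1ℚ
  q≤1 n = ℚ.*-cancelʳ-≤-pos (D n) {{D-pos n}}
    (subst₂ ℚ._≤_ (sym (q*D n)) (sym (ℚ.*-identityˡ (D n))) (u≤d (ℕ.m≤n⊔m n I)))

  private
    difference : ∀ m n → (q m ℚ.- q n) ℚ.* D m ≡ (U m ℚ.- U n) ℚ.+ q n ℚ.* (D n ℚ.- D m)
    difference m n = trans
      (solve 4 (λ a b c e → (a :- b) :* c := (a :* c :- b :* e) :+ b :* (e :- c)) refl (q m) (q n) (D m) (D n))
      (cong₂ (λ x y → (x ℚ.- y) ℚ.+ q n ℚ.* (D n ℚ.- D m)) (q*D m) (q*D n))
      where open +-*-Solver

    -- By `difference` and 0 ≤ q ≤ 1, the distance of the quotients times `D m` is at most the sum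
    -- of the two given distances, while `D m` is at least `δ`. Hence the tolerance half of `δ ε`
    -- for each of them.
    bound : ∀ {ε} m n → ℚ.∣ U m ℚ.- U n ∣ ℚ.≤ ½ ℚ.* (δ ℚ.* ε) → ℚ.∣ D n ℚ.- D m ∣ ℚ.≤ ½ ℚ.* (δ ℚ.* ε) →
            ℚ.∣ q m ℚ.- q n ∣ ℚ.≤ ε
    bound {ε} m n hU hD = ℚ.*-cancelʳ-≤-pos δ {{ℚ.positive δ>0}} (begin
      ℚ.∣ q m ℚ.- q n ∣ ℚ.* δ
        ≤⟨ ℚ.*-monoˡ-≤-nonNeg ℚ.∣ q m ℚ.- q n ∣ {{ℚ.∣-∣-nonNeg (q m ℚ.- q n)}} (δ≤d (ℕ.m≤n⊔m m I)) ⟩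
      ℚ.∣ q m ℚ.- q n ∣ ℚ.* D m
        ≡⟨ cong (ℚ.∣ q m ℚ.- q n ∣ ℚ.*_) (ℚ.0≤p⇒∣p∣≡p (ℚ.<⇒≤ (ℚ.positive⁻¹ (D m) {{D-pos m}}))) ⟨
      ℚ.∣ q m ℚ.- q n ∣ ℚ.* ℚ.∣ D m ∣
        ≡⟨ ℚ.∣p*q∣≡∣p∣*∣q∣ (q m ℚ.- q n) (D m) ⟨
      ℚ.∣ (q m ℚ.- q n) ℚ.* D m ∣
        ≡⟨ cong ℚ.∣_∣ (difference m n) ⟩
      ℚ.∣ (U m ℚ.- U n) ℚ.+ q n ℚ.* (D n ℚ.- D m) ∣
        ≤⟨ ℚ.∣p+q∣≤∣p∣+∣q∣ (U m ℚ.- U n) (q n ℚ.* (D n ℚ.- D m)) ⟩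
      ℚ.∣ U m ℚ.- U n ∣ ℚ.+ ℚ.∣ q n ℚ.* (D n ℚ.- D m) ∣
        ≤⟨ ℚ.+-mono-≤ hU (ℚ.≤-trans (ℚ.≤-reflexive (ℚ.∣p*q∣≡∣p∣*∣q∣ (q n) (D n ℚ.- D m))) second) ⟩
      ½ ℚ.* (δ ℚ.* ε) ℚ.+ ½ ℚ.* (δ ℚ.* ε)
        ≡⟨ solve 2 (λ δ ε → con ½ :* (δ :* ε) :+ con ½ :* (δ :* ε) := ε :* δ) refl δ ε ⟩
      ε ℚ.* δ ∎)
      where
      open ℚ.≤-Reasoning
      open +-*-Solver
      second : ℚ.∣ q n ∣ ℚ.* ℚ.∣ D n ℚ.- D m ∣ ℚ.≤ ½ ℚ.* (δ ℚ.* ε)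
      second = begin
        ℚ.∣ q n ∣ ℚ.* ℚ.∣ D n ℚ.- D m ∣
          ≤⟨ ℚ.*-monoʳ-≤-nonNeg ℚ.∣ D n ℚ.- D m ∣ {{ℚ.∣-∣-nonNeg (D n ℚ.- D m)}}
               (subst (ℚ._≤ 1ℚ) (sym (ℚ.0≤p⇒∣p∣≡p (0≤q n))) (q≤1 n)) ⟩
        1ℚ ℚ.* ℚ.∣ D n ℚ.- D m ∣        ≡⟨ ℚ.*-identityˡ _ ⟩
        ℚ.∣ D n ℚ.- D m ∣               ≤⟨ hD ⟩
        ½ ℚ.* (δ ℚ.* ε)                 ∎

  abstract
    quotient : ℝ
    quotient = mkℝ q λ {ε} ε>0 →
      let δε>0 = subst (ℚ._< δ ℚ.* ε) (ℚ.*-zeroʳ δ) (ℚ.*-monoʳ-<-pos δ {{ℚ.positive δ>0}} ε>0)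
          ε′>0 = ℚ.*-monoʳ-<-pos ½ δε>0
          M , v = cauchy u ε′>0
          N , w = cauchy d ε′>0
      in M ⊔ N , λ {m} {n} l l′ → bound {ε} m n
           (v (up m (ℕ.m⊔n≤o⇒m≤o M N l)) (up n (ℕ.m⊔n≤o⇒m≤o M N l′)))
           (w (up n (ℕ.m⊔n≤o⇒n≤o M N l′)) (up m (ℕ.m⊔n≤o⇒n≤o M N l)))
      where
      up : ∀ {N} n → N ≤ℕ n → N ≤ℕ n ⊔ I
      up n l = ℕ.≤-trans l (ℕ.m≤m⊔n n I)

    quotient-* : ∀ {n} → I ≤ℕ n → seq quotient n ℚ.* seq d n ≡ seq u n
    quotient-* {n} I≤n = subst (λ k → q n ℚ.* seq d k ≡ seq u k) (ℕ.m≥n⇒m⊔n≡m I≤n) (q*D n)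

    0≤quotient : ∀ n → 0ℚ ℚ.≤ seq quotient n
    0≤quotient = 0≤q

    quotient≤1 : ∀ n → seq quotient n ℚ.≤ 1ℚ
    quotient≤1 = q≤1

-- At precision `I` the dyadic interval of `R` separates those of `X` and `Y`. So the value of `R`
-- lies between theirs whatever its later bits are, and the distance of the ends is at least `2⁻ I`,
-- as the division requires.
module Segment {X Y R : Bits} (bX : Binary X) (bY : Binary Y) (bR : Binary R) (I : ℕ)
  (X<R : suc (prefix X I) ≡ prefix R I) (R<Y : suc (prefix R I) ≤ℕ prefix Y I) where
  private
    x y r : ℝ
    x = fromBinary {X} bX
    y = fromBinary {Y} bY
    r = fromBinary {R} bR

    x≤rI : ∀ {n} → I ≤ℕ n → lo X n ℚ.≤ lo R I
    x≤rI {n} I≤n = subst (lo X n ℚ.≤_) (trans (sym (dyadic-suc (prefix X I) I)) (cong (λ a → dyadic a I) X<R))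
      (lo≤hi {X} bX I≤n)

    r+≤y : ∀ {n} → I ≤ℕ n → lo R I ℚ.+ 2⁻ I ℚ.≤ lo Y n
    r+≤y I≤n = ℚ.≤-trans (subst (ℚ._≤ lo Y I) (dyadic-suc (prefix R I) I) (dyadic-mono I R<Y)) (lo-mono Y I≤n)

    0≤- : ∀ {a b} → a ℚ.≤ b → 0ℚ ℚ.≤ b ℚ.- a
    0≤- {a} {b} h = subst (ℚ._≤ b ℚ.- a) (ℚ.+-inverseʳ a) (ℚ.+-monoˡ-≤ (ℚ.- a) h)

    δ≤d : ∀ {n} → I ≤ℕ n → 2⁻ I ℚ.≤ lo Y n ℚ.- lo X n
    δ≤d {n} I≤n = subst (ℚ._≤ lo Y n ℚ.- lo X n)
      (solve 2 (λ a t → (a :+ t) :- a := t) refl (lo R I) (2⁻ I))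
      (ℚ.+-mono-≤ (r+≤y I≤n) (ℚ.neg-antimono-≤ (x≤rI I≤n)))
      where open +-*-Solver

    module Q = Quotient (r - x) (y - x) (2⁻-pos I) I
      (λ {n} I≤n → 0≤- (ℚ.≤-trans (x≤rI I≤n) (lo-mono R I≤n)))
      (λ {n} I≤n → ℚ.+-monoˡ-≤ (ℚ.- lo X n) (ℚ.≤-trans (lo≤hi {R} bR I≤n) (r+≤y I≤n)))
      δ≤d

  position : ℝ
  position = Q.quotient

  0≤position : ∀ n → 0ℚ ℚ.≤ seq position n
  0≤position = Q.0≤quotient

  position≤1 : ∀ n → seq position n ℚ.≤ 1ℚ
  position≤1 = Q.quotient≤1

  mix-position : ∀ {n} → I ≤ℕ n → mix (seq position n) (lo X n) (lo Y n) ≡ lo R n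
  mix-position {n} I≤n = trans
    (solve 3 (λ t x y → (con 1ℚ :- t) :* x :+ t :* y := x :+ t :* (y :- x)) refl (seq position n) (lo X n) (lo Y n))
    (trans (cong (lo X n ℚ.+_) (Q.quotient-* I≤n))
      (solve 2 (λ x r → x :+ (r :- x) := r) refl (lo X n) (lo R n)))
    where open +-*-Solver

-- Compactness

score≢0⇒ : ∀ {f q r} → graph (associated f) q r → ∀ s → score f q s ≢ 0 → ∃[ N ] r N ≢ 0
score≢0⇒ {f} {q} {r} ans s d =
  let N , _ , d′ = sumTo≢0⇒ s d ; k , a = ans N in N , λ z → d′ (vanish N k a z)
  where
  vanish : ∀ N k → Answer f q N k (r N) → r N ≡ 0 → firstValue f q N s ∸ 1 ≡ 0
  vanish N k a z with k ℕ.<? s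
  ... | no  k≮s = cong (_∸ 1) (firstValue-before {f} {q} {N} {k} {r N} a (ℕ.≮⇒≥ k≮s))
  ... | yes k<s = trans (cong (_∸ 1) (firstValue-after {f} {q} {N} {k} {r N} a k<s)) z

⇒score≢0 : ∀ {f q r} → graph (associated f) q r → ∀ {N} → r N ≢ 0 → ∃[ s ] score f q s ≢ 0
⇒score≢0 {f} {q} {r} ans {N} d =
  let k , a = ans N ; s = suc (k ⊔ N) in s , λ z →
    d (trans (sym (cong (_∸ 1) (firstValue-after {f} {q} {N} {k} {r N} a (s≤s (ℕ.m≤m⊔n k N)))))
             (sumTo≡0⇒ s z (s≤s (ℕ.m≤n⊔m k N))))

-- Weak König's lemma, with `D s γ` for "`γ` is not excluded at stage `s`". Locality is asked for
-- only from `S₀` on, because the comparison of prefixes may read more bits than an early stage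
-- covers.
module König (em : ExcludedMiddle 0ℓ) (D : ℕ → Bits → Set) (S₀ : ℕ)
  (mono : ∀ {s s′ γ} → s ≤ℕ s′ → D s′ γ → D s γ)
  (local : ∀ {s γ γ′} → S₀ ≤ℕ s → (∀ {k} → k < s → γ k ≡ γ′ k) → D s γ → D s γ′)
  (nonempty : ∀ {s} → S₀ ≤ℕ s → ∃[ γ ] Binary γ × D s γ) where
  private
    Reaches : ℕ → Bits → ℕ → Set
    Reaches k γ S = ∃[ s ] S ≤ℕ s × ∃[ γ′ ] Binary γ′ × (∀ {i} → i < k → γ′ i ≡ γ i) × D s γ′

    Extendible : ℕ → Bits → Set
    Extendible k γ = ∀ S → Reaches k γ S

    set : ℕ → ℕ → Bits → Bits
    set k b γ i with i ℕ.≟ k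
    ... | yes _ = b
    ... | no  _ = γ i

    set-here : ∀ k {b γ} → set k b γ k ≡ b
    set-here k with k ℕ.≟ k
    ... | yes _ = refl
    ... | no  d = contradiction refl d

    agree : ∀ {k b} {γ γ′ : Bits} → (∀ {i} → i < k → γ′ i ≡ γ i) → γ′ k ≡ b → ∀ {i} → i < suc k → γ′ i ≡ set k b γ i
    agree {k} {b} {γ} e e′ {i} (s≤s i≤k) with i ℕ.≟ k
    ... | yes refl = e′
    ... | no  i≢k  = e (ℕ.≤∧≢⇒< i≤k i≢k)

    -- If the prefix followed by 0 fails to reach some stage `S₁`, then every sequence that extends
    -- the prefix and reaches beyond `S₁` continues with 1.
    extend : ∀ k γ → Extendible k γ → ∃[ b ] b < 2 × Extendible (suc k) (set k b γ)
    extend k γ ext with em {∃[ S ] ¬ Reaches (suc k) (set k 0 γ) S}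
    ... | no  h = 0 , s≤s z≤n , λ S → dec S em
      where
      dec : ∀ S → Dec (Reaches (suc k) (set k 0 γ) S) → Reaches (suc k) (set k 0 γ) S
      dec S (yes r) = r
      dec S (no  r) = ⊥-elim (h (S , r))
    ... | yes (S₁ , h) = 1 , s≤s (s≤s z≤n) , λ S → one S (ext (S ⊔ S₁))
      where
      one : ∀ S → Reaches k γ (S ⊔ S₁) → Reaches (suc k) (set k 1 γ) S
      one S (s , l , γ′ , bin , e , d) with γ′ k in e′ | bin k
      ... | 0 | _ = ⊥-elim (h (s , ℕ.m⊔n≤o⇒n≤o S S₁ l , γ′ , bin , agree {k} {0} {γ} {γ′} e e′ , d))
      ... | 1 | _ = s , ℕ.m⊔n≤o⇒m≤o S S₁ l , γ′ , bin , agree {k} {1} {γ} {γ′} e e′ , d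
      ... | suc (suc _) | s≤s (s≤s ())

    approx : ∀ k → Σ Bits (Extendible k)
    approx zero    = (λ _ → 0) , λ S →
      let γ , bin , d = nonempty {S ⊔ S₀} (ℕ.m≤n⊔m S S₀) in S ⊔ S₀ , ℕ.m≤m⊔n S S₀ , γ , bin , (λ ()) , d
    approx (suc k) =
      let γ , ext = approx k ; b , _ , ext′ = extend k γ ext in set k b γ , ext′

    approx-stable : ∀ {i k} → i < k → proj₁ (approx k) i ≡ proj₁ (approx (suc i)) i
    approx-stable {i} {suc k} (s≤s i≤k) with i ℕ.≟ k in e
    ... | yes refl = sym (set-here k)
    ... | no  i≢k  = approx-stable (ℕ.≤∧≢⇒< i≤k i≢k)

  path : Bits
  path k = proj₁ (approx (suc k)) k

  path-binary : Binary path
  path-binary k = subst (_< 2) (sym (set-here k))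
    (proj₁ (proj₂ (extend k (proj₁ (approx k)) (proj₂ (approx k)))))

  -- The first `s ⊔ S₀` bits of the path begin a sequence that survives an even later stage, and at
  -- stage `s ⊔ S₀` only these bits matter.
  path-avoids : ∀ s → D s path
  path-avoids s with approx (s ⊔ S₀) in eq′
  ... | γ , ext with ext (s ⊔ S₀)
  ... | s′ , l , γ′ , _ , e , d = mono (ℕ.m≤m⊔n s S₀) (local (ℕ.m≤n⊔m s S₀)
    (λ {k} k< → trans (e k<) (trans (cong (λ a → proj₁ a k) (sym eq′)) (approx-stable k<)))
    (mono l d))

module Points (em : ExcludedMiddle 0ℓ) (n′ : ℕ) where
  open Certificates n′ public
  open EntryNames n′ public
  abstract
    binaryExpansion : ∀ (x : Carrier unitInterval) → ∃[ β ] Binary β × Expansion β (proj₁ x)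
    binaryExpansion (x , 0≤x , x≤1) =
      expand em x 0≤x x≤1 , expand-binary em x 0≤x x≤1 , expand-expansion em x 0≤x x≤1

  bitsAt-weave : ∀ c m (β : Fin (suc n′) → Bits) j → pinned c m (toℕ j) ≡ 0 →
                 ∀ k → β j k ≡ bitsAt c m (weave (suc n′) β) (toℕ j) k
  bitsAt-weave c m β j p k = trans (sym (column-weave (suc n′) β j k)) (sym (bitsAt-free c m (weave (suc n′) β) {toℕ j} p k))

  module _ (c : ℕ → ℕ) (m : ℕ) {γ : Bits} (bin : Binary γ) where

    point : Carrier (Cube (suc n′))
    point j = fromBinary {bitsAt c m γ (toℕ j)} (bitsAt-binary c m bin (toℕ j))
            , fromBinary-unit {bitsAt c m γ (toℕ j)} (bitsAt-binary c m bin (toℕ j))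

    point-named : RepresentedSpace._names_ (Cube (suc n′)) (entry (bitsAt c m γ)) point
    point-named = entry-names {bitsAt c m γ} {point} λ j →
      fromBinary-expansion {bitsAt c m γ (toℕ j)} (bitsAt-binary c m bin (toℕ j))

  -- A record, because the bare type is an implicit function type, which Agda
  -- would eta-expand at every use.
  record _Names_ (f : Baire) (A : Carrier (𝒜 (Cube (suc n′)))) : Set where
    field
      named : RepresentedSpace._names_ (𝒜 (Cube (suc n′))) f A

  open _Names_ public

  module _ (A : Carrier (𝒜 (Cube (suc n′)))) (f : Baire) (fA : f Names A)
           (q : Baire) (x : Carrier (Cube (suc n′))) (qx : RepresentedSpace._names_ (Cube (suc n′)) q x) where

    outside : ∃[ r ] graph (associated f) q r × (to A x ≡ true ⇔ (∃[ N ] r N ≢ 0))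
    outside =
      let r , ans , y , ry , e = named fA {q} {x} qx (to A x , refl)
      in r , ans , subst (λ b → b ≡ true ⇔ (∃[ N ] r N ≢ 0)) (sym e) ry

    ∈⇒score≡0 : _∈_ {Cube (suc n′)} x A → ∀ s → score f q s ≡ 0
    ∈⇒score≡0 x∈A s =
      let r , ans , out = outside in decidable-stable (score f q s ℕ.≟ 0) λ d →
        true≢false (trans (sym (Equivalence.from out (score≢0⇒ {f} {q} {r} ans s d))) x∈A)
      where
      true≢false : true ≢ false
      true≢false ()

    score≡0⇒∈ : (∀ s → score f q s ≡ 0) → _∈_ {Cube (suc n′)} x A
    score≡0⇒∈ h =
      let r , ans , out = outside in ¬-not λ e →
        let N , d = Equivalence.to out e ; s , d′ = ⇒score≢0 {f} {q} {r} ans d in d′ (h s)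

  module _ (A : Carrier (𝒜 (Cube (suc n′)))) (f : Baire) (fA : f Names A) where

    -- Completeness of certificates, read contrapositively: survivors at all late stages form an
    -- infinite binary tree, and a path through it is a point that no stage excludes, hence a point
    -- of the set.
    compactness : ∀ c m j i b S₀ → j +ℕ i *ℕ suc n′ ≤ℕ S₀ ⊎ i ≡ 0 →
                  (∀ {s} → S₀ ≤ℕ s → survivors f c m s j i b ≢ 0) →
                  ∃[ γ ] Σ[ bin ∈ Binary γ ] _∈_ {Cube (suc n′)} (point c m {γ} bin) A ×
                    near (prefix (bitsAt c m γ j) i) b ≡ 0
    compactness c m j i b S₀ big h = finish (path , path-binary , path-avoids)
      where
      D : ℕ → Bits → Set
      D s γ = score f (entry (bitsAt c m γ)) s ≡ 0 × near (prefix (bitsAt c m γ j) i) b ≡ 0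
      weaken : ∀ {s} → S₀ ≤ℕ s → j +ℕ i *ℕ suc n′ ≤ℕ S₀ ⊎ i ≡ 0 → j +ℕ i *ℕ suc n′ ≤ℕ s ⊎ i ≡ 0
      weaken l (inj₁ l′) = inj₁ (ℕ.≤-trans l′ l)
      weaken l (inj₂ e)  = inj₂ e
      open König em D S₀
        (λ {s} {s′} {γ} l (z , e) → score-mono f (entry (bitsAt c m γ)) l z , e)
        (λ {s} {γ} {γ′} l e (z , y) → survives⇒ f c m s j i b γ′
          (subst (_≢ 0) (survives-cong f c m s j i b {γ} {γ′} (weaken l big) e) (survives⇐ f c m s j i b γ z y)))
        (λ {s} l → survivors≢0⇒ f c m s j i b (h l))
      finish : ∃[ γ ] Binary γ × (∀ s → D s γ) →
               ∃[ γ ] Σ[ bin ∈ Binary γ ] _∈_ {Cube (suc n′)} (point c m {γ} bin) A × near (prefix (bitsAt c m γ j) i) b ≡ 0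
      finish (γ , bin , avoids) =
          γ , bin
        , score≡0⇒∈ A f fA (entry (bitsAt c m γ)) (point c m {γ} bin) (point-named c m {γ} bin) (λ s → proj₁ (avoids s))
        , proj₂ (avoids 0)

    certificate-near : ∀ c m s j i b → survivors f c m s j i b ≡ 0 → j +ℕ i *ℕ suc n′ ≤ℕ s ⊎ i ≡ 0 →
      ∀ {γ} (bin : Binary γ) (x : Carrier (Cube (suc n′))) → (∀ j → Expansion (bitsAt c m γ (toℕ j)) (proj₁ (x j))) →
      _∈_ {Cube (suc n′)} x A → near (prefix (bitsAt c m γ j) i) b ≢ 0
    certificate-near c m s j i b h big {γ} bin x ex x∈A =
      survivors≡0⇒ f c m s j i b h big bin (∈⇒score≡0 A f fA (entry (bitsAt c m γ)) x (entry-names {bitsAt c m γ} {x} ex) x∈A s)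

    module _ (convex : Convex A) (c : ℕ → ℕ) (m : ℕ)
      {γ₁ γ₂ : Bits} (bin₁ : Binary γ₁) (bin₂ : Binary γ₂)
      (in₁ : _∈_ {Cube (suc n′)} (point c m {γ₁} bin₁) A) (in₂ : _∈_ {Cube (suc n′)} (point c m {γ₂} bin₂) A)
      (J : Fin (suc n′)) (I : ℕ)
      (gap : suc (suc (prefix (bitsAt c m γ₁ (toℕ J)) I)) ≤ℕ prefix (bitsAt c m γ₂ (toℕ J)) I)
      where
      private
        X Y : ℕ → Bits
        X = bitsAt c m γ₁
        Y = bitsAt c m γ₂

      -- Pinned bits do not depend on `γ`, so in a pinned coordinate the two prefixes would
      -- coincide.
      gap-free : pinned c m (toℕ J) ≡ 0
      gap-free = free (pinned c m (toℕ J)) refl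
        where
        free : ∀ p → pinned c m (toℕ J) ≡ p → p ≡ 0
        free zero    e = refl
        free (suc d) e = contradiction (ℕ.≤-trans gap (ℕ.≤-reflexive (prefix-cong {Y (toℕ J)} {X (toℕ J)} I
                      λ {k} _ → trans (bitsAt-pinned c m γ₂ e k) (sym (bitsAt-pinned c m γ₁ e k)))))
                      (ℕ.<⇒≱ (ℕ.n≤1+n _))

      module _ (c′ : ℕ → ℕ) (same : ∀ {l} → l < m → c l ≡ c′ l) (onJ : c′ m % suc n′ ≡ toℕ J)
        (R≡ : prefix (digit 1 (c′ m / suc n′)) I ≡ suc (prefix (X (toℕ J)) I)) where
        private
          R : Bits
          R = digit 1 (c′ m / suc n′)
          module S = Segment {X (toℕ J)} {Y (toℕ J)} {R}
            (bitsAt-binary c m bin₁ (toℕ J)) (bitsAt-binary c m bin₂ (toℕ J)) (digit-binary (c′ m / suc n′)) I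
            (sym R≡) (subst (λ a → suc a ≤ℕ prefix (Y (toℕ J)) I) (sym R≡) gap)
          t : Carrier unitInterval
          t = S.position , ≤-eventually {0ℝ} {S.position} 0 (λ {k} _ → S.0≤position k)
                         , ≤-eventually {S.position} {1ℝ} 0 (λ {k} _ → S.position≤1 k)
          z′ : Fin (suc n′) → ℝ
          z′ j = (1ℝ - S.position) * proj₁ (point c m {γ₁} bin₁ j) + S.position * proj₁ (point c m {γ₂} bin₂ j)
          z′-unit : ∀ j k → 0ℚ ℚ.≤ seq (z′ j) k × seq (z′ j) k ℚ.≤ 1ℚ
          z′-unit j k = mix-unit (S.0≤position k) (S.position≤1 k)
            (dyadic-nonneg (prefix (X (toℕ j)) k) k) (lo≤1 {X (toℕ j)} (bitsAt-binary c m bin₁ (toℕ j)) k)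
            (dyadic-nonneg (prefix (Y (toℕ j)) k) k) (lo≤1 {Y (toℕ j)} (bitsAt-binary c m bin₂ (toℕ j)) k)
          z : Carrier (Cube (suc n′))
          z j = z′ j , ≤-eventually {0ℝ} {z′ j} 0 (λ {k} _ → proj₁ (z′-unit j k))
                     , ≤-eventually {z′ j} {1ℝ} 0 (λ {k} _ → proj₂ (z′-unit j k))
          z∈A : _∈_ {Cube (suc n′)} z A
          z∈A = convex (point c m {γ₁} bin₁) (point c m {γ₂} bin₂) z t
            (λ j → ≤-refl {z′ j} , ≤-refl {z′ j}) in₁ in₂
          digits : Fin (suc n′) → Bits
          digits j = proj₁ (binaryExpansion (z j))
          γ₃ : Bits
          γ₃ = weave (suc n′) digits
          bin₃ : Binary γ₃
          bin₃ k = proj₁ (proj₂ (binaryExpansion (z (k mod suc n′)))) (k / suc n′)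
          pointwise : ∀ {x y} N → (∀ {k} → N ≤ℕ k → seq x k ≡ seq y k) → x ≈ᵣ y
          pointwise {x} {y} N e = ≤-eventually {x} {y} N (λ l → ℚ.≤-reflexive (e l))
                                , ≤-eventually {y} {x} N (λ l → ℚ.≤-reflexive (sym (e l)))
          fixed : ∀ j {e} → pinned c′ (suc m) (toℕ j) ≡ suc e → ∀ N →
                  (∀ {k} → N ≤ℕ k → lo (digit 1 e) k ≡ seq (z′ j) k) → Expansion (bitsAt c′ (suc m) γ₃ (toℕ j)) (z′ j)
          fixed j {e} pe N eq′ = Expansion-cong {digit 1 e} {bitsAt c′ (suc m) γ₃ (toℕ j)} {z′ j}
            (λ k → sym (bitsAt-pinned c′ (suc m) γ₃ pe k))
            (Expansion-≈ {digit 1 e} {fromBinary {digit 1 e} (digit-binary e)} {z′ j}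
              (pointwise {fromBinary {digit 1 e} (digit-binary e)} {z′ j} N eq′)
              (fromBinary-expansion {digit 1 e} (digit-binary e)))
          lo-cong : ∀ {β β′} k → (∀ i → β i ≡ β′ i) → lo β k ≡ lo β′ k
          lo-cong {β} {β′} k e = cong (λ a → dyadic a k) (prefix-cong {β} {β′} k (λ {i} _ → e i))
          mix-z : ∀ j k → seq (z′ j) k ≡ mix (seq S.position k) (lo (X (toℕ j)) k) (lo (Y (toℕ j)) k)
          mix-z j k = refl
          pinned-earlier : ∀ (j : Fin (suc n′)) {e : ℕ} → pinned c m (toℕ j) ≡ e → pinned c′ m (toℕ j) ≡ e
          pinned-earlier j p = trans (sym (pinned-cong {c} {c′} m (toℕ j) (λ {l} → same {l}))) p
          expansion-pinned : ∀ j {e} → pinned c m (toℕ j) ≡ suc e → Expansion (bitsAt c′ (suc m) γ₃ (toℕ j)) (z′ j)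
          expansion-pinned j {e} p = fixed j {e} (pinned-old c′ m {toℕ j} {e} (pinned-earlier j {suc e} p)) 0 λ {k} _ → sym (begin
            seq (z′ j) k
              ≡⟨ mix-z j k ⟩
            mix (seq S.position k) (lo (X (toℕ j)) k) (lo (Y (toℕ j)) k)
              ≡⟨ cong₂ (mix (seq S.position k))
                   (lo-cong {X (toℕ j)} {digit 1 e} k (bitsAt-pinned c m γ₁ {toℕ j} {e} p))
                   (lo-cong {Y (toℕ j)} {digit 1 e} k (bitsAt-pinned c m γ₂ {toℕ j} {e} p)) ⟩
            mix (seq S.position k) (lo (digit 1 e) k) (lo (digit 1 e) k)
              ≡⟨ mix-same (seq S.position k) (lo (digit 1 e) k) ⟩
            lo (digit 1 e) k ∎)
            where open ≡-Reasoning
          expansion-new : Expansion (bitsAt c′ (suc m) γ₃ (toℕ J)) (z′ J)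
          expansion-new = fixed J {c′ m / suc n′}
            (pinned-new c′ m {toℕ J} (pinned-earlier J {0} gap-free) onJ) I
            λ {k} I≤k → sym (trans (mix-z J k) (S.mix-position I≤k))
          expansion-free : ∀ j → pinned c m (toℕ j) ≡ 0 → c′ m % suc n′ ≢ toℕ j →
                           Expansion (bitsAt c′ (suc m) γ₃ (toℕ j)) (z′ j)
          expansion-free j p d = Expansion-cong {digits j} {bitsAt c′ (suc m) γ₃ (toℕ j)} {z′ j}
            (bitsAt-weave c′ (suc m) digits j (trans (pinned-other c′ m {toℕ j} d) (pinned-earlier j {0} p)))
            (proj₂ (proj₂ (binaryExpansion (z j))))
          expansions : ∀ j → Expansion (bitsAt c′ (suc m) γ₃ (toℕ j)) (z′ j)
          expansions j = cases (pinned c m (toℕ j)) refl (c′ m % suc n′ ℕ.≟ toℕ j)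
            where
            cases : ∀ e → pinned c m (toℕ j) ≡ e → Dec (c′ m % suc n′ ≡ toℕ j) →
                    Expansion (bitsAt c′ (suc m) γ₃ (toℕ j)) (z′ j)
            cases (suc e) p _       = expansion-pinned j {e} p
            cases zero    p (yes e) = subst (λ i → Expansion (bitsAt c′ (suc m) γ₃ (toℕ i)) (z′ i))
                                        (toℕ-injective (trans (sym onJ) e)) expansion-new
            cases zero    p (no d)  = expansion-free j p d

        -- The point `z` of the segment with parameter `S.position` has coordinate J equal to the
        -- candidate value and belongs to the set by convexity. The earlier pins survive the mixing
        -- because both ends share them, so `z` has an expansion of the form that the test ranges
        -- over.
        hyperplane-met : ∀ s → survivors f c′ (suc m) s 0 0 2 ≢ 0
        hyperplane-met s h =
          certificate-near c′ (suc m) s 0 0 2 h (inj₂ refl) {γ₃} bin₃ z expansions z∈A refl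

-- Sorted sequences

countIn-suc : ∀ σ s l → countIn σ (suc s) l ≡ eq (σ 0) l +ℕ countIn (σ ∘ suc) s l
countIn-suc σ s l = sumTo-suc (λ y → eq (σ y) l) s

countIn-stable : ∀ σ l {N s} → N ≤ℕ s → (∀ {k} → N ≤ℕ k → σ k ≢ l) → countIn σ s l ≡ countIn σ N l
countIn-stable σ l {N} N≤s h = go (ℕ.≤⇒≤′ N≤s)
  where
  go : ∀ {s} → N ≤′ s → countIn σ s l ≡ countIn σ N l
  go (≤′-reflexive refl) = refl
  go (≤′-step {s} l′)    = trans (cong (countIn σ s l +ℕ_) (eq-≢ (h (ℕ.≤′⇒≤ l′)))) (trans (ℕ.+-identityʳ _) (go l′))

-- Position 0 is split off: it contributes one element or none, equality proofs in `Fin d` being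
-- unique, and the shifted sequence contributes the others. This links the bijections in `Sort` to
-- computed counts.
occurrences : ∀ {d} (σ : ℕ → Fin d) l N → (∀ {k} → N ≤ℕ k → σ k ≢ l) →
              Fin (countIn (toℕ ∘ σ) N (toℕ l)) ↔ (∃[ k ] σ k ≡ l)
occurrences σ l zero    h = mk↔ₛ′ (λ ()) (λ (k , e) → ⊥-elim (h z≤n e)) (λ (k , e) → ⊥-elim (h z≤n e)) (λ ())
occurrences {d} σ l (suc N) h = subst (λ c → Fin c ↔ (∃[ k ] σ k ≡ l)) (sym (countIn-suc (toℕ ∘ σ) N (toℕ l)))
  (split ↔-∘ ((first (σ 0 Fin.≟ l) ⊎-↔ occurrences (σ ∘ suc) l N (λ N≤k → h (s≤s N≤k))) ↔-∘ +↔⊎))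
  where
  uip : ∀ {x y : Fin d} (e e′ : x ≡ y) → e ≡ e′
  uip = Decidable⇒UIP.≡-irrelevant Fin._≟_

  first : Dec (σ 0 ≡ l) → Fin (eq (toℕ (σ 0)) (toℕ l)) ↔ (σ 0 ≡ l)
  first (yes e) = subst (λ c → Fin c ↔ (σ 0 ≡ l))
    (sym (trans (cong (λ x → eq (toℕ x) (toℕ l)) e) (eq-refl (toℕ l))))
    (mk↔ₛ′ {A = Fin 1} (λ _ → e) (λ _ → fzero) (uip e) (λ { fzero → refl }))
  first (no d) = subst (λ c → Fin c ↔ (σ 0 ≡ l)) (sym (eq-≢ (d ∘ toℕ-injective)))
    (mk↔ₛ′ (λ ()) (λ e → ⊥-elim (d e)) (λ e → ⊥-elim (d e)) (λ ()))

  split : (σ 0 ≡ l ⊎ (∃[ k ] σ (suc k) ≡ l)) ↔ (∃[ k ] σ k ≡ l)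
  split = mk↔ₛ′ to′ from′ to-from from-to
    where
    to′ : σ 0 ≡ l ⊎ (∃[ k ] σ (suc k) ≡ l) → ∃[ k ] σ k ≡ l
    to′ (inj₁ e)       = 0 , e
    to′ (inj₂ (k , e)) = suc k , e
    from′ : ∃[ k ] σ k ≡ l → σ 0 ≡ l ⊎ (∃[ k ] σ (suc k) ≡ l)
    from′ (zero  , e) = inj₁ e
    from′ (suc k , e) = inj₂ (k , e)
    to-from : ∀ x → to′ (from′ x) ≡ x
    to-from (zero  , e) = refl
    to-from (suc k , e) = refl
    from-to : ∀ x → from′ (to′ x) ≡ x
    from-to (inj₁ e) = refl
    from-to (inj₂ _) = refl

module _ {d : ℕ} (m : Fin d) where

  -- `sorted` for an arbitrary family of block symbols: without its first block the sequence is no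
  -- longer of the form `sorted`, but the induction on the number of blocks needs it.
  blocks : ∀ {k} → (Fin k → Fin d) → (Fin k → ℕ) → Baire
  blocks g c K = toℕ ((List.concat (List.tabulate λ l → List.replicate (c l) (g l)) ++ω λ _ → m) K)

  Increasing : ∀ {k} → (Fin k → Fin d) → Set
  Increasing g = (∀ {i j} → toℕ i < toℕ j → toℕ (g i) < toℕ (g j)) × (∀ i → toℕ (g i) < toℕ m)

  private
    tail-increasing : ∀ {k} {g : Fin (suc k) → Fin d} → Increasing g → Increasing (g ∘ fsuc)
    tail-increasing (inc , bd) = (λ i<j → inc (s≤s i<j)) , bd ∘ fsuc

    prepend : ℕ → Fin d → List (Fin d) → Baire
    prepend r x ys K = toℕ (((List.replicate r x List.++ ys) ++ω λ _ → m) K)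

    prepend-bounded : ∀ r x ys {b : ℕ → Set} → b (toℕ x) → (∀ K → b (prepend 0 x ys K)) → ∀ K → b (prepend r x ys K)
    prepend-bounded zero    x ys bx bys K       = bys K
    prepend-bounded (suc r) x ys bx bys zero    = bx
    prepend-bounded (suc r) x ys {b} bx bys (suc K) = prepend-bounded r x ys {b} bx bys K

    prepend-later : ∀ r x ys {y c} → toℕ x < y →
      (∀ K → y < prepend 0 x ys K → countIn (prepend 0 x ys) K y ≡ c) →
      ∀ K → y < prepend r x ys K → countIn (prepend r x ys) K y ≡ c
    prepend-later zero    x ys x<y h K       = h K
    prepend-later (suc r) x ys x<y h zero    y<x = contradiction y<x (ℕ.<-asym x<y)
    prepend-later (suc r) x ys {y} x<y h (suc K) y< =
      trans (countIn-suc (prepend (suc r) x ys) K y)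
        (cong₂ _+ℕ_ (eq-≢ (ℕ.<⇒≢ x<y)) (prepend-later r x ys x<y h K y<))

    prepend-first : ∀ r x ys → (∀ K → toℕ x < prepend 0 x ys K) →
      ∀ K → toℕ x < prepend r x ys K → countIn (prepend r x ys) K (toℕ x) ≡ r
    prepend-first zero    x ys h K       _ = sumTo≡0 K λ {k} _ → eq-≢ λ e → ℕ.<⇒≢ (h k) (sym e)
    prepend-first (suc r) x ys h zero    x<x = contradiction x<x (ℕ.<-irrefl refl)
    prepend-first (suc r) x ys h (suc K) x< =
      trans (countIn-suc (prepend (suc r) x ys) K (toℕ x))
        (cong₂ _+ℕ_ (eq-refl (toℕ x)) (prepend-first r x ys h K x<))

    prepend-final : ∀ r x ys {K₀} → (∀ {K} → K₀ ≤ℕ K → prepend 0 x ys K ≡ toℕ m) →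
      ∀ {K} → r +ℕ K₀ ≤ℕ K → prepend r x ys K ≡ toℕ m
    prepend-final zero    x ys h l       = h l
    prepend-final (suc r) x ys h {suc K} (s≤s l) = prepend-final r x ys h l

    rest : ∀ {k} → (Fin (suc k) → Fin d) → (Fin (suc k) → ℕ) → List (Fin d)
    rest g c = List.concat (List.tabulate λ l → List.replicate (c (fsuc l)) (g (fsuc l)))

  blocks-satisfy : ∀ {k} (g : Fin k → Fin d) c {b : ℕ → Set} → (∀ l → b (toℕ (g l))) → b (toℕ m) → ∀ K → b (blocks g c K)
  blocks-satisfy {zero}  g c bg bm K = bm
  blocks-satisfy {suc k} g c {b} bg bm K =
    prepend-bounded (c fzero) (g fzero) (rest g c) {b} (bg fzero) (blocks-satisfy (g ∘ fsuc) (c ∘ fsuc) {b} (bg ∘ fsuc) bm) K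

  -- Blocks come in increasing order, so once a symbol above `g l` is read, the block of `g l` is
  -- complete and its count is final.
  blocks-count : ∀ {k} {g : Fin k → Fin d} → Increasing g → ∀ c K l → toℕ (g l) < blocks g c K →
                 countIn (blocks g c) K (toℕ (g l)) ≡ c l
  blocks-count {suc k} {g} inc@(i , bd) c K fzero    lt =
    prepend-first (c fzero) (g fzero) (rest g c)
      (blocks-satisfy (g ∘ fsuc) (c ∘ fsuc) {toℕ (g fzero) <_} (λ l → i {fzero} {fsuc l} (s≤s z≤n)) (bd fzero)) K lt
  blocks-count {suc k} {g} inc@(i , _) c K (fsuc l) lt =
    prepend-later (c fzero) (g fzero) (rest g c) (i {fzero} {fsuc l} (s≤s z≤n))
      (λ K → blocks-count {g = g ∘ fsuc} (tail-increasing {g = g} inc) (c ∘ fsuc) K l) K lt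

  blocks-final : ∀ {k} (g : Fin k → Fin d) c → ∃[ K₀ ] ∀ {K} → K₀ ≤ℕ K → blocks g c K ≡ toℕ m
  blocks-final {zero}  g c = 0 , λ _ → refl
  blocks-final {suc k} g c =
    let K₀ , h = blocks-final (g ∘ fsuc) (c ∘ fsuc)
    in c fzero +ℕ K₀ , prepend-final (c fzero) (g fzero) (rest g c) h

-- Recurring symbols and what a sorted sequence reveals

Recurs : Baire → ℕ → Set
Recurs a l = ∀ N → ∃[ k ] N ≤ℕ k × a k ≡ l

module _ (em : ExcludedMiddle 0ℓ) where

  ¬Recurs⇒ : ∀ {a l} → ¬ Recurs a l → ∃[ N ] ∀ {k} → N ≤ℕ k → a k ≢ l
  ¬Recurs⇒ {a} {l} h with em {∃[ N ] ∀ {k} → N ≤ℕ k → a k ≢ l}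
  ... | yes r = r
  ... | no  r = ⊥-elim (h λ N → visit N em)
    where
    visit : ∀ N → Dec (∃[ k ] N ≤ℕ k × a k ≡ l) → ∃[ k ] N ≤ℕ k × a k ≡ l
    visit N (yes v) = v
    visit N (no  v) = ⊥-elim (r (N , λ {k} N≤k e → v (k , N≤k , e)))

  eventually-≥ : ∀ {a} m → (∀ {l} → l < m → ¬ Recurs a l) → ∃[ N ] ∀ {k} → N ≤ℕ k → m ≤ℕ a k
  eventually-≥ zero    h = 0 , λ _ → z≤n
  eventually-≥ {a} (suc m) h =
    let N , f = eventually-≥ {a} m (λ l<m → h (ℕ.m<n⇒m<1+n l<m))
        M , g = ¬Recurs⇒ {a} {m} (h ℕ.≤-refl)
    in N ⊔ M , λ l → ℕ.≤∧≢⇒< (f (ℕ.m⊔n≤o⇒m≤o N M l)) (λ e → g (ℕ.m⊔n≤o⇒n≤o N M l) (sym e))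

  least-recurring : ∀ {a d} → (∀ k → a k < d) → ∃[ m ] m < d × Recurs a m × (∀ {l} → l < m → ¬ Recurs a l)
  least-recurring {a} {d} bd with search d
    where
    search : ∀ k → (∃[ m ] m < k × Recurs a m × (∀ {l} → l < m → ¬ Recurs a l)) ⊎ (∀ {l} → l < k → ¬ Recurs a l)
    search zero    = inj₂ λ ()
    search (suc k) with search k
    ... | inj₁ (m , m<k , r) = inj₁ (m , ℕ.m<n⇒m<1+n m<k , r)
    ... | inj₂ h with em {Recurs a k}
    ...   | yes r = inj₁ (k , ℕ.≤-refl , r , h)
    ...   | no  r = inj₂ λ {l} l≤k → below (ℕ.m<1+n⇒m<n∨m≡n l≤k)
      where
      below : ∀ {l} → l < k ⊎ l ≡ k → ¬ Recurs a l
      below (inj₁ l<k)  = h l<k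
      below (inj₂ refl) = r
  ... | inj₁ found = found
  ... | inj₂ h with eventually-≥ {a} d h
  ...   | N , g = contradiction (g ℕ.≤-refl) (ℕ.<⇒≱ (bd N))

  -- A realizer is constrained only on the domain, so this is what allows a realizer of `Sort` to be
  -- applied to the emitted sequence.
  sort-defined : ∀ {d} (σ : ℕ → Fin d) → dom (Sort d) σ
  sort-defined {d} σ with least-recurring {toℕ ∘ σ} {d} (λ k → toℕ<n (σ k))
  ... | m , m<d , r , h with eventually-≥ {toℕ ∘ σ} m h
  ... | N , g =
      sorted M C , M
    , (λ N → let k , l , e = r N in k , l , toℕ-injective (trans e (sym toℕ-M)))
    , (λ l i → h (l<m l) λ N → let k , l′ , e = i N in k , l′ , trans (cong toℕ e) (toℕ-inject l))
    , C
    , (λ l → subst (λ c → Fin c ↔ (∃[ k ] σ k ≡ inject {i = M} l)) (cong (countIn (toℕ ∘ σ) N) (toℕ-inject l))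
        (occurrences σ (inject {i = M} l) N
        λ {k} N≤k e → ℕ.<⇒≱ (l<m l) (subst (m ≤ℕ_) (trans (cong toℕ e) (toℕ-inject l)) (g N≤k))))
    , λ _ → refl
    where
    M : Fin d
    M = fromℕ< m<d
    toℕ-M : toℕ M ≡ m
    toℕ-M = toℕ-fromℕ< m<d
    C : Fin′ M → ℕ
    C l = countIn (toℕ ∘ σ) N (toℕ l)
    l<m : ∀ (l : Fin′ M) → toℕ l < m
    l<m l = subst (toℕ l <_) toℕ-M (toℕ<n l)

  -- The content of `Sort` in terms of numbers. No symbol below `limit` occurs in `a` from `start`
  -- on, so for these symbols `countIn a start` is the total count, which `counts` finds in finite
  -- segments of `b`.
  record Sorts (a b : Baire) : Set where
    field
      limit        : ℕ
      recurs       : Recurs a limit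
      start        : ℕ
      above        : ∀ {k} → start ≤ℕ k → limit ≤ℕ a k
      final        : ∃[ K₀ ] ∀ {K} → K₀ ≤ℕ K → b K ≡ limit
      b≤limit      : ∀ K → b K ≤ℕ limit
      counts       : ∀ K {l} → l < b K → countIn b K l ≡ countIn a start l

  sort-sorts : ∀ {d} (σ y : ℕ → Fin d) → rel (Sort d) σ y → Sorts (toℕ ∘ σ) (toℕ ∘ y)
  sort-sorts {d} σ y (m , inf , least , c , bij , y≗) = record
    { limit   = toℕ m
    ; recurs  = λ N → let k , l , e = inf N in k , l , cong toℕ e
    ; start   = N
    ; above   = g
    ; final   = proj₁ fin , λ l → trans (y≡ _) (proj₂ fin l)
    ; b≤limit = b≤m
    ; counts  = λ K {l} l< → trans
        (trans (sumTo-cong K λ {k} _ → cong (λ x → eq x l) (y≡ k)) (number K l<))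
        (agree l (ℕ.<-≤-trans l< (b≤m K)))
    }
    where
    g′ : Fin′ m → Fin d
    g′ = inject {i = m}
    y≡ : ∀ k → toℕ (y k) ≡ blocks m g′ c k
    y≡ k = cong toℕ (y≗ k)
    fin = blocks-final m g′ c
    small : ∀ l → toℕ (g′ l) < toℕ m
    small l = subst (_< toℕ m) (sym (toℕ-inject l)) (toℕ<n l)
    inc : Increasing m g′
    inc = (λ {i} {j} → subst₂ _<_ (sym (toℕ-inject i)) (sym (toℕ-inject j))) , small
    b≤m : ∀ K → toℕ (y K) ≤ℕ toℕ m
    b≤m K = subst (_≤ℕ toℕ m) (sym (y≡ K)) (blocks-satisfy m g′ c {_≤ℕ toℕ m} (λ l → ℕ.<⇒≤ (small l)) ℕ.≤-refl K)
    index : ∀ {l} → l < toℕ m → Fin′ m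
    index l<m = fromℕ< l<m
    toℕ-index : ∀ {l} (l<m : l < toℕ m) → toℕ (g′ (index l<m)) ≡ l
    toℕ-index l<m = trans (toℕ-inject (index l<m)) (toℕ-fromℕ< l<m)
    notRecurs : ∀ {l} → l < toℕ m → ¬ Recurs (toℕ ∘ σ) l
    notRecurs l<m r = least (index l<m) λ N →
      let k , N≤k , e = r N in k , N≤k , toℕ-injective (trans e (sym (toℕ-index l<m)))
    bound = eventually-≥ {toℕ ∘ σ} (toℕ m) notRecurs
    N = proj₁ bound
    g : ∀ {k} → N ≤ℕ k → toℕ m ≤ℕ toℕ (σ k)
    g = proj₂ bound
    count-of : ∀ {l} → l < toℕ m → ℕ
    count-of l<m = c (index l<m)
    number : ∀ K {l} → (l< : l < toℕ (y K)) → countIn (blocks m g′ c) K l ≡ count-of (ℕ.<-≤-trans l< (b≤m K))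
    number K {l} l< = subst (λ x → countIn (blocks m g′ c) K x ≡ c i) e
      (blocks-count m {g = g′} inc c K i (subst₂ _<_ (sym e) (y≡ K) l<))
      where
      i = index (ℕ.<-≤-trans l< (b≤m K))
      e = toℕ-index (ℕ.<-≤-trans l< (b≤m K))
    agree : ∀ l (l<m : l < toℕ m) → count-of l<m ≡ countIn (toℕ ∘ σ) N l
    agree l l<m = trans (↔⇒≡ (↔-sym (occurrences σ (g′ i) N λ {k} N≤k e →
        ℕ.<⇒≱ (small i) (subst (toℕ m ≤ℕ_) (cong toℕ e) (g N≤k))) ↔-∘ bij i))
        (cong (countIn (toℕ ∘ σ) N) (toℕ-index l<m))
      where i = index l<m

-- Correctness of the reductions

least-zero : ∀ (g : ℕ → ℕ) {w} → g w ≡ 0 → ∃[ w ] g w ≡ 0 × (∀ {j} → j < w → ∃[ r ] g j ≡ suc r)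
least-zero g {w} z with g 0 in e
... | zero = 0 , e , λ ()
least-zero g {zero}  z | suc r with () ← trans (sym e) z
least-zero g {suc w} z | suc r =
  let w′ , z′ , nz = least-zero (g ∘ suc) {w} z
  in suc w′ , z′ , λ { {zero} _ → r , e ; {suc j} (s≤s l) → nz l }

next-occurrence : ∀ {a m} → Recurs a m → ∀ N → ∃[ s ] N ≤ℕ s × a s ≡ m × countIn a s m ≡ countIn a N m
next-occurrence {a} {m} r N = let k , N≤k , e = r N in go (k ∸ N) N (subst (λ k → a k ≡ m) (sym (ℕ.m∸n+n≡m N≤k)) e)
  where
  go : ∀ t N → a (t +ℕ N) ≡ m → ∃[ s ] N ≤ℕ s × a s ≡ m × countIn a s m ≡ countIn a N m
  go zero    N e = N , ℕ.≤-refl , e , refl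
  go (suc t) N e with a N ℕ.≟ m
  ... | yes e′ = N , ℕ.≤-refl , e′ , refl
  ... | no  d  =
    let s , l , e′ , c = go t (suc N) (subst (λ k → a k ≡ m) (sym (ℕ.+-suc t N)) e)
    in s , ℕ.<⇒≤ l , e′ , trans c (trans (cong (countIn a N m +ℕ_) (eq-≢ d)) (ℕ.+-identityʳ _))

-- A discrete intermediate value theorem: the count increases by one, and only at occurrences of
-- `m`, so no value is skipped and each is the current count at some occurrence.
count-attained : ∀ {a m} → Recurs a m → ∀ N {v} → countIn a N m ≤ℕ v → ∃[ s ] N ≤ℕ s × a s ≡ m × countIn a s m ≡ v
count-attained {a} {m} r N {v} l =
  let s , l′ , e , c = go (v ∸ countIn a N m) in s , l′ , e , trans c (ℕ.m∸n+n≡m l)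
  where
  go : ∀ t → ∃[ s ] N ≤ℕ s × a s ≡ m × countIn a s m ≡ t +ℕ countIn a N m
  go zero    = next-occurrence r N
  go (suc t) =
    let s , l , e , c = go t ; s′ , l′ , e′ , c′ = next-occurrence r (suc s)
    in s′ , ℕ.≤-trans l (ℕ.<⇒≤ l′) , e′ ,
       trans c′ (trans (cong₂ _+ℕ_ c (trans (cong (λ x → eq x m) e) (eq-refl m))) (ℕ.+-comm _ 1))

evens-⟨⟩ : ∀ p q x → ⟨ p , q ⟩ (x +ℕ x) ≡ p x
evens-⟨⟩ p q zero    = refl
evens-⟨⟩ p q (suc x) = trans (cong ⟨ q , p ∘ suc ⟩ (ℕ.+-suc x x)) (evens-⟨⟩ (p ∘ suc) (q ∘ suc) x)

odds-⟨⟩ : ∀ p q x → ⟨ p , q ⟩ (suc (x +ℕ x)) ≡ q x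
odds-⟨⟩ p q x = evens-⟨⟩ q (p ∘ suc) x

module Reduction (em : ExcludedMiddle 0ℓ) (n′ : ℕ) where
  open Points em n′ public
  outer inner : Code 1
  inner = proj₁ emissionᴾ
  outer = comp (proj₁ answerᴾ) (min (proj₁ missᴾ) ∷ proj fzero ∷ [])

  outer⇓ : ∀ o P {w} → miss (evens o) (odds o) (P % suc n′) (P / suc n′ / 3) w ≡ 0 →
    ∃[ w ] miss (evens o) (odds o) (P % suc n′) (P / suc n′ / 3) w ≡ 0 × o ⊢ outer [ P ∷ [] ]⇓ answer P w
  outer⇓ o P {w} z =
    let w , z , nz = least-zero (miss (evens o) (odds o) (P % suc n′) (P / suc n′ / 3)) {w} z
    in w , z , comp⇓
      (min⇓ (subst (o ⊢ proj₁ missᴾ [ w ∷ P ∷ [] ]⇓_) z (proj₂ missᴾ o (w ∷ P ∷ [])))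
            (λ {j} j<w → let r , e = nz j<w in r , subst (o ⊢ proj₁ missᴾ [ j ∷ P ∷ [] ]⇓_) e (proj₂ missᴾ o (j ∷ P ∷ [])))
       ∷ proj⇓ ∷ [])
      (proj₂ answerᴾ o (w ∷ P ∷ []))

  request : ∀ j i s q → j +ℕ suc i *ℕ suc n′ ≤ℕ s → q < suc (2 ^ℕ suc i) →
            ∃[ w ] stage j i w ≡ s × guess i w ≡ q
  request j i s q t≤s q< = q +ℕ (s ∸ t) *ℕ suc (2 ^ℕ suc i)
    , trans (cong (_+ℕ t) (proj₂ (modDiv-unique (s ∸ t) q<))) (ℕ.m∸n+n≡m t≤s)
    , proj₁ (modDiv-unique (s ∸ t) q<)
    where t = j +ℕ suc i *ℕ suc n′

  index : Fin (suc n′) → ℕ → ℕ → ℕ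
  index J e i = toℕ J +ℕ (e +ℕ i *ℕ 3) *ℕ suc n′

  index-coordinate : ∀ J e i → index J e i % suc n′ ≡ toℕ J
  index-coordinate J e i = proj₁ (modDiv-unique (e +ℕ i *ℕ 3) (toℕ<n J))

  index-rest : ∀ J e i → index J e i / suc n′ ≡ e +ℕ i *ℕ 3
  index-rest J e i = proj₂ (modDiv-unique (e +ℕ i *ℕ 3) (toℕ<n J))

  index-precision : ∀ J e i → e < 3 → index J e i / suc n′ / 3 ≡ i
  index-precision J e i e<3 = trans (cong (_/ 3) (index-rest J e i)) (proj₂ (modDiv-unique i e<3))

  index-part : ∀ J e i → e < 3 → index J e i / suc n′ % 3 ≡ e
  index-part J e i e<3 = trans (cong (_% 3) (index-rest J e i)) (proj₁ (modDiv-unique i e<3))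

  answer-index : ∀ J e i w → e < 3 →
                 answer (index J e i) w ≡ eq e 0 *ℕ guess i w +ℕ eq e 2 *ℕ (2 ^ℕ suc i ∸ 1)
  answer-index J e i w e<3 = cong₂ (λ x y → eq x 0 *ℕ guess y w +ℕ eq x 2 *ℕ (2 ^ℕ suc y ∸ 1))
    (index-part J e i e<3) (index-precision J e i e<3)

  module _ (A : Carrier (𝒜 (Cube (suc n′)))) (convex : Convex A)
    (origin : Carrier (Cube (suc n′))) (origin∈A : _∈_ {Cube (suc n′)} origin A)
    (p : Baire) (pA : p Names A)
    (a b : Baire) (a≡ : ∀ s → a s ≡ emission p s) (sorts : Sorts em a b) where
    open Sorts sorts

    private
      m = limit

      c : ℕ → ℕ
      c = countIn a start

      cs : ℕ → ℕ → ℕ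
      cs s = count (history p s) s

    cs≡ : ∀ s l → cs s l ≡ countIn a s l
    cs≡ s l = trans (count-packing {history p} {emission p} (refl , λ _ → refl)
                      (λ s → emit≤ p (cs s) s) s l)
                    (sumTo-cong s λ {k} _ → cong (λ x → eq x l) (sym (a≡ k)))

    settled : ∀ {s} → start ≤ℕ s → ∀ {l} → l < m → cs s l ≡ c l
    settled {s} start≤s {l} l<m = trans (cs≡ s l)
      (countIn-stable a l start≤s λ {k} start≤k e → ℕ.<⇒≱ l<m (subst (m ≤ℕ_) e (above start≤k)))

    accepted : ∀ {s} → start ≤ℕ s → ∀ {l} → l < m → reject p (cs s) s l ≡ 0
    accepted {s} start≤s l<m = emit-accepted p (cs s) s
      (ℕ.<-≤-trans l<m (subst (m ≤ℕ_) (a≡ s) (above start≤s)))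

    limit≤n : m ≤ℕ suc n′
    limit≤n = let k , _ , e = recurs 0 in subst (_≤ℕ (suc n′)) (trans (sym (a≡ k)) e) (emit≤ p (cs k) k)

    -- From `start` on all levels below `m` are accepted, and acceptance includes that the
    -- coordinate is not pinned at a lower level.
    pins-distinct : ∀ {l} → l < m → pinned c l (c l % suc n′) ≡ 0
    pins-distinct {l} l<m = trans
      (trans (cong (λ x → pinned c l (x % suc n′)) (sym (settled ℕ.≤-refl l<m)))
        (sym (pinned-cong {cs start} {c} l (cs start l % suc n′) λ k<l → settled ℕ.≤-refl (ℕ.<-trans k<l l<m))))
      (ℕ.m+n≡0⇒m≡0 _ (accepted ℕ.≤-refl l<m))

    Inhabited : ℕ → Set
    Inhabited k = ∃[ γ ] Σ[ bin ∈ Binary γ ] _∈_ {Cube (suc n′)} (point c k {γ} bin) A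

    -- The two points have a common name, and the scores that decide membership depend on the name
    -- alone.
    expansion⇒∈ : ∀ k {γ} (bin : Binary γ) → (∀ j → Expansion (bitsAt c k γ (toℕ j)) (proj₁ (origin j))) →
                  _∈_ {Cube (suc n′)} (point c k {γ} bin) A
    expansion⇒∈ k {γ} bin ex = score≡0⇒∈ A p pA (entry (bitsAt c k γ)) (point c k {γ} bin) (point-named c k {γ} bin)
      (∈⇒score≡0 A p pA (entry (bitsAt c k γ)) origin (entry-names {bitsAt c k γ} {origin} ex) origin∈A)

    origin-digits : Fin (suc n′) → Bits
    origin-digits j = proj₁ (binaryExpansion (origin j))

    origin-digits-binary : Binary (weave (suc n′) origin-digits)
    origin-digits-binary k = proj₁ (proj₂ (binaryExpansion (origin (k mod suc n′)))) (k / suc n′)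

    origin-digits-expansion : ∀ j → Expansion (bitsAt c 0 (weave (suc n′) origin-digits) (toℕ j)) (proj₁ (origin j))
    origin-digits-expansion j = Expansion-cong
      {origin-digits j} {bitsAt c 0 (weave (suc n′) origin-digits) (toℕ j)} {proj₁ (origin j)}
      (bitsAt-weave c 0 origin-digits j refl) (proj₂ (proj₂ (binaryExpansion (origin j))))

    inhabited-unpinned : Inhabited 0
    inhabited-unpinned = weave (suc n′) origin-digits , origin-digits-binary ,
      expansion⇒∈ 0 {weave (suc n′) origin-digits} origin-digits-binary origin-digits-expansion

    -- The last level below `m` is accepted, and its test covers exactly the `m` hyperplanes below
    -- level `m`. For `m` = 0 there is no such level, and the given point of the set takes its
    -- place.
    survivors-remain : ∀ {k} → m ≡ suc k → ∀ {s} → start ≤ℕ s → survivors p c m s 0 0 2 ≢ 0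
    survivors-remain {k} e {s} start≤s = subst (_≢ 0) (survivors-cong {p} {cs s} {c} m s 0 0 2 (settled start≤s))
      (subst (λ m → survivors p (cs s) m s 0 0 2 ≢ 0) (sym e)
        (1∸≡0 (ℕ.m+n≡0⇒n≡0 (pinned (cs s) k (cs s k % suc n′)) (accepted start≤s {k} (subst (k <_) (sym e) ℕ.≤-refl)))))

    Surviving : Set
    Surviving = ∃[ γ ] Σ[ bin ∈ Binary γ ] _∈_ {Cube (suc n′)} (point c m {γ} bin) A ×
                  near (prefix (bitsAt c m γ 0) 0) 2 ≡ 0

    surviving⇒ : Surviving → Inhabited m
    surviving⇒ (γ , bin , i , _) = γ , bin , i

    surviving : ∀ {k} → m ≡ suc k → Surviving
    surviving e = compactness A p pA c m 0 0 2 start (inj₂ refl) (λ {s} → survivors-remain e {s})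

    inhabited-without : m ≡ 0 → Inhabited m
    inhabited-without e = subst Inhabited (sym e) inhabited-unpinned

    inhabited-at : ∀ k → m ≡ k → Inhabited m
    inhabited-at zero    e = inhabited-without e
    inhabited-at (suc k) e = surviving⇒ (surviving e)

    inhabited : Inhabited m
    inhabited = inhabited-at m refl

    -- A free coordinate and the n pins, which have distinct coordinates, would make n + 1 distinct
    -- coordinates.
    all-pinned : m ≡ suc n′ → ∀ (J : Fin (suc n′)) → pinned c m (toℕ J) ≢ 0
    all-pinned m≡n J free = collide (pigeonhole ℕ.≤-refl coordinate)
      where
      coordinate : Fin (suc (suc n′)) → Fin (suc n′)
      coordinate fzero    = J
      coordinate (fsuc l) = c (toℕ l) mod suc n′
      toℕ-mod : ∀ x → toℕ (x mod suc n′) ≡ x % suc n′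
      toℕ-mod x = toℕ-fromℕ< (m%n<n x (suc n′))
      bound : ∀ (l : Fin (suc n′)) → toℕ l < m
      bound l = subst (toℕ l <_) (sym m≡n) (toℕ<n l)
      collide : ∃[ i ] ∃[ j ] i Fin.< j × coordinate i ≡ coordinate j → ⊥
      collide (fzero  , fsuc l , _ , e) =
        pinned-≡0 c m free (bound l) (trans (sym (toℕ-mod (c (toℕ l)))) (cong toℕ (sym e)))
      collide (fsuc k , fsuc l , s≤s k<l , e) =
        pinned-≡0 c (toℕ l) (pins-distinct (bound l)) k<l
          (trans (sym (toℕ-mod (c (toℕ k)))) (trans (cong toℕ e) (toℕ-mod (c (toℕ l)))))

    -- A gap of two leaves room for an intermediate prefix. Some emission of `m` after `start` has a
    -- candidate for the free coordinate J with this prefix. As J is free, its rejection can only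
    -- mean that the hyperplane was seen to miss the set, but the segment between the two points
    -- crosses it.
    no-gap : ∀ {γ₁ γ₂} (bin₁ : Binary γ₁) (bin₂ : Binary γ₂) →
      _∈_ {Cube (suc n′)} (point c m {γ₁} bin₁) A → _∈_ {Cube (suc n′)} (point c m {γ₂} bin₂) A → (J : Fin (suc n′)) (I : ℕ) →
      ¬ (suc (suc (prefix (bitsAt c m γ₁ (toℕ J)) I)) ≤ℕ prefix (bitsAt c m γ₂ (toℕ J)) I)
    no-gap {γ₁} {γ₂} bin₁ bin₂ in₁ in₂ J I gap =
      refute (bits-of-prefix I (ℕ.<-trans gap (prefix< {bitsAt c m γ₂ (toℕ J)} (bitsAt-binary c m bin₂ (toℕ J)) I)))
      where
      free = gap-free A p pA convex c m {γ₁} {γ₂} bin₁ bin₂ in₁ in₂ J I gap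
      m<n : m < suc n′
      m<n = ℕ.≤∧≢⇒< limit≤n λ m≡n → all-pinned m≡n J free
      refute : ∃[ β ] Binary β × prefix β I ≡ suc (prefix (bitsAt c m γ₁ (toℕ J)) I) → ⊥
      refute (β , binβ , β≡) =
        let s , start≤s , as≡m , count≡v = count-attained {a} {m} recurs start {v} v≥ in at s start≤s as≡m count≡v
        where
        -- The part above the prescribed bits makes `v` at least the count at `start`, so this
        -- candidate has not been passed yet.
        e = fromBits β I (countIn a start m)
        v = toℕ J +ℕ e *ℕ suc n′
        v≥ : countIn a start m ≤ℕ v
        v≥ = ℕ.≤-trans (fromBits≥ β I (countIn a start m)) (ℕ.≤-trans (ℕ.m≤m*n e (suc n′)) (ℕ.m≤n+m (e *ℕ suc n′) (toℕ J)))
        at : ∀ s → start ≤ℕ s → a s ≡ m → countIn a s m ≡ v → ⊥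
        at s start≤s as≡m count≡v = hyperplane-met A p pA convex c m {γ₁} {γ₂} bin₁ bin₂ in₁ in₂ J I gap (cs s)
          (λ l<m → sym (settled start≤s l<m)) onJ digits s (1∸≢0 rejected)
          where
          csm : cs s m ≡ v
          csm = trans (cs≡ s m) count≡v
          onJ : cs s m % suc n′ ≡ toℕ J
          onJ = trans (cong (_% suc n′) csm) (proj₁ (modDiv-unique e (toℕ<n J)))
          digits : prefix (digit 1 (cs s m / suc n′)) I ≡ suc (prefix (bitsAt c m γ₁ (toℕ J)) I)
          digits = trans (cong (λ x → prefix (digit 1 x) I) (trans (cong (_/ suc n′) csm) (proj₂ (modDiv-unique e (toℕ<n J)))))
            (trans (prefix-cong {digit 1 e} {β} I (digit-fromBits {β} binβ I (countIn a start m))) β≡)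
          Es≡m : emission p s ≡ m
          Es≡m = trans (sym (a≡ s)) as≡m
          unpinned : pinned (cs s) m (cs s m % suc n′) ≡ 0
          unpinned = trans (cong (pinned (cs s) m) onJ)
            (trans (pinned-cong {cs s} {c} m (toℕ J) (settled start≤s)) free)
          rejected : 1 ∸ survivors p (cs s) (suc m) s 0 0 2 ≢ 0
          rejected z = subst (λ l → reject p (cs s) s l ≢ 0) Es≡m
            (emit-rejected p (cs s) s (subst (_< (suc n′)) (sym Es≡m) m<n)) (cong₂ _+ℕ_ unpinned z)

    module _ (f : Baire) (fA : f Names A)
             (b′ : Baire) (b′≡ : ∀ k → b′ k ≡ b k)
             {γ : Bits} (bin : Binary γ) (γ∈A : _∈_ {Cube (suc n′)} (point c m {γ} bin) A) where

      stage-counts : ∀ s {l} → l < b′ s → count (packed b′ s) s l ≡ c l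
      stage-counts s {l} l< = trans (count-packing {packed b′} {b′} (refl , λ _ → refl)
          (λ s → ℕ.≤-trans (subst (_≤ℕ m) (sym (b′≡ s)) (b≤limit s)) limit≤n) s l)
        (trans (sumTo-cong s λ {k} _ → cong (λ x → eq x l) (b′≡ k)) (counts s (subst (l <_) (b′≡ s) l<)))

      -- Certificates for fewer levels remain sound: `γ′` supplies all bits of the point as free
      -- bits, including those pinned from level `k` on, while the pins below `k` are the same.
      certified : ∀ k → k ≤ℕ m → ∀ s (J : Fin (suc n′)) i q → toℕ J +ℕ i *ℕ suc n′ ≤ℕ s →
                  survivors f c k s (toℕ J) i q ≡ 0 → near (prefix (bitsAt c m γ (toℕ J)) i) q ≢ 0
      certified k k≤m s J i q big z = subst (λ x → near x q ≢ 0)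
        (prefix-cong {bitsAt c k γ′ (toℕ J)} {bitsAt c m γ (toℕ J)} i λ {x} _ → sym (same J x))
        (certificate-near A f fA c k s (toℕ J) i q z (inj₁ big) {γ′}
          (λ x → bitsAt-binary c m {γ} bin (toℕ (x mod suc n′)) (x / suc n′)) (point c m {γ} bin)
          (λ j → Expansion-cong {bitsAt c m γ (toℕ j)} {bitsAt c k γ′ (toℕ j)} {proj₁ (point c m {γ} bin j)}
            (same j) (fromBinary-expansion {bitsAt c m γ (toℕ j)} (bitsAt-binary c m {γ} bin (toℕ j))))
          γ∈A)
        where
        digits : Fin (suc n′) → Bits
        digits j = bitsAt c m γ (toℕ j)
        γ′ = weave (suc n′) digits
        same : ∀ j x → bitsAt c m γ (toℕ j) x ≡ bitsAt c k γ′ (toℕ j) x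
        same j x = cases (pinned c k (toℕ j)) refl
          where
          cases : ∀ e → pinned c k (toℕ j) ≡ e → bitsAt c m γ (toℕ j) x ≡ bitsAt c k γ′ (toℕ j) x
          cases zero    pe = bitsAt-weave c k digits j pe x
          cases (suc e) pe = trans (bitsAt-pinned c m γ {toℕ j} {e} (pinned-mono c {k} {m} k≤m {toℕ j} {e} pe) x)
                                   (sym (bitsAt-pinned c k γ′ {toℕ j} {e} pe x))

      attempt-sound : ∀ (J : Fin (suc n′)) i s q → toℕ J +ℕ suc i *ℕ suc n′ ≤ℕ s →
                      attempt f b′ (toℕ J) i s q ≡ 0 → near (prefix (bitsAt c m γ (toℕ J)) (suc i)) q ≢ 0
      attempt-sound J i s q big z = certified (b′ s) (subst (_≤ℕ m) (sym (b′≡ s)) (b≤limit s)) s J (suc i) q big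
        (trans (sym (survivors-cong {f} {count (packed b′ s) s} {c} (b′ s) s (toℕ J) (suc i) q (stage-counts s))) z)

      miss-sound : ∀ (J : Fin (suc n′)) i w → miss f b′ (toℕ J) i w ≡ 0 →
                   near (prefix (bitsAt c m γ (toℕ J)) (suc i)) (guess i w) ≢ 0
      miss-sound J i w = attempt-sound J i (stage (toℕ J) i w) (guess i w)
        (ℕ.m≤n+m (toℕ J +ℕ suc i *ℕ suc n′) (w / suc (2 ^ℕ suc i)))

      no-rival : ∀ (J : Fin (suc n′)) i → ¬ (∃[ γ₂ ] Σ[ bin₂ ∈ Binary γ₂ ] _∈_ {Cube (suc n′)} (point c m {γ₂} bin₂) A ×
                   near (prefix (bitsAt c m γ₂ (toℕ J)) i) (prefix (bitsAt c m γ (toℕ J)) i) ≡ 0)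
      no-rival J i (γ₂ , bin₂ , in₂ , far) = cases (far⇒ {prefix (bitsAt c m γ₂ (toℕ J)) i} {q} far)
        where
        q = prefix (bitsAt c m γ (toℕ J)) i
        cases : suc q < prefix (bitsAt c m γ₂ (toℕ J)) i ⊎ suc (prefix (bitsAt c m γ₂ (toℕ J)) i) < q → ⊥
        cases (inj₁ gap) = no-gap {γ} {γ₂} bin bin₂ γ∈A in₂ J i gap
        cases (inj₂ gap) = no-gap {γ₂} {γ} bin₂ bin in₂ γ∈A J i gap

      Certified : ℕ → Fin (suc n′) → ℕ → Set
      Certified S₀ J i = ∃[ s ] S₀ ≤ℕ s × survivors f c m s (toℕ J) i (prefix (bitsAt c m γ (toℕ J)) i) ≡ 0

      -- Without a certificate, compactness would produce a second point whose coordinate is far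
      -- from that of the first. Existence is shown classically, which is enough for the search to
      -- halt.
      certificate-exists : ∀ S₀ (J : Fin (suc n′)) i → toℕ J +ℕ i *ℕ suc n′ ≤ℕ S₀ → Certified S₀ J i
      certificate-exists S₀ J i big = decidable-stable em λ h →
        no-rival J i (compactness A f fA c m (toℕ J) i (prefix (bitsAt c m γ (toℕ J)) i) S₀ (inj₁ big)
          λ {s} S₀≤s z → h (s , S₀≤s , z))

      attempt-hits : ∀ (J : Fin (suc n′)) i → ∃[ s ] toℕ J +ℕ suc i *ℕ suc n′ ≤ℕ s ×
                     attempt f b′ (toℕ J) i s (prefix (bitsAt c m γ (toℕ J)) (suc i)) ≡ 0
      attempt-hits J i = hit (certificate-exists (proj₁ final ⊔ t) J (suc i) (ℕ.m≤n⊔m (proj₁ final) t))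
        where
        t = toℕ J +ℕ suc i *ℕ suc n′
        q = prefix (bitsAt c m γ (toℕ J)) (suc i)
        hit : ∃[ s ] proj₁ final ⊔ t ≤ℕ s × survivors f c m s (toℕ J) (suc i) q ≡ 0 →
              ∃[ s ] t ≤ℕ s × attempt f b′ (toℕ J) i s q ≡ 0
        hit (s , l , z) = s , ℕ.m⊔n≤o⇒n≤o (proj₁ final) t l ,
          trans (survivors-cong {f} {count (packed b′ s) s} {c} (b′ s) s (toℕ J) (suc i) q (stage-counts s))
            (trans (cong (λ k → survivors f c k s (toℕ J) (suc i) q) b′s≡m) z)
          where
          b′s≡m : b′ s ≡ m
          b′s≡m = trans (b′≡ s) (proj₂ final (ℕ.m⊔n≤o⇒m≤o (proj₁ final) t l))

      miss-hits : ∀ (J : Fin (suc n′)) i → ∃[ w ] miss f b′ (toℕ J) i w ≡ 0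
      miss-hits J i =
        let s , l , z = attempt-hits J i
            w , stage≡ , guess≡ = request (toℕ J) i s (prefix (bitsAt c m γ (toℕ J)) (suc i)) l
              (ℕ.m<n⇒m<1+n (prefix< {bitsAt c m γ (toℕ J)} (bitsAt-binary c m {γ} bin (toℕ J)) (suc i)))
        in w , trans (cong₂ (attempt f b′ (toℕ J) i) stage≡ guess≡) z

      module _ (r : Baire) (w : ℕ → ℕ)
        (r≡ : ∀ P → r P ≡ answer P (w P))
        (w-hits : ∀ P → miss f b′ (P % suc n′) (P / suc n′ / 3) (w P) ≡ 0) where

        answer-close : ∀ (J : Fin (suc n′)) e i → e < 3 →
          near (prefix (bitsAt c m γ (toℕ J)) (suc i)) (guess i (w (index J e i))) ≢ 0
        answer-close J e i e<3 = miss-sound J i (w (index J e i)) (subst₂ (λ j k → miss f b′ j k (w (index J e i)) ≡ 0)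
            (index-coordinate J e i) (index-precision J e i e<3) (w-hits (index J e i)))

        answers-name : RepresentedSpace._names_ (Cube (suc n′)) r (point c m {γ} bin)
        answers-name J i = subst (λ q → fromℚ (q ℚ.- 2⁻ i) ≤ y × y ≤ fromℚ (q ℚ.+ 2⁻ i)) (sym rational≡)
          ( ≤-trans {fromℚ (dyadic q (suc i) ℚ.- 2⁻ i)} {fromℚ (lo β (suc i))} {y}
              (≤-eventually {fromℚ (dyadic q (suc i) ℚ.- 2⁻ i)} {fromℚ (lo β (suc i))} 0 (λ _ → below)) (proj₁ (ex (suc i)))
          , ≤-trans {y} {fromℚ (lo β (suc i) ℚ.+ 2⁻ suc i)} {fromℚ (dyadic q (suc i) ℚ.+ 2⁻ i)}
              (proj₂ (ex (suc i)))
              (≤-eventually {fromℚ (lo β (suc i) ℚ.+ 2⁻ suc i)} {fromℚ (dyadic q (suc i) ℚ.+ 2⁻ i)} 0 (λ _ → upper)))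
          where
          open +-*-Solver
          β = bitsAt c m γ (toℕ J)
          y = proj₁ (point c m {γ} bin J)
          ex : Expansion β y
          ex = fromBinary-expansion {β} (bitsAt-binary c m {γ} bin (toℕ J))
          -- The three entries of a rational are answered by separate searches, which may end
          -- differently; the rational is still well determined, since the subtrahend and the
          -- denominator do not depend on the result.
          q = guess i (w (index J 0 i))
          entry≡ : ∀ e → e < 3 → r (index J e i) ≡ eq e 0 *ℕ guess i (w (index J e i)) +ℕ eq e 2 *ℕ (2 ^ℕ suc i ∸ 1)
          entry≡ e e<3 = trans (r≡ (index J e i)) (answer-index J e i (w (index J e i)) e<3)
          rational≡ : rational (column (suc n′) r J) i ≡ dyadic q (suc i)
          rational≡ = rational-dyadic (column (suc n′) r J) {q} {i} {suc i}
            (trans (entry≡ 0 (s≤s z≤n)) (trans (ℕ.+-identityʳ _) (ℕ.+-identityʳ _)))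
            (entry≡ 1 (s≤s (s≤s z≤n)))
            (trans (entry≡ 2 (s≤s (s≤s (s≤s z≤n)))) (ℕ.+-identityʳ _))
          close = near⇒ {prefix β (suc i)} {q} (answer-close J 0 i (s≤s z≤n))
          ≤suc : ∀ {x z} → x ≤ℕ suc z → dyadic x (suc i) ℚ.≤ dyadic z (suc i) ℚ.+ 2⁻ suc i
          ≤suc {x} {z} l = subst (dyadic x (suc i) ℚ.≤_) (dyadic-suc z (suc i)) (dyadic-mono {x} {suc z} (suc i) l)
          below : dyadic q (suc i) ℚ.- 2⁻ i ℚ.≤ lo β (suc i)
          below = ℚ.≤-trans (ℚ.+-monoˡ-≤ (ℚ.- 2⁻ i) (≤suc {q} {prefix β (suc i)} (proj₂ close)))
            (≤-+-nonneg (2⁻-nonneg (suc i))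
              (solve 2 (λ l t → l := ((l :+ con ½ :* t) :- t) :+ con ½ :* t) refl (lo β (suc i)) (2⁻ i)))
          upper : lo β (suc i) ℚ.+ 2⁻ suc i ℚ.≤ dyadic q (suc i) ℚ.+ 2⁻ i
          upper = ℚ.≤-trans (ℚ.+-monoˡ-≤ (2⁻ suc i) (≤suc {prefix β (suc i)} {q} (proj₁ close)))
            (ℚ.≤-reflexive (trans (ℚ.+-assoc (dyadic q (suc i)) (2⁻ suc i) (2⁻ suc i)) (cong (dyadic q (suc i) ℚ.+_) (2⁻-half i))))

    module _ (o : Baire) (fA : evens o Names A) (odds≡ : ∀ k → odds o k ≡ b k) where

      Solved : Set
      Solved = ∃[ r ] graph (computedBy outer) o r × ∃[ x ] RepresentedSpace._names_ (Cube (suc n′)) r x ×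
                 Convex A × _∈_ {Cube (suc n′)} x A

      module _ {γ : Bits} (bin : Binary γ) (γ∈A : _∈_ {Cube (suc n′)} (point c m {γ} bin) A) where

        miss-hits-at : ∀ P → ∃[ w ] miss (evens o) (odds o) (P % suc n′) (P / suc n′ / 3) w ≡ 0
        miss-hits-at P = subst (λ j → ∃[ w ] miss (evens o) (odds o) j (P / suc n′ / 3) w ≡ 0)
          (toℕ-fromℕ< (m%n<n P (suc n′)))
          (miss-hits (evens o) fA (odds o) odds≡ {γ} bin γ∈A (P mod suc n′) (P / suc n′ / 3))

        found : ∀ P → ∃[ w ] miss (evens o) (odds o) (P % suc n′) (P / suc n′ / 3) w ≡ 0 × o ⊢ outer [ P ∷ [] ]⇓ answer P w
        found P = outer⇓ o P {proj₁ (miss-hits-at P)} (proj₂ (miss-hits-at P))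

        solved-at : Solved
        solved-at = r , (λ P → proj₂ (proj₂ (found P))) , point c m {γ} bin
          , answers-name (evens o) fA (odds o) odds≡ {γ} bin γ∈A r (λ P → proj₁ (found P))
              (λ _ → refl) (λ P → proj₁ (proj₂ (found P)))
          , convex , γ∈A
          where
          r : Baire
          r P = answer P (proj₁ (found P))

      solved : Solved
      solved = solved-from inhabited
        where
        solved-from : Inhabited m → Solved
        solved-from (γ , bin , γ∈A) = solved-at {γ} bin γ∈A

  emitted : Baire → ℕ → Fin (suc (suc n′))
  emitted p s = fromℕ< (s≤s (emit≤ p (count (history p s) s) s))

  emitted≡ : ∀ p s → toℕ (emitted p s) ≡ emission p s
  emitted≡ p s = toℕ-fromℕ< (s≤s (emit≤ p (count (history p s) s) s))

  reduces : ∀ G → _⊩_ {Symbols^ω (suc (suc n′))} {Symbols^ω (suc (suc n′))} G (Sort (suc (suc n′))) →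
            _⊩_ {𝒜 (Cube (suc n′))} {Cube (suc n′)} (wrap (computedBy inner) (computedBy outer) G) (XC (suc n′))
  reduces G G⊩ {p} {A} pA (origin , convex , origin∈A) =
    conclude (G⊩ {emission p} {emitted p} (λ s → sym (emitted≡ p s)) (sort-defined em (emitted p)))
    where
    wrapped : p Names A
    wrapped = record { named = λ {q} {x} → pA {q} {x} }

    conclude : (∃[ s ] graph G (emission p) s × ∃[ y ]
                 RepresentedSpace._names_ (Symbols^ω (suc (suc n′))) s y × rel (Sort (suc (suc n′))) (emitted p) y) →
      ∃[ r ] graph (wrap (computedBy inner) (computedBy outer) G) p r ×
        ∃[ x ] RepresentedSpace._names_ (Cube (suc n′)) r x × Convex A × _∈_ {Cube (suc n′)} x A
    conclude (s , Gs , y , sy , sorted) = assemble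
      (solved A convex origin origin∈A p wrapped (toℕ ∘ emitted p) (toℕ ∘ y) (emitted≡ p)
        (sort-sorts em (emitted p) y sorted) ⟨ p , s ⟩
        (record { named = RepresentedSpace.resp-names (𝒜 (Cube (suc n′))) {p} {evens ⟨ p , s ⟩} {A} {A}
                            (λ x → sym (evens-⟨⟩ p s x)) (λ _ → refl) (λ {q} {x} → pA {q} {x}) })
        (λ k → trans (odds-⟨⟩ p s k) (sy k)))
      where
      assemble : (∃[ r ] graph (computedBy outer) ⟨ p , s ⟩ r ×
          ∃[ x ] RepresentedSpace._names_ (Cube (suc n′)) r x × Convex A × _∈_ {Cube (suc n′)} x A) →
        ∃[ r ] graph (wrap (computedBy inner) (computedBy outer) G) p r ×
          ∃[ x ] RepresentedSpace._names_ (Cube (suc n′)) r x × Convex A × _∈_ {Cube (suc n′)} x A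
      assemble (r , Kr , x , rx , sol) =
        r , (emission p , s , (λ k → proj₂ emissionᴾ p (k ∷ [])) , Gs , Kr) , x , rx , sol

theorem18 : ExcludedMiddle 0ℓ → ∀ (n : ℕ) → n ≥ 1 → XC n ≤W Sort (suc n)
theorem18 em (suc n′) _ =
  computedBy inner , computedBy outer , computedBy-computable inner , computedBy-computable outer , reduces
  where open Reduction em n′
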